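{- For every $k \geq 0$, there exist graphs $G$ and $H$ such that $G \equiv_{\mathcal{H}_k} H$ and $G \not\equiv_{\mathcal{H}_{k+1}} H$.
   Context: All graphs are finite, simple and loopless. For a graph class $\mathcal{F}$, $G\equiv_{\mathcal{F}}H$ means $\hom(F,G)=\hom(F,H)$ for every $F\in\mathcal{F}$, where $\hom(F,G)$ is the number of homomorphisms $F\to G$. For $g,d\geq 0$, let $\mathcal{C}_{g,d}$ be the class of graphs $G$ having a set $S\subseteq V(G)$ with $|S|\leq d$ such that $G-S$ has Euler genus $\leq g$. For a graph $G$ and $X\subseteq V(G)$, the torso of $G$ on $X$ is the graph with vertex set $X$ whose edges are the edges of $G$ with both endpoints in $X$ together with all pairs $xy$ with $x,y\in N_G(C)$ for some connected component $C$ of $G-X$. For a class $\mathcal{C}$ and $s\geq0$, $\mathcal{C}^{\oplus s}$ is the class of graphs $G$ admitting a tree decomposition $(T,\beta)$ with $|\beta(t)\cap\beta(t')|\leq s$ for every $tt'\in E(T)$ and such that the torso of $G$ on $\beta(t)$ lies in $\mathcal{C}$ for every $t\in V(T)$. $\mathcal{H}_k \coloneqq \mathcal{C}_{k,k}^{\oplus k}$ is the class of graphs of vortex-free Hadwiger number at most $k$. -}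

module Defs where

open import Data.Nat using (ℕ; zero; suc; _+_; _*_; _∸_; _≤_; _≤ᵇ_; _/_)
open import Data.Nat.Base using (⌊_/2⌋)
open import Data.Fin using (Fin; zero; suc; toℕ; _≟_)
open import Data.Bool using (Bool; true; false; _∧_; _∨_; not; if_then_else_; _xor_)
open import Data.List using (List; []; _∷_; map; concatMap; length; filterᵇ; allFin; upTo)
open import Data.Bool.ListAction using (all; any)
open import Data.Nat.ListAction using (sum)
open import Data.Product using (Σ; _×_; _,_)
open import Relation.Binary.PropositionalEquality using (_≡_)
open import Relation.Nullary using (¬_; does)

Adj : ℕ → Set
Adj n = Fin n → Fin n → Bool

record Graph (n : ℕ) : Set where
  field
    adj    : Adj n
    sym    : ∀ u v → adj u v ≡ adj v u
    irrefl : ∀ v → adj v v ≡ false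
open Graph public

anyF : (n : ℕ) → (Fin n → Bool) → Bool
anyF n p = any p (allFin n)

allF : (n : ℕ) → (Fin n → Bool) → Bool
allF n p = all p (allFin n)

countF : (n : ℕ) → (Fin n → Bool) → ℕ
countF n p = length (filterᵇ p (allFin n))

_==_ : ∀ {n} → Fin n → Fin n → Bool
u == v = does (u ≟ v)

allFuns : (a b : ℕ) → List (Fin a → Fin b)
allFuns zero    b = (λ ()) ∷ []
allFuns (suc a) b = concatMap (λ f → map (λ x → ext x f) (allFin b)) (allFuns a b)
  where
  ext : Fin b → (Fin a → Fin b) → Fin (suc a) → Fin b
  ext x f zero    = x
  ext x f (suc i) = f i

isHom : ∀ {a b} → Graph a → Graph b → (Fin a → Fin b) → Bool
isHom {a} F G f = allF a (λ u → allF a (λ v → not (adj F u v) ∨ adj G (f u) (f v)))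

hom : ∀ {a b} → Graph a → Graph b → ℕ
hom {a} {b} F G = length (filterᵇ (isHom F G) (allFuns a b))

Mask : ℕ → Set
Mask n = Fin n → Bool

adjM : ∀ {n} → Adj n → Mask n → Adj n
adjM A X u v = X u ∧ X v ∧ A u v

reachK : ∀ {n} → ℕ → Adj n → Fin n → Fin n → Bool
reachK zero    A u w = u == w
reachK {n} (suc k) A u w = reachK k A u w ∨ anyF n (λ x → reachK k A u x ∧ A x w)

reach : ∀ {n} → Adj n → Fin n → Fin n → Bool
reach {n} = reachK n

-- Euler genus, via general (signed) rotation systems (Mohar–Thomassen).
-- All counts are for the subgraph induced on the mask X.

iter : ∀ {A : Set} → (A → A) → ℕ → A → A
iter f zero    x = x
iter f (suc i) x = f (iter f i x)

numVerts : ∀ {n} → Mask n → ℕ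
numVerts {n} X = countF n X

sumF : (n : ℕ) → (Fin n → ℕ) → ℕ
sumF n f = sum (map f (allFin n))

numDarts : ∀ {n} → Adj n → Mask n → ℕ
numDarts {n} A X = sumF n (λ u → countF n (λ v → adjM A X u v))

numEdges : ∀ {n} → Adj n → Mask n → ℕ
numEdges A X = ⌊ numDarts A X /2⌋

numComps : ∀ {n} → Adj n → Mask n → ℕ
numComps {n} A X = countF n (λ v → X v ∧
  allF n (λ u → not (X u ∧ reach (adjM A X) u v) ∨ (toℕ v ≤ᵇ toℕ u)))

numIsolated : ∀ {n} → Adj n → Mask n → ℕ
numIsolated {n} A X = countF n (λ v → X v ∧ not (anyF n (adjM A X v)))

-- A general rotation system of the subgraph induced on X:
-- ρ v is a cyclic permutation of N(v) (with inverse ρ' v), λ a symmetric edge signature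
-- (true = twisted / negative edge).
record RotSystem {n : ℕ} (A : Adj n) (X : Mask n) : Set where
  field
    ρ  : Fin n → Fin n → Fin n
    ρ' : Fin n → Fin n → Fin n
    sig : Fin n → Fin n → Bool
    ρ-closed  : ∀ v u → adjM A X v u ≡ true → adjM A X v (ρ v u) ≡ true
    ρ'-closed : ∀ v u → adjM A X v u ≡ true → adjM A X v (ρ' v u) ≡ true
    ρρ' : ∀ v u → adjM A X v u ≡ true → ρ v (ρ' v u) ≡ u
    ρ'ρ : ∀ v u → adjM A X v u ≡ true → ρ' v (ρ v u) ≡ u
    cyclic : ∀ v u w → adjM A X v u ≡ true → adjM A X v w ≡ true →
             Σ ℕ (λ i → iter (ρ v) i u ≡ w)
    sig-sym : ∀ u v → sig u v ≡ sig v u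

-- face-tracing state: dart u → v together with a local orientation bit
State : ℕ → Set
State n = Fin n × Fin n × Bool

module _ {n : ℕ} {A : Adj n} {X : Mask n} (R : RotSystem A X) where
  open RotSystem R

  -- face-tracing step (Mohar–Thomassen face traversal procedure)
  trace : State n → State n
  trace (u , v , s) =
    let s' = s xor sig u v in
    (v , (if s' then ρ v u else ρ' v u) , s')

  code : State n → ℕ
  code (u , v , s) = toℕ u * (2 * n) + toℕ v * 2 + (if s then 1 else 0)

  isRep : State n → Bool
  isRep x = all (λ i → code x ≤ᵇ code (iter trace i x)) (upTo (suc (2 * n * n)))

  numOrbits : ℕ
  numOrbits = sumF n (λ u → sumF n (λ v →
    (if adjM A X u v ∧ isRep (u , v , true)  then 1 else 0) +
    (if adjM A X u v ∧ isRep (u , v , false) then 1 else 0)))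

  -- each face is traced exactly twice (once in each direction);
  -- isolated vertices are components embedded in a sphere with one face
  numFaces : ℕ
  numFaces = ⌊ numOrbits /2⌋ + numIsolated A X

-- Euler genus of the subgraph induced on X is ≤ g:
-- there is a rotation system with Σ_components (2 - V_i + E_i - F_i) ≤ g
-- (Euler genus is additive over components; the minimum over cellular embeddings
-- of each component is its Euler genus).
EulerGenus≤ : ∀ {n} → ℕ → Adj n → Mask n → Set
EulerGenus≤ g A X = Σ (RotSystem A X) (λ R →
  2 * numComps A X + numEdges A X ≤ g + numVerts X + numFaces R)

InC : ∀ {n} → ℕ → ℕ → Adj n → Mask n → Set
InC {n} g d A X = Σ (Mask n) (λ S →
  (∀ v → S v ≡ true → X v ≡ true) ×
  countF n S ≤ d ×
  EulerGenus≤ g A (λ v → X v ∧ not (S v)))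

torso : ∀ {n} → Adj n → Mask n → Adj n
torso {n} A X x y = X x ∧ X y ∧ not (x == y) ∧
  (A x y ∨ anyF n (λ c₁ → anyF n (λ c₂ →
     not (X c₁) ∧ not (X c₂) ∧ A x c₁ ∧ A y c₂ ∧
     reach (adjM A (λ z → not (X z))) c₁ c₂)))

full : ∀ {n} → Mask n
full _ = true

record IsTree {t : ℕ} (T : Adj t) : Set where
  field
    sym       : ∀ a b → T a b ≡ T b a
    irrefl    : ∀ a → T a a ≡ false
    nonempty  : 1 ≤ t
    connected : ∀ a b → reach T a b ≡ true
    edges     : numEdges T full ≡ t ∸ 1

record TreeDecomposition {n : ℕ} (A : Adj n) : Set where
  field
    t      : ℕ
    T      : Adj t
    isTree : IsTree T
    β      : Fin t → Mask n
    coverV : ∀ v → Σ (Fin t) (λ x → β x v ≡ true)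
    coverE : ∀ u v → A u v ≡ true → Σ (Fin t) (λ x → β x u ∧ β x v ≡ true)
    subtree : ∀ v x y → β x v ≡ true → β y v ≡ true →
              reach (adjM T (λ z → β z v)) x y ≡ true

InSumC : ℕ → ℕ → ℕ → ∀ {n} → Graph n → Set
InSumC g d s {n} G = Σ (TreeDecomposition (adj G)) (λ D →
  let open TreeDecomposition D in
  (∀ x y → T x y ≡ true → countF n (λ v → β x v ∧ β y v) ≤ s) ×
  (∀ x → InC g d (torso (adj G) (β x)) (β x)))

ℋ : ℕ → ∀ {n} → Graph n → Set
ℋ k = InSumC k k k

HomEquivℋ : ℕ → ∀ {n m} → Graph n → Graph m → Set
HomEquivℋ k G H = ∀ (a : ℕ) (F : Graph a) → ℋ k F → hom F G ≡ hom F H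

{-# OPTIONS --safe #-}
module Submission where

-- The graphs are the even and odd Cai–Fürer–Immerman graphs of Γ = K_{k+1} ∨ r·K₅ with r = 3k + 1. Γ lies
-- in ℋ_{k+1}: glue the cliques K_{k+1} ∨ K₅ along K_{k+1}, with K₅ drawn in the projective plane.
--
-- If K distinguishes the two graphs, then by the Fredholm alternative over 𝔽₂ some homomorphism φ : K → Γ
-- carries a certificate (y , z), which is a chain map C(Γ) → C(K) over φ that preserves augmentation. Since Γ
-- is (k+1)-connected, adhesions of size k cannot balance it, so following the odd side down a tree
-- decomposition leads to one bag all of whose relevant flaps are even. After removing the apices and the
-- adhesion, k + 1 of the K₅ survive, and retracting the flaps turns z into chain maps C(K₅) → C(torso) which
-- send disjoint simplices to disjoint supports.
--
-- A rotation system gives a bilinear form B on 1-chains with B(x , y) + B(y , x) = ⟨∂x , ∂y⟩ for which face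
-- boundaries are orthogonal to cycles. Summing B over the three pairs of triangles through one vertex of K₅
-- (the van Kampen obstruction) yields two cycles with B = 1. The k + 1 disjoint copies force rank k + 1, but
-- the rank of B on cycles is at most the Euler genus, i.e. at most k.

-- A certificate is a mod 2 object. It produces neither a minor nor a subdivision of Γ inside a bag,
-- so large genus cannot be read off from a forbidden subgraph; this is why K₅ enters only through
-- the van Kampen obstruction, which a chain map already carries. For the same reason the copies of
-- K₅ are added up by the rank of one bilinear form instead of by additivity of Euler genus. The
-- other obstacle is the torso: its new edges need not lie over edges of Γ. Each edge w w′ of Γ
-- therefore gets a retraction of its own, into the fibres of w and w′ only, and the evenness of the
-- flaps is what makes the pushed vertex chain over w independent of w′. The core K_{k+1} consists
-- of dominating vertices: when k fibres are excluded, one core vertex is left, and it equalises the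
-- parity of y over all remaining fibres. In the decomposition of Γ the same core is both the
-- adhesion and the apex set, which costs k + 1 in both budgets and leaves a single K₅ of Euler
-- genus 1.

open import Defs hiding (sym)
open import Algebra.Bundles using (CommutativeRing)
open import Data.Bool using (Bool; true; false; _∧_; _∨_; not; if_then_else_; _xor_; T)
open import Data.Bool.ListAction using (all; any)
open import Data.Bool.Properties using (xor-∧-commutativeRing; xor-same; xor-comm; xor-assoc; xor-identityʳ; ∧-zeroʳ; ∧-comm; ∧-assoc; ∧-idem; ∧-identityʳ; ∧-distribˡ-xor; ∧-distribʳ-xor; ∧-distribˡ-∨; ∨-comm)
open import Data.Bool.Solver using (module xor-∧-Solver)
open import Data.Empty using (⊥; ⊥-elim)
open import Data.Fin using (Fin; zero; suc; toℕ; _≟_; _↑ˡ_; _↑ʳ_; combine; remQuot; splitAt; join; finToFun; funToFin)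
import Data.Fin.Properties as Fin
open import Data.List using (List; []; _∷_; map; concatMap; length; filterᵇ; allFin; tabulate; _++_; upTo; applyUpTo)
open import Data.Nat using (ℕ; zero; suc; _+_; _*_; _^_; _∸_; _≤_; _<_; _≤ᵇ_; z≤n; s≤s; s≤s⁻¹; ⌊_/2⌋; _≤′_; ≤′-reflexive; ≤′-step)
open import Data.Nat.Induction using (<-rec)
open import Data.Nat.ListAction using (sum)
import Data.Nat.Properties as ℕ
open import Data.Product using (Σ; ∃; _×_; _,_; _,′_; proj₁; proj₂)
open import Data.Sum using (_⊎_; inj₁; inj₂; [_,_]′)
open import Function using (_∘_; id; case_of_)
open import Relation.Binary.Construct.Closure.ReflexiveTransitive using (Star; ε; _◅_; _◅◅_; reverse)
open import Relation.Binary.Definitions using (tri<; tri≈; tri>)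
open import Relation.Binary.PropositionalEquality using (_≡_; _≢_; refl; sym; trans; cong; cong₂; subst; module ≡-Reasoning)
open import Relation.Nullary using (¬_; Dec; yes; no; does)
open import Relation.Nullary.Decidable using (dec-true; dec-false)

import Algebra.Properties.Semiring.Sum (CommutativeRing.semiring xor-∧-commutativeRing) as Xor
import Algebra.Properties.Semiring.Sum ℕ.+-*-semiring as Add

-- Opaque, so that unification treats the summation operators as injective.
opaque
  ⨁ : ∀ {n} → (Fin n → Bool) → Bool
  ⨁ = Xor.sum

  ⨁-zero : (f : Fin 0 → Bool) → ⨁ f ≡ false
  ⨁-zero f = refl

  ⨁-suc : ∀ {n} (f : Fin (suc n) → Bool) → ⨁ f ≡ f zero xor ⨁ (λ i → f (suc i))
  ⨁-suc f = refl

  ⨁-cong : ∀ {n} {f g : Fin n → Bool} → (∀ i → f i ≡ g i) → ⨁ f ≡ ⨁ g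
  ⨁-cong = Xor.sum-cong-≗

  ⨁-xor : ∀ {n} (f g : Fin n → Bool) → ⨁ (λ i → f i xor g i) ≡ ⨁ f xor ⨁ g
  ⨁-xor = Xor.∑-distrib-+

  ⨁-swap : ∀ {m n} (f : Fin m → Fin n → Bool) → ⨁ (λ i → ⨁ (f i)) ≡ ⨁ (λ j → ⨁ (λ i → f i j))
  ⨁-swap = Xor.∑-comm

  ⨁-∧ˡ : ∀ {n} b (f : Fin n → Bool) → b ∧ ⨁ f ≡ ⨁ (λ i → b ∧ f i)
  ⨁-∧ˡ = Xor.*-distribˡ-sum

  ⨁-false : ∀ {n} {f : Fin n → Bool} → (∀ i → f i ≡ false) → ⨁ f ≡ false
  ⨁-false {n} h = trans (⨁-cong h) (Xor.sum-replicate-zero n)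

  ∑ : ∀ {n} → (Fin n → ℕ) → ℕ
  ∑ = Add.sum

  ∑-zero : (f : Fin 0 → ℕ) → ∑ f ≡ 0
  ∑-zero f = refl

  ∑-suc : ∀ {n} (f : Fin (suc n) → ℕ) → ∑ f ≡ f zero + ∑ (λ i → f (suc i))
  ∑-suc f = refl

  ∑-cong : ∀ {n} {f g : Fin n → ℕ} → (∀ i → f i ≡ g i) → ∑ f ≡ ∑ g
  ∑-cong = Add.sum-cong-≗

  ∑-+ : ∀ {n} (f g : Fin n → ℕ) → ∑ (λ i → f i + g i) ≡ ∑ f + ∑ g
  ∑-+ = Add.∑-distrib-+

  ∑-swap : ∀ {m n} (f : Fin m → Fin n → ℕ) → ∑ (λ i → ∑ (f i)) ≡ ∑ (λ j → ∑ (λ i → f i j))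
  ∑-swap = Add.∑-comm

  ∑-0 : ∀ {n} {f : Fin n → ℕ} → (∀ i → f i ≡ 0) → ∑ f ≡ 0
  ∑-0 {n} h = trans (∑-cong h) (Add.sum-replicate-zero n)

-- Booleans, decidable equality on `Fin` and bounded search

true≢false : ∀ {b} → b ≡ true → b ≡ false → ⊥
true≢false refl ()

∧-true : ∀ {a b} → a ≡ true → b ≡ true → a ∧ b ≡ true
∧-true refl refl = refl

∧-fst : ∀ {a b} → a ∧ b ≡ true → a ≡ true
∧-fst {true} _ = refl

∧-snd : ∀ {a b} → a ∧ b ≡ true → b ≡ true
∧-snd {true} p = p

∨-injˡ : ∀ {a b} → a ≡ true → a ∨ b ≡ true
∨-injˡ refl = refl

∨-injʳ : ∀ {a b} → b ≡ true → a ∨ b ≡ true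
∨-injʳ {true} _ = refl
∨-injʳ {false} p = p

∨-case : ∀ {a b} → a ∨ b ≡ true → a ≡ true ⊎ b ≡ true
∨-case {true} _ = inj₁ refl
∨-case {false} p = inj₂ p

not-true : ∀ {a} → not a ≡ true → a ≡ false
not-true {false} _ = refl

true-or-false : ∀ b → b ≡ true ⊎ b ≡ false
true-or-false true = inj₁ refl
true-or-false false = inj₂ refl

¬true⇒false : ∀ {b} → (b ≡ true → ⊥) → b ≡ false
¬true⇒false {true} h = ⊥-elim (h refl)
¬true⇒false {false} h = refl

iff⇒≡ : ∀ {a b} → (a ≡ true → b ≡ true) → (b ≡ true → a ≡ true) → a ≡ b
iff⇒≡ {true} f g = sym (f refl)
iff⇒≡ {false} {false} f g = refl
iff⇒≡ {false} {true} f g = g refl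

∧-congʳ-if : ∀ {a b c} → (a ≡ true → b ≡ c) → a ∧ b ≡ a ∧ c
∧-congʳ-if {true} h = h refl
∧-congʳ-if {false} h = refl

xor≡false⇒≡ : ∀ {a b} → a xor b ≡ false → a ≡ b
xor≡false⇒≡ {true} {true} _ = refl
xor≡false⇒≡ {false} {false} _ = refl

toBit : Bool → Fin 2
toBit false = zero
toBit true = suc zero

fromBit : Fin 2 → Bool
fromBit zero = false
fromBit (suc zero) = true

fromBit-toBit : ∀ b → fromBit (toBit b) ≡ b
fromBit-toBit true = refl
fromBit-toBit false = refl

fromBit-injective : ∀ i j → fromBit i ≡ fromBit j → i ≡ j
fromBit-injective zero zero e = refl
fromBit-injective (suc zero) (suc zero) e = refl
fromBit-injective zero (suc zero) ()
fromBit-injective (suc zero) zero ()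

==-refl : ∀ {n} (u : Fin n) → (u == u) ≡ true
==-refl u = dec-true (u ≟ u) refl

==⇒≡ : ∀ {n} (u v : Fin n) → (u == v) ≡ true → u ≡ v
==⇒≡ u v p with u ≟ v
... | yes e = e
... | no _ = case p of λ ()

≢⇒==false : ∀ {n} {u v : Fin n} → u ≢ v → (u == v) ≡ false
≢⇒==false {u = u} {v} ne = dec-false (u ≟ v) ne

≡⇒== : ∀ {n} {u v : Fin n} → u ≡ v → (u == v) ≡ true
≡⇒== {u = u} refl = ==-refl u

==-sym : ∀ {n} (u v : Fin n) → (u == v) ≡ (v == u)
==-sym u v = iff⇒≡ (λ p → ≡⇒== (sym (==⇒≡ u v p))) (λ p → ≡⇒== (sym (==⇒≡ v u p)))

anyF⁺ : ∀ {n} (p : Fin n → Bool) i → p i ≡ true → anyF n p ≡ true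
anyF⁺ {n} p i pi = go id i pi
  where
  go : ∀ {m} (g : Fin m → Fin n) i → p (g i) ≡ true → any p (tabulate g) ≡ true
  go g zero h = ∨-injˡ h
  go g (suc i) h = ∨-injʳ {p (g zero)} (go (g ∘ suc) i h)

anyF⁻ : ∀ {n} (p : Fin n → Bool) → anyF n p ≡ true → ∃ λ i → p i ≡ true
anyF⁻ {n} p = go id
  where
  go : ∀ {m} (g : Fin m → Fin n) → any p (tabulate g) ≡ true → ∃ λ i → p i ≡ true
  go {suc m} g h with ∨-case {p (g zero)} h
  ... | inj₁ q = g zero , q
  ... | inj₂ q = go (g ∘ suc) q

allF⁺ : ∀ {n} (p : Fin n → Bool) → (∀ i → p i ≡ true) → allF n p ≡ true
allF⁺ {n} p h = go id
  where
  go : ∀ {m} (g : Fin m → Fin n) → all p (tabulate g) ≡ true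
  go {zero} g = refl
  go {suc m} g = ∧-true (h (g zero)) (go (g ∘ suc))

allF⁻ : ∀ {n} (p : Fin n → Bool) → allF n p ≡ true → ∀ i → p i ≡ true
allF⁻ {n} p h i = go id i h
  where
  go : ∀ {m} (g : Fin m → Fin n) i → all p (tabulate g) ≡ true → p (g i) ≡ true
  go g zero h = ∧-fst h
  go g (suc i) h = go (g ∘ suc) i (∧-snd {p (g zero)} h)

search : ∀ {n} (p : Fin n → Bool) → (∃ λ i → p i ≡ true) ⊎ (∀ i → p i ≡ false)
search {n} p with true-or-false (anyF n p)
... | inj₁ h = inj₁ (anyF⁻ p h)
... | inj₂ h = inj₂ λ i → ¬true⇒false λ q → true≢false (anyF⁺ p i q) h

-- Canonical representatives come from this search. Its value depends on `p` only pointwise, and on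
-- `d` only if `p` is nowhere true, so equal classes get equal representatives without function
-- extensionality.
firstOr : ∀ {n} {A : Set} → A → (Fin n → Bool) → (Fin n → A) → A
firstOr {zero} d p g = d
firstOr {suc n} d p g = if p zero then g zero else firstOr d (p ∘ suc) (g ∘ suc)

firstOr-cong : ∀ {n} {A : Set} {d : A} {p q : Fin n → Bool} {g : Fin n → A} → (∀ i → p i ≡ q i) → firstOr d p g ≡ firstOr d q g
firstOr-cong {zero} h = refl
firstOr-cong {suc n} {g = g} h = cong₂ (λ b r → if b then g zero else r) (h zero) (firstOr-cong (h ∘ suc))

firstOr-some : ∀ {n} {A : Set} {d : A} (p : Fin n → Bool) (g : Fin n → A) {i} → p i ≡ true → ∃ λ j → p j ≡ true × firstOr d p g ≡ g j
firstOr-some {suc n} p g {i} pi with p zero in eq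
... | true = zero , eq , refl
firstOr-some {suc n} p g {zero} pi | false = ⊥-elim (true≢false pi eq)
firstOr-some {suc n} p g {suc i} pi | false =
  let j , pj , e = firstOr-some (p ∘ suc) (g ∘ suc) {i} pi in suc j , pj , e

-- Finite sums over 𝔽₂

⨁-δ : ∀ {n} (j : Fin n) (f : Fin n → Bool) → ⨁ (λ i → (i == j) ∧ f i) ≡ f j
⨁-δ zero f = trans (⨁-suc _) (trans (cong (f zero xor_) (⨁-false λ _ → refl)) (xor-identityʳ _))
⨁-δ (suc j) f = trans (⨁-suc _) (⨁-δ j (f ∘ suc))

⨁-δ′ : ∀ {n} (j : Fin n) (f : Fin n → Bool) → ⨁ (λ i → (j == i) ∧ f i) ≡ f j
⨁-δ′ j f = trans (⨁-cong λ i → cong (_∧ f i) (==-sym j i)) (⨁-δ j f)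

-- The terms at (a , b) and (b , a) cancel over 𝔽₂. This is the handshake argument behind
-- `certificate⇒¬solution` and `B-sym`.
⨁⨁-symmetric : ∀ {n} {f : Fin n → Fin n → Bool} → (∀ a b → f a b ≡ f b a) → (∀ a → f a a ≡ false) →
  ⨁ (λ a → ⨁ (f a)) ≡ false
⨁⨁-symmetric {zero} s d = ⨁-zero _
⨁⨁-symmetric {suc n} {f} s d = begin
  ⨁ (λ a → ⨁ (f a))
    ≡⟨ trans (⨁-suc _) (cong₂ _xor_ (⨁-suc _) (⨁-cong λ a → ⨁-suc (f (suc a)))) ⟩
  (f zero zero xor ⨁ (λ b → f zero (suc b))) xor ⨁ (λ a → f (suc a) zero xor ⨁ (λ b → f (suc a) (suc b)))
    ≡⟨ cong₂ _xor_ (cong (_xor ⨁ (λ b → f zero (suc b))) (d zero)) (⨁-xor (λ a → f (suc a) zero) _) ⟩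
  ⨁ (λ b → f zero (suc b)) xor (⨁ (λ a → f (suc a) zero) xor ⨁ (λ a → ⨁ (λ b → f (suc a) (suc b))))
    ≡⟨ cong (⨁ (λ b → f zero (suc b)) xor_) (cong₂ _xor_ (⨁-cong λ a → s (suc a) zero) (⨁⨁-symmetric (λ a b → s (suc a) (suc b)) (d ∘ suc))) ⟩
  ⨁ (λ b → f zero (suc b)) xor (⨁ (λ b → f zero (suc b)) xor false) ≡⟨ cong (⨁ (λ b → f zero (suc b)) xor_) (xor-identityʳ _) ⟩
  ⨁ (λ b → f zero (suc b)) xor ⨁ (λ b → f zero (suc b)) ≡⟨ xor-same (⨁ (λ b → f zero (suc b))) ⟩
  false ∎
  where open ≡-Reasoning

⨁-+ : ∀ m {n} (f : Fin (m + n) → Bool) → ⨁ f ≡ ⨁ (λ i → f (i ↑ˡ n)) xor ⨁ (λ j → f (m ↑ʳ j))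
⨁-+ zero f = cong (_xor ⨁ f) (sym (⨁-zero _))
⨁-+ (suc m) {n} f = trans (⨁-suc f) (trans (cong (f zero xor_) (⨁-+ m (f ∘ suc)))
  (trans (sym (xor-assoc (f zero) (⨁ (λ i → f (suc i ↑ˡ n))) (⨁ (λ j → f (suc m ↑ʳ j)))))
         (cong (_xor ⨁ (λ j → f (suc m ↑ʳ j))) (sym (⨁-suc _)))))

⨁-* : ∀ m {n} (f : Fin (m * n) → Bool) → ⨁ f ≡ ⨁ (λ i → ⨁ (λ j → f (combine {m} {n} i j)))
⨁-* zero f = trans (⨁-zero f) (sym (⨁-zero _))
⨁-* (suc m) {n} f = trans (⨁-+ n f) (trans (cong (⨁ (λ j → f (j ↑ˡ (m * n))) xor_) (⨁-* m (λ j → f (n ↑ʳ j)))) (sym (⨁-suc _)))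

-- Counting as summation over ℕ

⟦_⟧ : Bool → ℕ
⟦ true ⟧ = 1
⟦ false ⟧ = 0

cnt : ∀ {n} → (Fin n → Bool) → ℕ
cnt p = ∑ (λ i → ⟦ p i ⟧)

cnt-suc : ∀ {n} (p : Fin (suc n) → Bool) → cnt p ≡ ⟦ p zero ⟧ + cnt (λ i → p (suc i))
cnt-suc p = ∑-suc _

countF≡cnt : ∀ n (p : Fin n → Bool) → countF n p ≡ cnt p
countF≡cnt n p = go id
  where
  go : ∀ {m} (g : Fin m → Fin n) → length (filterᵇ p (tabulate g)) ≡ cnt (λ i → p (g i))
  go {zero} g = sym (∑-zero _)
  go {suc m} g with p (g zero) in eq
  ... | true = trans (cong suc (go (g ∘ suc))) (sym (trans (cnt-suc _) (cong (λ b → ⟦ b ⟧ + cnt (λ i → p (g (suc i)))) eq)))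
  ... | false = trans (go (g ∘ suc)) (sym (trans (cnt-suc _) (cong (λ b → ⟦ b ⟧ + cnt (λ i → p (g (suc i)))) eq)))

sumF≡∑ : ∀ n (f : Fin n → ℕ) → sumF n f ≡ ∑ f
sumF≡∑ n f = go id
  where
  go : ∀ {m} (g : Fin m → Fin n) → sum (map f (tabulate g)) ≡ ∑ (λ i → f (g i))
  go {zero} g = sym (∑-zero _)
  go {suc m} g = trans (cong (f (g zero) +_) (go (g ∘ suc))) (sym (∑-suc _))

∑-mono : ∀ {n} {f g : Fin n → ℕ} → (∀ i → f i ≤ g i) → ∑ f ≤ ∑ g
∑-mono {zero} h = ℕ.≤-reflexive (trans (∑-zero _) (sym (∑-zero _)))
∑-mono {suc n} {f} {g} h rewrite ∑-suc f | ∑-suc g = ℕ.+-mono-≤ (h zero) (∑-mono (h ∘ suc))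

∑-split : ∀ m {n} (f : Fin (m + n) → ℕ) → ∑ f ≡ ∑ (λ i → f (i ↑ˡ n)) + ∑ (λ j → f (m ↑ʳ j))
∑-split zero f = cong (_+ ∑ f) (sym (∑-zero _))
∑-split (suc m) {n} f = trans (∑-suc f) (trans (cong (f zero +_) (∑-split m (f ∘ suc)))
  (trans (sym (ℕ.+-assoc (f zero) _ _)) (cong (_+ ∑ (λ j → f (suc m ↑ʳ j))) (sym (∑-suc _)))))

∑-combine : ∀ m {n} (f : Fin (m * n) → ℕ) → ∑ f ≡ ∑ (λ i → ∑ (λ j → f (combine {m} {n} i j)))
∑-combine zero f = trans (∑-zero f) (sym (∑-zero _))
∑-combine (suc m) {n} f = trans (∑-split n f) (trans (cong (∑ (λ j → f (j ↑ˡ (m * n))) +_) (∑-combine m (λ j → f (n ↑ʳ j)))) (sym (∑-suc _)))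

∑-δ : ∀ {n} (j : Fin n) → ∑ (λ i → ⟦ i == j ⟧) ≡ 1
∑-δ zero = trans (∑-suc _) (cong suc (∑-0 λ _ → refl))
∑-δ (suc j) = trans (∑-suc _) (∑-δ j)

⟦⟧-mono : ∀ a b → (a ≡ true → b ≡ true) → ⟦ a ⟧ ≤ ⟦ b ⟧
⟦⟧-mono false b h = z≤n
⟦⟧-mono true b h rewrite h refl = s≤s z≤n

cnt-mono : ∀ {n} {p q : Fin n → Bool} → (∀ i → p i ≡ true → q i ≡ true) → cnt p ≤ cnt q
cnt-mono {p = p} {q} h = ∑-mono λ i → ⟦⟧-mono (p i) (q i) (h i)

cnt-∨ : ∀ {n} (p q : Fin n → Bool) → cnt (λ i → p i ∨ q i) ≤ cnt p + cnt q
cnt-∨ p q = ℕ.≤-trans (∑-mono λ i → go (p i) (q i)) (ℕ.≤-reflexive (∑-+ (λ i → ⟦ p i ⟧) (λ i → ⟦ q i ⟧)))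
  where
  go : ∀ a b → ⟦ a ∨ b ⟧ ≤ ⟦ a ⟧ + ⟦ b ⟧
  go true b = s≤s z≤n
  go false b = ℕ.≤-refl

cnt-not : ∀ {n} (p : Fin n → Bool) → cnt p + cnt (λ i → not (p i)) ≡ n
cnt-not {zero} p = cong₂ _+_ (∑-zero _) (∑-zero _)
cnt-not {suc n} p rewrite cnt-suc p | cnt-suc (λ i → not (p i)) with p zero
... | true = cong suc (cnt-not (p ∘ suc))
... | false = trans (ℕ.+-suc _ _) (cong suc (cnt-not (p ∘ suc)))

cnt-remove : ∀ {n} (q : Fin n → Bool) j → q j ≡ true → suc (cnt (λ i → q i ∧ not (i == j))) ≤ cnt q
cnt-remove q zero qj rewrite cnt-suc q | cnt-suc (λ i → q i ∧ not (i == zero)) | qj = s≤s (cnt-mono λ i → ∧-fst {q (suc i)})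
cnt-remove q (suc j) qj rewrite cnt-suc q | cnt-suc (λ i → q i ∧ not (i == suc j)) | ∧-identityʳ (q zero) =
  ℕ.≤-trans (ℕ.≤-reflexive (sym (ℕ.+-suc ⟦ q zero ⟧ _))) (ℕ.+-monoʳ-≤ ⟦ q zero ⟧ (cnt-remove (q ∘ suc) j qj))

-- Induction on `m`: a counted first element uses up its image, which is struck from `q` before the
-- others are placed.
cnt-≤ : ∀ {m n} (p : Fin m → Bool) (q : Fin n → Bool) (f : ∀ i → p i ≡ true → Fin n) →
  (∀ i pi → q (f i pi) ≡ true) → (∀ i pi j pj → f i pi ≡ f j pj → i ≡ j) → cnt p ≤ cnt q
cnt-≤ {zero} p q f fq inj = ℕ.≤-trans (ℕ.≤-reflexive (∑-zero _)) z≤n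
cnt-≤ {suc m} p q f fq inj rewrite cnt-suc p with p zero in eq
... | false = cnt-≤ (p ∘ suc) q (λ i → f (suc i)) (λ i → fq (suc i)) (λ i pi j pj e → Fin.suc-injective (inj (suc i) pi (suc j) pj e))
... | true = ℕ.≤-trans (s≤s (cnt-≤ (p ∘ suc) (λ j → q j ∧ not (j == f zero eq)) (λ i → f (suc i))
                 (λ i pi → ∧-true (fq (suc i) pi) (cong not (≢⇒==false λ e → case inj (suc i) pi zero eq e of λ ())))
                 (λ i pi j pj e → Fin.suc-injective (inj (suc i) pi (suc j) pj e))))
               (cnt-remove q (f zero eq) (fq zero eq))

-- `f` stands for the number of faces, `p` for the number of dual pairs of cycles, `c` for the
-- components, `d` for those with an edge, `i` for the isolated vertices and `o` for half the number
-- of directed face traversals. The first hypothesis is Euler's formula in the form of a rank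
-- inequality.
euler-arithmetic : ∀ {f p V i e c d g o} → (f + p) + V ≤ e + (d + c) → d + i ≤ c → 2 * c + e ≤ g + V + (o + i) → o ≤ f → p ≤ g
euler-arithmetic {f} {p} {V} {i} {e} {c} {d} {g} {o} dimension roots euler faces = ℕ.+-cancelˡ-≤ (f + V + i) p g (begin
  f + V + i + p ≡⟨ solve 4 (λ f V i p → f :+ V :+ i :+ p := f :+ p :+ V :+ i) refl f V i p ⟩
  f + p + V + i ≤⟨ ℕ.+-monoˡ-≤ i dimension ⟩
  e + (d + c) + i ≡⟨ solve 4 (λ e d c i → e :+ (d :+ c) :+ i := (d :+ i) :+ c :+ e) refl e d c i ⟩
  (d + i) + c + e ≤⟨ ℕ.+-monoˡ-≤ e (ℕ.+-monoˡ-≤ c roots) ⟩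
  c + c + e ≡⟨ cong (_+ e) (cong (c +_) (sym (ℕ.+-identityʳ c))) ⟩
  2 * c + e ≤⟨ euler ⟩
  g + V + (o + i) ≤⟨ ℕ.+-monoʳ-≤ (g + V) (ℕ.+-monoˡ-≤ i faces) ⟩
  g + V + (f + i) ≡⟨ solve 4 (λ g V f i → g :+ V :+ (f :+ i) := f :+ V :+ i :+ g) refl g V f i ⟩
  f + V + i + g ∎)
  where
  open ℕ.≤-Reasoning
  open import Data.Nat.Solver using (module +-*-Solver)
  open +-*-Solver using (solve; _:=_; _:+_)

open xor-∧-Solver using (solve; _:=_; _:+_; _:*_; con)
open ≡-Reasoning

-- Linear algebra over 𝔽₂

infixl 7 _·_
_·_ : ∀ {n} → (Fin n → Bool) → (Fin n → Bool) → Bool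
x · y = ⨁ (λ i → x i ∧ y i)

·-suc : ∀ {n} (x y : Fin (suc n) → Bool) → x · y ≡ (x zero ∧ y zero) xor ((x ∘ suc) · (y ∘ suc))
·-suc x y = ⨁-suc _

·-xorˡ : ∀ {n} (x x′ y : Fin n → Bool) → (λ i → x i xor x′ i) · y ≡ (x · y) xor (x′ · y)
·-xorˡ x x′ y = trans (⨁-cong λ i → ∧-distribʳ-xor (y i) (x i) (x′ i)) (⨁-xor _ _)

·-scaleˡ : ∀ {n} b (x y : Fin n → Bool) → (λ i → b ∧ x i) · y ≡ b ∧ (x · y)
·-scaleˡ b x y = trans (⨁-cong λ i → ∧-assoc b (x i) (y i)) (sym (⨁-∧ˡ b _))

·-comm : ∀ {n} (x y : Fin n → Bool) → x · y ≡ y · x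
·-comm x y = ⨁-cong λ i → ∧-comm (x i) (y i)

·-δˡ : ∀ {n} j (y : Fin n → Bool) → (λ i → i == j) · y ≡ y j
·-δˡ j y = ⨁-δ j y

·-zeroˡ : ∀ {n} (x y : Fin n → Bool) → (∀ i → x i ≡ false) → x · y ≡ false
·-zeroˡ x y h = ⨁-false λ i → cong (_∧ y i) (h i)

-- The pivot row p is also eliminated against itself: it becomes zero, and no row has to be removed.
private
  module Pivot {m n : ℕ} (A : Fin m → Fin (suc n) → Bool) (b : Fin m → Bool) (p : Fin m) (Ap : A p zero ≡ true) where
    A′ : Fin m → Fin n → Bool
    A′ i j = A i (suc j) xor (A i zero ∧ A p (suc j))

    b′ : Fin m → Bool
    b′ i = b i xor (A i zero ∧ b p)

    solution : ∀ x → (∀ i → A′ i · x ≡ b′ i) → ∃ λ x → ∀ i → A i · x ≡ b i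
    solution x h = x⁺ , λ i → begin
      A i · x⁺ ≡⟨ ·-suc (A i) x⁺ ⟩
      (A i zero ∧ x⁺ zero) xor ((A i ∘ suc) · x)
        ≡⟨ solve 4 (λ a u v w → (a :* (u :+ v)) :+ w := (w :+ a :* v) :+ a :* u) refl (A i zero) (b p) ((A p ∘ suc) · x) ((A i ∘ suc) · x) ⟩
      (((A i ∘ suc) · x) xor (A i zero ∧ ((A p ∘ suc) · x))) xor (A i zero ∧ b p)
        ≡⟨ cong (_xor (A i zero ∧ b p)) (sym (trans (·-xorˡ _ _ x) (cong (((A i ∘ suc) · x) xor_) (·-scaleˡ (A i zero) _ x)))) ⟩
      (A′ i · x) xor (A i zero ∧ b p) ≡⟨ cong (_xor (A i zero ∧ b p)) (h i) ⟩
      (b i xor (A i zero ∧ b p)) xor (A i zero ∧ b p) ≡⟨ solve 2 (λ u v → (u :+ v) :+ v := u) refl (b i) (A i zero ∧ b p) ⟩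
      b i ∎
      where
      -- Row `p` starts with `true`, so it dictates the eliminated unknown.
      x⁺ : Fin (suc n) → Bool
      x⁺ zero = b p xor ((A p ∘ suc) · x)
      x⁺ (suc j) = x j

    certificate : ∀ y → (∀ j → y · (λ i → A′ i j) ≡ false) → y · b′ ≡ true →
      ∃ λ y → (∀ j → y · (λ i → A i j) ≡ false) × y · b ≡ true
    certificate y h hb = y⁺ , col , trans (apply b) (trans (sym (expand b (b p))) hb)
      where
      c = y · (λ i → A i zero)
      -- The eliminated rows used row `p` with total multiplicity `c`; adding this to the
      -- coefficient of `p` undoes the elimination and clears column zero.
      y⁺ : Fin m → Bool
      y⁺ i = y i xor (c ∧ (i == p))
      apply : ∀ v → y⁺ · v ≡ (y · v) xor (c ∧ v p)
      apply v = trans (·-xorˡ y _ v) (cong ((y · v) xor_) (trans (·-scaleˡ c _ v) (cong (c ∧_) (·-δˡ p v))))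
      expand : ∀ (v : Fin m → Bool) (d : Bool) → y · (λ i → v i xor (A i zero ∧ d)) ≡ (y · v) xor (c ∧ d)
      expand v d = begin
        y · (λ i → v i xor (A i zero ∧ d)) ≡⟨ ·-comm y _ ⟩
        (λ i → v i xor (A i zero ∧ d)) · y ≡⟨ ·-xorˡ v _ y ⟩
        (v · y) xor ((λ i → A i zero ∧ d) · y) ≡⟨ cong₂ _xor_ (·-comm v y) (⨁-cong λ i → cong (_∧ y i) (∧-comm (A i zero) d)) ⟩
        (y · v) xor ((λ i → d ∧ A i zero) · y) ≡⟨ cong ((y · v) xor_) (trans (·-scaleˡ d _ y) (trans (∧-comm d _) (cong (_∧ d) (·-comm _ y)))) ⟩
        (y · v) xor (c ∧ d) ∎
      col : ∀ j → y⁺ · (λ i → A i j) ≡ false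
      col zero = trans (apply _) (trans (cong (λ t → c xor (c ∧ t)) Ap) (trans (cong (c xor_) (∧-identityʳ c)) (xor-same c)))
      col (suc j) = trans (apply _) (trans (sym (expand (λ i → A i (suc j)) (A p (suc j)))) (h j))

-- Gaussian elimination, one unknown at a time. A column of zeros leaves its unknown free (set to
-- `false`); once no unknown is left, a nonzero entry of `b` is itself a certificate.
fredholm : ∀ {m} n (A : Fin m → Fin n → Bool) (b : Fin m → Bool) →
  (∃ λ x → ∀ i → A i · x ≡ b i) ⊎ (∃ λ y → (∀ j → y · (λ i → A i j) ≡ false) × y · b ≡ true)
fredholm zero A b with search b
... | inj₁ (i , bi) = inj₂ ((λ j → j == i) , (λ ()) , trans (·-δˡ i b) bi)
... | inj₂ h = inj₁ ((λ ()) , λ i → trans (⨁-zero _) (sym (h i)))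
fredholm (suc n) A b with search (λ i → A i zero)
... | inj₁ (p , Ap) = case fredholm n A′ b′ of λ where
    (inj₁ (x , h)) → inj₁ (solution x h)
    (inj₂ (y , h , hb)) → inj₂ (certificate y h hb)
  where open Pivot A b p Ap
... | inj₂ none = case fredholm n (λ i j → A i (suc j)) b of λ where
    (inj₁ (x , h)) → inj₁ ((λ { zero → false ; (suc j) → x j }) , λ i → trans (·-suc (A i) _) (trans (cong (_xor ((A i ∘ suc) · x)) (∧-zeroʳ (A i zero))) (h i)))
    (inj₂ (y , h , hb)) → inj₂ (y , (λ { zero → trans (·-comm y _) (·-zeroˡ _ y none) ; (suc j) → h j }) , hb)

comb : ∀ {a e} → (Fin a → Bool) → (Fin a → Fin e → Bool) → Fin e → Bool
comb c α j = c · (λ i → α i j)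

-- The mask M selects the members of the family α, and L the coordinates that count.
Independent : ∀ {a e} → Mask a → Mask e → (Fin a → Fin e → Bool) → Set
Independent M L α = ∀ c → (∀ i → c i ≡ true → M i ≡ true) → (∀ j → L j ≡ true → comb c α j ≡ false) → ∀ i → c i ≡ false

Orthogonal : ∀ {a b e} → Mask a → Mask b → Mask e → (Fin a → Fin e → Bool) → (Fin b → Fin e → Bool) → Set
Orthogonal M N L α β = ∀ i i′ → M i ≡ true → N i′ ≡ true → ⨁ (λ j → L j ∧ (α i j ∧ β i′ j)) ≡ false

private
  module Step {a b e : ℕ} (M : Mask a) (N : Mask b) (L : Mask (suc e))
      (α : Fin a → Fin (suc e) → Bool) (β : Fin b → Fin (suc e) → Bool)
      (indα : Independent M L α) (indβ : Independent N L β) (orth : Orthogonal M N L α β) (L0 : L zero ≡ true)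
      (p : Fin a) (Mp : M p ≡ true) (αp : α p zero ≡ true) where

    M′ : Mask a
    M′ i = M i ∧ not (i == p)

    α′ : Fin a → Fin e → Bool
    α′ i j = α i (suc j) xor (α i zero ∧ α p (suc j))

    β′ : Fin b → Fin e → Bool
    β′ i j = β i (suc j)

    orth-suc : ∀ i i′ → M i ≡ true → N i′ ≡ true → ⨁ (λ j → L (suc j) ∧ (α i (suc j) ∧ β i′ (suc j))) ≡ α i zero ∧ β i′ zero
    orth-suc i i′ Mi Ni′ = sym (xor≡false⇒≡ (trans (cong (λ t → (t ∧ (α i zero ∧ β i′ zero)) xor ⨁ (λ j → L (suc j) ∧ (α i (suc j) ∧ β i′ (suc j)))) (sym L0)) (trans (sym (⨁-suc (λ j → L j ∧ (α i j ∧ β i′ j)))) (orth i i′ Mi Ni′))))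

    orth′ : Orthogonal M′ N (L ∘ suc) α′ β′
    orth′ i i′ Mi Ni′ = begin
      ⨁ (λ j → L (suc j) ∧ ((α i (suc j) xor (α i zero ∧ α p (suc j))) ∧ β i′ (suc j)))
        ≡⟨ ⨁-cong (λ j → solve 5 (λ l x y z w → l :* ((x :+ y :* z) :* w) := (l :* (x :* w)) :+ (y :* (l :* (z :* w)))) refl
             (L (suc j)) (α i (suc j)) (α i zero) (α p (suc j)) (β i′ (suc j))) ⟩
      ⨁ (λ j → (L (suc j) ∧ (α i (suc j) ∧ β i′ (suc j))) xor (α i zero ∧ (L (suc j) ∧ (α p (suc j) ∧ β i′ (suc j)))))
        ≡⟨ trans (⨁-xor _ _) (cong₂ _xor_ (orth-suc i i′ (∧-fst {M i} Mi) Ni′) (trans (sym (⨁-∧ˡ (α i zero) _)) (cong (α i zero ∧_) (orth-suc p i′ Mp Ni′)))) ⟩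
      (α i zero ∧ β i′ zero) xor (α i zero ∧ (α p zero ∧ β i′ zero))
        ≡⟨ cong (λ t → (α i zero ∧ β i′ zero) xor (α i zero ∧ (t ∧ β i′ zero))) αp ⟩
      (α i zero ∧ β i′ zero) xor (α i zero ∧ β i′ zero) ≡⟨ xor-same (α i zero ∧ β i′ zero) ⟩
      false ∎

    indα′ : Independent M′ (L ∘ suc) α′
    indα′ c sup h i = case i ≟ p of λ where
        (yes refl) → ¬true⇒false λ ci → true≢false (∧-snd {M p} (sup p ci)) (cong not (==-refl p))
        (no i≢p) → begin
          c i ≡⟨ sym (xor-identityʳ (c i)) ⟩
          c i xor false ≡⟨ cong (c i xor_) (sym (trans (cong (μ ∧_) (≢⇒==false i≢p)) (∧-zeroʳ μ))) ⟩
          c⁺ i ≡⟨ indα c⁺ sup⁺ (λ { zero _ → h0 ; (suc j) Lj → trans (hsuc j) (h j Lj) }) i ⟩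
          false ∎
      where
      μ = c · (λ i → α i zero)
      -- Each α′ contains a multiple of `α p`; in the combination these add up to `μ`. Crediting
      -- them to `p` turns a relation among the α′ into one among the α.
      c⁺ : Fin a → Bool
      c⁺ i = c i xor (μ ∧ (i == p))
      apply : ∀ v → c⁺ · v ≡ (c · v) xor (μ ∧ v p)
      apply v = trans (·-xorˡ c _ v) (cong ((c · v) xor_) (trans (·-scaleˡ μ _ v) (cong (μ ∧_) (·-δˡ p v))))
      h0 : c⁺ · (λ i → α i zero) ≡ false
      h0 = trans (apply _) (trans (cong (λ t → μ xor (μ ∧ t)) αp) (trans (cong (μ xor_) (∧-identityʳ μ)) (xor-same μ)))
      hsuc : ∀ j → c⁺ · (λ i → α i (suc j)) ≡ comb c α′ j
      hsuc j = trans (apply _) (sym (trans (⨁-cong λ i → solve 4 (λ x y z w → x :* (y :+ z :* w) := x :* y :+ w :* (x :* z)) refl (c i) (α i (suc j)) (α i zero) (α p (suc j)))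
        (trans (⨁-xor _ _) (cong ((c · (λ i → α i (suc j))) xor_) (trans (sym (⨁-∧ˡ (α p (suc j)) _)) (∧-comm _ μ))))))
      sup⁺ : ∀ i → c⁺ i ≡ true → M i ≡ true
      sup⁺ i q with true-or-false (c i)
      ... | inj₁ ci = ∧-fst {M i} (sup i ci)
      ... | inj₂ ci = subst (λ t → M t ≡ true) (sym (==⇒≡ i p (∧-snd {μ} (trans (cong (_xor (μ ∧ (i == p))) (sym ci)) q)))) Mp

    -- Dropping coordinate zero loses nothing on the side of β: since `α p` is `true` there,
    -- orthogonality to `α p` forces a combination that vanishes on the other counted coordinates to
    -- vanish at zero too.
    indβ′ : Independent N (L ∘ suc) β′
    indβ′ c sup h = indβ c sup λ { zero _ → h0 ; (suc j) Lj → h j Lj }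
      where
      h0 : comb c β zero ≡ false
      h0 = begin
        ⨁ (λ i → c i ∧ β i zero) ≡⟨ ⨁-cong (λ i → ∧-congʳ-if {c i} λ ci → sym (trans (orth-suc p i Mp (sup i ci)) (cong (_∧ β i zero) αp))) ⟩
        ⨁ (λ i → c i ∧ ⨁ (λ j → L (suc j) ∧ (α p (suc j) ∧ β i (suc j)))) ≡⟨ ⨁-cong (λ i → ⨁-∧ˡ (c i) _) ⟩
        ⨁ (λ i → ⨁ (λ j → c i ∧ (L (suc j) ∧ (α p (suc j) ∧ β i (suc j))))) ≡⟨ ⨁-swap _ ⟩
        ⨁ (λ j → ⨁ (λ i → c i ∧ (L (suc j) ∧ (α p (suc j) ∧ β i (suc j)))))
          ≡⟨ ⨁-cong (λ j → trans (⨁-cong λ i → solve 4 (λ x y z w → x :* (y :* (z :* w)) := y :* z :* (x :* w)) refl (c i) (L (suc j)) (α p (suc j)) (β i (suc j))) (sym (⨁-∧ˡ (L (suc j) ∧ α p (suc j)) _))) ⟩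
        ⨁ (λ j → (L (suc j) ∧ α p (suc j)) ∧ comb c β (suc j))
          ≡⟨ ⨁-false (λ j → ¬true⇒false λ q → true≢false (∧-snd {L (suc j) ∧ α p (suc j)} q) (h j (∧-fst {L (suc j)} (∧-fst {L (suc j) ∧ α p (suc j)} q)))) ⟩
        false ∎

    bound : cnt M′ + cnt N ≤ cnt (L ∘ suc) → cnt M + cnt N ≤ cnt L
    bound h = ℕ.≤-trans (ℕ.+-monoˡ-≤ (cnt N) cnt-M) (ℕ.≤-trans (s≤s h) (ℕ.≤-reflexive (sym (trans (cnt-suc L) (cong (λ t → ⟦ t ⟧ + cnt (L ∘ suc)) L0)))))
      where
      go : ∀ a b → ⟦ a ⟧ ≤ ⟦ b ⟧ + ⟦ a ∧ not b ⟧
      go false b = z≤n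
      go true false = s≤s z≤n
      go true true = s≤s z≤n
      cnt-M : cnt M ≤ suc (cnt M′)
      cnt-M = ℕ.≤-trans (∑-mono λ i → go (M i) (i == p)) (ℕ.≤-reflexive (trans (∑-+ (λ i → ⟦ i == p ⟧) _) (cong (_+ cnt M′) (∑-δ p))))

orthogonal-sym : ∀ {a b e} {M : Mask a} {N : Mask b} (L : Mask e) (α : Fin a → Fin e → Bool) (β : Fin b → Fin e → Bool) →
  Orthogonal M N L α β → Orthogonal N M L β α
orthogonal-sym L α β o i i′ Ni Mi′ = trans (⨁-cong λ j → cong (L j ∧_) (∧-comm (β i j) (α i′ j))) (o i′ i Mi′ Ni)

independent-zero : ∀ {a} (M : Mask a) (L : Mask 0) (α : Fin a → Fin 0 → Bool) → Independent M L α → cnt M ≡ 0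
independent-zero M L α ind = ∑-0 λ i → cong ⟦_⟧ (¬true⇒false λ Mi →
  true≢false (==-refl i) (ind (_== i) (λ j e → subst (λ t → M t ≡ true) (sym (==⇒≡ j i e)) Mi) (λ ()) i))

independent-skip : ∀ {a e} (M : Mask a) (L : Mask (suc e)) (α : Fin a → Fin (suc e) → Bool) →
  (∀ i → M i ∧ (L zero ∧ α i zero) ≡ false) → Independent M L α → Independent M (L ∘ suc) (λ i j → α i (suc j))
independent-skip M L α none ind c sup h = ind c sup λ where
  zero L0 → ⨁-false λ i → ¬true⇒false λ q →
    true≢false (∧-true (sup i (∧-fst {c i} q)) (∧-true L0 (∧-snd {c i} q))) (none i)
  (suc j) Lj → h j Lj

-- Each counted coordinate pays for one vector: if a member of one family is nonzero there, it
-- becomes the pivot, and member and coordinate are removed together. A coordinate that is not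
-- counted, or on which both families vanish, is dropped.
orthogonal-dim : ∀ {a b} e (M : Mask a) (N : Mask b) (L : Mask e) (α : Fin a → Fin e → Bool) (β : Fin b → Fin e → Bool) →
  Independent M L α → Independent N L β → Orthogonal M N L α β → cnt M + cnt N ≤ cnt L
orthogonal-dim zero M N L α β iα iβ o = ℕ.≤-trans (ℕ.≤-reflexive (cong₂ _+_ (independent-zero M L α iα) (independent-zero N L β iβ))) z≤n
orthogonal-dim (suc e) M N L α β iα iβ o with search (λ i → M i ∧ (L zero ∧ α i zero)) | search (λ i → N i ∧ (L zero ∧ β i zero))
... | inj₁ (p , q) | _ = bound (orthogonal-dim e M′ N (L ∘ suc) α′ β′ indα′ indβ′ orth′)
  where open Step M N L α β iα iβ o (∧-fst {L zero} (∧-snd {M p} q)) p (∧-fst {M p} q) (∧-snd {L zero} (∧-snd {M p} q))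
... | inj₂ _ | inj₁ (p , q) = ℕ.≤-trans (ℕ.≤-reflexive (ℕ.+-comm (cnt M) (cnt N))) (bound (orthogonal-dim e M′ M (L ∘ suc) α′ β′ indα′ indβ′ orth′))
  where open Step N M L β α iβ iα (orthogonal-sym L α β o) (∧-fst {L zero} (∧-snd {N p} q)) p (∧-fst {N p} q) (∧-snd {L zero} (∧-snd {N p} q))
... | inj₂ none | inj₂ none′ = ℕ.≤-trans (orthogonal-dim e M N (L ∘ suc) (λ i j → α i (suc j)) (λ i j → β i (suc j))
        (independent-skip M L α none iα) (independent-skip N L β none′ iβ) o′) (ℕ.≤-trans (ℕ.m≤n+m _ ⟦ L zero ⟧) (ℕ.≤-reflexive (sym (cnt-suc L))))
  where
  o′ : Orthogonal M N (L ∘ suc) (λ i j → α i (suc j)) (λ i j → β i (suc j))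
  o′ i i′ Mi Ni′ = trans (sym (cong (_xor ⨁ (λ j → L (suc j) ∧ (α i (suc j) ∧ β i′ (suc j)))) first)) (trans (sym (⨁-suc _)) (o i i′ Mi Ni′))
    where
    first : L zero ∧ (α i zero ∧ β i′ zero) ≡ false
    first = ¬true⇒false λ q → true≢false (∧-true Mi (∧-true (∧-fst {L zero} q) (∧-fst {α i zero} (∧-snd {L zero} q)))) (none i)

-- Counting homomorphisms

IsHom : ∀ {a b} → Graph a → Graph b → (Fin a → Fin b) → Set
IsHom F G f = ∀ u v → adj F u v ≡ true → adj G (f u) (f v) ≡ true

isHom⁺ : ∀ {a b} (F : Graph a) (G : Graph b) f → IsHom F G f → isHom F G f ≡ true
isHom⁺ F G f h = allF⁺ _ λ u → allF⁺ _ λ v → case true-or-false (adj F u v) of λ where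
  (inj₁ e) → ∨-injʳ {not (adj F u v)} (h u v e)
  (inj₂ e) → ∨-injˡ (cong not e)

isHom⁻ : ∀ {a b} (F : Graph a) (G : Graph b) f → isHom F G f ≡ true → IsHom F G f
isHom⁻ F G f h u v e = case ∨-case {not (adj F u v)} (allF⁻ _ (allF⁻ _ h u) v) of λ where
  (inj₁ q) → ⊥-elim (true≢false e (not-true q))
  (inj₂ q) → q

isHom-cong : ∀ {a b} (F : Graph a) (G : Graph b) {f g} → (∀ i → f i ≡ g i) → isHom F G f ≡ isHom F G g
isHom-cong F G {f} {g} e = iff⇒≡
  (λ h → isHom⁺ F G g λ u v a → trans (cong₂ (adj G) (sym (e u)) (sym (e v))) (isHom⁻ F G f h u v a))
  (λ h → isHom⁺ F G f λ u v a → trans (cong₂ (adj G) (e u) (e v)) (isHom⁻ F G g h u v a))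

length-filterᵇ : ∀ {A : Set} (p : A → Bool) xs → length (filterᵇ p xs) ≡ sum (map (λ x → ⟦ p x ⟧) xs)
length-filterᵇ p [] = refl
length-filterᵇ p (x ∷ xs) with p x
... | true = cong suc (length-filterᵇ p xs)
... | false = length-filterᵇ p xs

sum-map-++ : ∀ {A : Set} (g : A → ℕ) xs ys → sum (map g (xs ++ ys)) ≡ sum (map g xs) + sum (map g ys)
sum-map-++ g [] ys = refl
sum-map-++ g (x ∷ xs) ys = trans (cong (g x +_) (sum-map-++ g xs ys)) (sym (ℕ.+-assoc (g x) _ _))

sum-map-concatMap : ∀ {A B : Set} (g : B → ℕ) (k : A → List B) xs → sum (map g (concatMap k xs)) ≡ sum (map (λ x → sum (map g (k x))) xs)
sum-map-concatMap g k [] = refl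
sum-map-concatMap g k (x ∷ xs) = trans (sum-map-++ g (k x) (concatMap k xs)) (cong (sum (map g (k x)) +_) (sum-map-concatMap g k xs))

sum-map-cong : ∀ {A : Set} {g h : A → ℕ} → (∀ x → g x ≡ h x) → ∀ xs → sum (map g xs) ≡ sum (map h xs)
sum-map-cong e [] = refl
sum-map-cong e (x ∷ xs) = cong₂ _+_ (e x) (sum-map-cong e xs)

sum-map-map-allFin : ∀ {A : Set} b (g : A → ℕ) (h : Fin b → A) → sum (map g (map h (allFin b))) ≡ ∑ (λ x → g (h x))
sum-map-map-allFin b g h = trans (go (allFin b)) (sumF≡∑ b (g ∘ h))
  where
  go : ∀ xs → sum (map g (map h xs)) ≡ sum (map (g ∘ h) xs)
  go [] = refl
  go (x ∷ xs) = cong (g (h x) +_) (go xs)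

-- Functions are replaced by their codes in `Fin (b ^ a)`, where equality is decidable and
-- injections can be counted. The hypothesis on `g` stands in for function extensionality.
sum-allFuns : ∀ a b (g : (Fin a → Fin b) → ℕ) → (∀ {f f′} → (∀ i → f i ≡ f′ i) → g f ≡ g f′) →
  sum (map g (allFuns a b)) ≡ ∑ (λ (i : Fin (b ^ a)) → g (finToFun i))
sum-allFuns zero b g ext = trans (ℕ.+-identityʳ _) (trans (ext λ ()) (sym (trans (∑-suc _) (trans (cong (g (finToFun zero) +_) (∑-zero _)) (ℕ.+-identityʳ _)))))
sum-allFuns (suc a) b g ext = begin
  sum (map g (allFuns (suc a) b)) ≡⟨ sum-map-concatMap g _ (allFuns a b) ⟩
  sum (map (λ f → sum (map g (map _ (allFin b)))) (allFuns a b)) ≡⟨ sum-map-cong (λ f → trans (sum-map-map-allFin b g _) (∑-cong λ x → ext λ { zero → refl ; (suc i) → refl })) (allFuns a b) ⟩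
  sum (map (λ f → ∑ (λ x → g (cons x f))) (allFuns a b)) ≡⟨ sum-allFuns a b _ (λ e → ∑-cong λ x → ext λ { zero → refl ; (suc i) → e i }) ⟩
  ∑ (λ j → ∑ (λ x → g (cons x (finToFun j)))) ≡⟨ ∑-swap _ ⟩
  ∑ (λ x → ∑ (λ j → g (cons x (finToFun j)))) ≡⟨ ∑-cong (λ x → ∑-cong λ j → ext λ i → sym (finToFun-combine x j i)) ⟩
  ∑ (λ x → ∑ (λ j → g (finToFun (combine {b} {b ^ a} x j)))) ≡⟨ sym (∑-combine b _) ⟩
  ∑ (λ i → g (finToFun i)) ∎
  where
  cons : Fin b → (Fin a → Fin b) → Fin (suc a) → Fin b
  cons x f zero = x
  cons x f (suc i) = f i
  finToFun-combine : ∀ x (j : Fin (b ^ a)) i → finToFun {b} {suc a} (combine x j) i ≡ cons x (finToFun j) i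
  finToFun-combine x j zero = cong proj₁ (Fin.remQuot-combine {b} {b ^ a} x j)
  finToFun-combine x j (suc i) = cong (λ r → finToFun (proj₂ r) i) (Fin.remQuot-combine {b} {b ^ a} x j)

hom≡cnt : ∀ {a b} (F : Graph a) (G : Graph b) → hom F G ≡ cnt (λ (i : Fin (b ^ a)) → isHom F G (finToFun i))
hom≡cnt {a} {b} F G = trans (length-filterᵇ (isHom F G) (allFuns a b)) (sum-allFuns a b _ (λ e → cong ⟦_⟧ (isHom-cong F G e)))

funToFin-cong : ∀ {m n} {f g : Fin m → Fin n} → (∀ i → f i ≡ g i) → funToFin f ≡ funToFin g
funToFin-cong {zero} e = refl
funToFin-cong {suc m} e = cong₂ combine (e zero) (funToFin-cong (λ i → e (suc i)))

funToFin⁻ : ∀ {m n} (f g : Fin m → Fin n) → funToFin f ≡ funToFin g → ∀ i → f i ≡ g i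
funToFin⁻ f g e i = trans (sym (Fin.finToFun-funToFin f i)) (trans (cong (λ k → finToFun k i) e) (Fin.finToFun-funToFin g i))

module _ {a b c} (F : Graph a) (G : Graph b) (H : Graph c) (Θ : (Fin a → Fin b) → Fin a → Fin c)
    (Θ-hom : ∀ f → IsHom F G f → IsHom F H (Θ f))
    (Θ-inj : ∀ f g → (∀ i → Θ f i ≡ Θ g i) → ∀ i → f i ≡ g i) where
  private
    Θ̂ : Fin (b ^ a) → Fin (c ^ a)
    Θ̂ i = funToFin (Θ (finToFun i))

    Θ̂-hom : ∀ i → isHom F G (finToFun i) ≡ true → isHom F H (finToFun (Θ̂ i)) ≡ true
    Θ̂-hom i h = trans (isHom-cong F H (Fin.finToFun-funToFin (Θ (finToFun i)))) (isHom⁺ F H _ (Θ-hom _ (isHom⁻ F G _ h)))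

    Θ̂-inj : ∀ i j → Θ̂ i ≡ Θ̂ j → i ≡ j
    Θ̂-inj i j e = trans (sym (Fin.funToFin-finToFin {a} {b} i)) (trans (funToFin-cong (Θ-inj _ _ (funToFin⁻ (Θ (finToFun i)) (Θ (finToFun j)) e))) (Fin.funToFin-finToFin {a} {b} j))

  hom-≤ : hom F G ≤ hom F H
  hom-≤ rewrite hom≡cnt F G | hom≡cnt F H = cnt-≤ _ _ (λ i _ → Θ̂ i) Θ̂-hom (λ i _ j _ → Θ̂-inj i j)

  -- The code of `h` is a homomorphism outside the image of the injection, so it can be struck from
  -- the target before counting.
  hom-< : ∀ h → IsHom F H h → (∀ f → IsHom F G f → (∀ i → Θ f i ≡ h i) → ⊥) → hom F G < hom F H
  hom-< h hh miss rewrite hom≡cnt F G | hom≡cnt F H = ℕ.≤-trans (s≤s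
      (cnt-≤ _ (λ j → isHom F H (finToFun j) ∧ not (j == funToFin h)) (λ i _ → Θ̂ i)
        (λ i pi → ∧-true (Θ̂-hom i pi) (cong not (≢⇒==false λ e → miss (finToFun i) (isHom⁻ F G _ pi) (funToFin⁻ (Θ (finToFun i)) h e))))
        (λ i _ j _ → Θ̂-inj i j)))
    (cnt-remove (λ j → isHom F H (finToFun j)) (funToFin h) (trans (isHom-cong F H (Fin.finToFun-funToFin h)) (isHom⁺ F H h hh)))

-- Cai–Fürer–Immerman graphs

-- The 0-chain `y` and the 1-chain `z` of K are the multipliers of the vertex and edge equations of
-- `Solution`. By `balance`, the part of `z` over an edge v w of Γ has boundary `y` on the fibres of
-- v and w: this is the chain map sending v to `y` on its fibre. The augmentation at `U` is `odd`.
record Certificate {n N} (K : Graph n) (Γ : Graph N) (U : Fin N) (φ : Fin n → Fin N) : Set where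
  field
    y : Fin n → Bool
    z : Fin n → Fin n → Bool
    z-sym : ∀ a b → z a b ≡ z b a
    z-adj : ∀ a b → z a b ≡ true → adj K a b ≡ true
    balance : ∀ a w → adj Γ (φ a) w ≡ true → y a ≡ ⨁ (λ b → (φ b == w) ∧ z a b)
    odd : ⨁ (λ a → (φ a == U) ∧ y a) ≡ true

-- `x a w` tells whether bit `w` of the image of `a` is flipped: parity must change exactly over
-- `U`, and agreement along the edges of K must be kept.
record Solution {n N} (K : Graph n) (Γ : Graph N) (U : Fin N) (φ : Fin n → Fin N) (x : Fin n → Fin N → Bool) : Set where
  field
    vertex : ∀ a → ⨁ (λ w → adj Γ (φ a) w ∧ x a w) ≡ (φ a == U)
    edge : ∀ a b → adj K a b ≡ true → x a (φ b) ≡ x b (φ a)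

module _ {n N} (K : Graph n) (Γ : Graph N) (U : Fin N) (φ : Fin n → Fin N) where

  -- Substituting the vertex equations and `balance` turns the odd sum into a sum of
  -- `x a (φ b) ∧ z a b` over ordered pairs. The edge equations make it symmetric, so it cancels.
  certificate⇒¬solution : IsHom K Γ φ → Certificate K Γ U φ → ∀ x → Solution K Γ U φ x → ⊥
  certificate⇒¬solution φ-hom C x S = true≢false odd (begin
    ⨁ (λ a → (φ a == U) ∧ y a) ≡⟨ ⨁-cong (λ a → trans (cong (_∧ y a) (sym (vertex a))) (trans (∧-comm _ (y a)) (⨁-∧ˡ (y a) _))) ⟩
    ⨁ (λ a → ⨁ (λ w → y a ∧ (adj Γ (φ a) w ∧ x a w)))
      ≡⟨ ⨁-cong (λ a → ⨁-cong λ w → trans (solve 3 (λ p q r → p :* (q :* r) := q :* (r :* p)) refl (y a) (adj Γ (φ a) w) (x a w))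
           (trans (∧-congʳ-if {adj Γ (φ a) w} λ e → cong (x a w ∧_) (balance a w e))
             (trans (cong (adj Γ (φ a) w ∧_) (⨁-∧ˡ (x a w) _)) (⨁-∧ˡ (adj Γ (φ a) w) _)))) ⟩
    ⨁ (λ a → ⨁ (λ w → ⨁ (λ b → adj Γ (φ a) w ∧ (x a w ∧ ((φ b == w) ∧ z a b)))))
      ≡⟨ ⨁-cong (λ a → ⨁-swap _) ⟩
    ⨁ (λ a → ⨁ (λ b → ⨁ (λ w → adj Γ (φ a) w ∧ (x a w ∧ ((φ b == w) ∧ z a b)))))
      ≡⟨ ⨁-cong (λ a → ⨁-cong λ b → trans (⨁-cong λ w → solve 4 (λ p q r s → p :* (q :* (r :* s)) := r :* (p :* (q :* s))) refl (adj Γ (φ a) w) (x a w) (φ b == w) (z a b)) (⨁-δ′ (φ b) _)) ⟩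
    ⨁ (λ a → ⨁ (λ b → adj Γ (φ a) (φ b) ∧ (x a (φ b) ∧ z a b)))
      ≡⟨ ⨁⨁-symmetric (λ a b → cong₂ _∧_ (Graph.sym Γ (φ a) (φ b)) (trans (∧-comm (x a (φ b)) (z a b))
           (trans (∧-congʳ-if {z a b} λ e → edge a b (z-adj a b e)) (trans (∧-comm (z a b) (x b (φ a))) (cong (x b (φ a) ∧_) (z-sym a b))))))
           (λ a → cong (_∧ (x a (φ a) ∧ z a a)) (Graph.irrefl Γ (φ a))) ⟩
    false ∎)
    where
    open Certificate C
    open Solution S

  private
    vertexRow : Fin n → Fin n × Fin N → Bool
    vertexRow a (b , w) = (b == a) ∧ adj Γ (φ a) w

    edgeRow : Fin n × Fin n → Fin n × Fin N → Bool
    edgeRow (a , a′) (b , w) = adj K a a′ ∧ (((b == a) ∧ (w == φ a′)) xor ((b == a′) ∧ (w == φ a)))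

    rows : Fin n ⊎ Fin (n * n) → Fin n × Fin N → Bool
    rows (inj₁ a) = vertexRow a
    rows (inj₂ e) = edgeRow (remQuot n e)

    rhs : Fin n ⊎ Fin (n * n) → Bool
    rhs (inj₁ a) = φ a == U
    rhs (inj₂ e) = false

    A : Fin (n + n * n) → Fin (n * N) → Bool
    A i j = rows (splitAt n i) (remQuot N j)

    A-vertex : ∀ a b w → A (a ↑ˡ (n * n)) (combine b w) ≡ vertexRow a (b , w)
    A-vertex a b w = cong₂ rows (Fin.splitAt-↑ˡ n a (n * n)) (Fin.remQuot-combine b w)

    A-edge : ∀ a a′ b w → A (n ↑ʳ combine a a′) (combine b w) ≡ edgeRow (a , a′) (b , w)
    A-edge a a′ b w = trans (cong₂ rows (Fin.splitAt-↑ʳ n (n * n) (combine a a′)) (Fin.remQuot-combine b w)) (cong (λ e → edgeRow e (b , w)) (Fin.remQuot-combine a a′))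

    solution : ∀ x̂ → (∀ i → A i · x̂ ≡ rhs (splitAt n i)) → Solution K Γ U φ (λ a w → x̂ (combine a w))
    solution x̂ h = record
      { vertex = λ a → begin
          ⨁ (λ w → adj Γ (φ a) w ∧ x a w) ≡⟨ sym (⨁-δ a _) ⟩
          ⨁ (λ b → (b == a) ∧ ⨁ (λ w → adj Γ (φ a) w ∧ x b w))
            ≡⟨ ⨁-cong (λ b → trans (⨁-∧ˡ (b == a) _) (⨁-cong λ w → trans (sym (∧-assoc (b == a) _ _)) (cong (_∧ x b w) (sym (A-vertex a b w))))) ⟩
          ⨁ (λ b → ⨁ (λ w → A (a ↑ˡ (n * n)) (combine b w) ∧ x b w)) ≡⟨ sym (⨁-* n _) ⟩
          A (a ↑ˡ (n * n)) · x̂ ≡⟨ h _ ⟩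
          rhs (splitAt n (a ↑ˡ (n * n))) ≡⟨ cong rhs (Fin.splitAt-↑ˡ n a (n * n)) ⟩
          (φ a == U) ∎
      ; edge = λ a a′ e → xor≡false⇒≡ (begin
          x a (φ a′) xor x a′ (φ a) ≡⟨ cong₂ _xor_ (sym (pick a (φ a′))) (sym (pick a′ (φ a))) ⟩
          ⨁ (λ b → ⨁ (λ w → ((b == a) ∧ (w == φ a′)) ∧ x b w)) xor ⨁ (λ b → ⨁ (λ w → ((b == a′) ∧ (w == φ a)) ∧ x b w))
            ≡⟨ trans (sym (⨁-xor _ _)) (⨁-cong λ b → trans (sym (⨁-xor _ _)) (⨁-cong λ w → trans (sym (∧-distribʳ-xor (x b w) ((b == a) ∧ (w == φ a′)) _))
                 (cong (_∧ x b w) (trans (cong (_∧ (((b == a) ∧ (w == φ a′)) xor ((b == a′) ∧ (w == φ a)))) (sym e)) (sym (A-edge a a′ b w)))))) ⟩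
          ⨁ (λ b → ⨁ (λ w → A (n ↑ʳ combine a a′) (combine b w) ∧ x b w)) ≡⟨ sym (⨁-* n _) ⟩
          A (n ↑ʳ combine a a′) · x̂ ≡⟨ h _ ⟩
          rhs (splitAt n (n ↑ʳ combine a a′)) ≡⟨ cong rhs (Fin.splitAt-↑ʳ n (n * n) (combine a a′)) ⟩
          false ∎)
      }
      where
      x : Fin n → Fin N → Bool
      x a w = x̂ (combine a w)
      pick : ∀ a v → ⨁ (λ b → ⨁ (λ w → ((b == a) ∧ (w == v)) ∧ x b w)) ≡ x a v
      pick a v = trans (⨁-cong λ b → trans (⨁-cong λ w → ∧-assoc (b == a) (w == v) (x b w)) (trans (sym (⨁-∧ˡ (b == a) _)) (cong ((b == a) ∧_) (⨁-δ v _)))) (⨁-δ a _)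

    certificate : ∀ ŷ → (∀ j → ŷ · (λ i → A i j) ≡ false) → ŷ · (λ i → rhs (splitAt n i)) ≡ true → Certificate K Γ U φ
    certificate ŷ h hb = record
      { y = y ; z = z
      ; z-sym = λ a b → cong₂ _∧_ (Graph.sym K a b) (xor-comm (ζ a b) (ζ b a))
      ; z-adj = λ a b → ∧-fst {adj K a b}
      ; balance = λ a w e → xor≡false⇒≡ (begin
          y a xor ⨁ (λ b → (φ b == w) ∧ z a b) ≡⟨ cong₂ _xor_ (sym (trans (vertexSum a w) (trans (cong (y a ∧_) e) (∧-identityʳ (y a))))) (sym (edgeSum a w)) ⟩
          ⨁ (λ a′ → y a′ ∧ vertexRow a′ (a , w)) xor ⨁ (λ a′ → ⨁ (λ a″ → ζ a′ a″ ∧ edgeRow (a′ , a″) (a , w)))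
            ≡⟨ cong₂ _xor_ (⨁-cong λ a′ → cong (y a′ ∧_) (sym (A-vertex a′ a w))) (⨁-cong λ a′ → ⨁-cong λ a″ → cong (ζ a′ a″ ∧_) (sym (A-edge a′ a″ a w))) ⟩
          ⨁ (λ a′ → y a′ ∧ A (a′ ↑ˡ (n * n)) (combine a w)) xor ⨁ (λ a′ → ⨁ (λ a″ → ζ a′ a″ ∧ A (n ↑ʳ combine a′ a″) (combine a w)))
            ≡⟨ sym (trans (⨁-+ n _) (cong (⨁ (λ a′ → y a′ ∧ A (a′ ↑ˡ (n * n)) (combine a w)) xor_) (⨁-* n _))) ⟩
          ŷ · (λ i → A i (combine a w)) ≡⟨ h _ ⟩
          false ∎)
      ; odd = begin
          ⨁ (λ a → (φ a == U) ∧ y a) ≡⟨ ⨁-cong (λ a → trans (∧-comm (φ a == U) (y a)) (cong (y a ∧_) (sym (cong rhs (Fin.splitAt-↑ˡ n a (n * n)))))) ⟩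
          ⨁ (λ a → y a ∧ rhs (splitAt n (a ↑ˡ (n * n)))) ≡⟨ sym (xor-identityʳ _) ⟩
          ⨁ (λ a → y a ∧ rhs (splitAt n (a ↑ˡ (n * n)))) xor false
            ≡⟨ cong (⨁ (λ a → y a ∧ rhs (splitAt n (a ↑ˡ (n * n)))) xor_)
                 (sym (⨁-false λ e → trans (cong (λ t → ŷ (n ↑ʳ e) ∧ rhs t) (Fin.splitAt-↑ʳ n (n * n) e)) (∧-zeroʳ _))) ⟩
          ⨁ (λ a → y a ∧ rhs (splitAt n (a ↑ˡ (n * n)))) xor ⨁ (λ e → ŷ (n ↑ʳ e) ∧ rhs (splitAt n (n ↑ʳ e))) ≡⟨ sym (⨁-+ n _) ⟩
          ŷ · (λ i → rhs (splitAt n i)) ≡⟨ hb ⟩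
          true ∎
      }
      where
      y : Fin n → Bool
      y a = ŷ (a ↑ˡ (n * n))
      -- Every edge has one row for each orientation; `z` adds the two multipliers and is therefore
      -- symmetric.
      ζ z : Fin n → Fin n → Bool
      ζ a b = ŷ (n ↑ʳ combine a b)
      z a b = adj K a b ∧ (ζ a b xor ζ b a)
      vertexSum : ∀ a w → ⨁ (λ a′ → y a′ ∧ vertexRow a′ (a , w)) ≡ y a ∧ adj Γ (φ a) w
      vertexSum a w = trans (⨁-cong λ a′ → solve 3 (λ p q r → p :* (q :* r) := q :* (p :* r)) refl (y a′) (a == a′) (adj Γ (φ a′) w)) (⨁-δ′ a _)
      edgeSum : ∀ a w → ⨁ (λ a′ → ⨁ (λ a″ → ζ a′ a″ ∧ edgeRow (a′ , a″) (a , w))) ≡ ⨁ (λ b → (φ b == w) ∧ z a b)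
      edgeSum a w = begin
        ⨁ (λ a′ → ⨁ (λ a″ → ζ a′ a″ ∧ edgeRow (a′ , a″) (a , w)))
          ≡⟨ ⨁-cong (λ a′ → trans (⨁-cong λ a″ → solve 6 (λ p q r s t u → p :* (q :* (r :* s :+ t :* u)) := (r :* (s :* (p :* q))) :+ (t :* (u :* (p :* q)))) refl
               (ζ a′ a″) (adj K a′ a″) (a == a′) (w == φ a″) (a == a″) (w == φ a′)) (⨁-xor _ _)) ⟩
        ⨁ (λ a′ → ⨁ (λ a″ → (a == a′) ∧ ((w == φ a″) ∧ (ζ a′ a″ ∧ adj K a′ a″))) xor ⨁ (λ a″ → (a == a″) ∧ ((w == φ a′) ∧ (ζ a′ a″ ∧ adj K a′ a″))))
          ≡⟨ ⨁-xor _ _ ⟩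
        ⨁ (λ a′ → ⨁ (λ a″ → (a == a′) ∧ ((w == φ a″) ∧ (ζ a′ a″ ∧ adj K a′ a″)))) xor ⨁ (λ a′ → ⨁ (λ a″ → (a == a″) ∧ ((w == φ a′) ∧ (ζ a′ a″ ∧ adj K a′ a″))))
          ≡⟨ cong₂ _xor_ (trans (⨁-cong λ a′ → sym (⨁-∧ˡ (a == a′) _)) (⨁-δ′ a _)) (⨁-cong λ a′ → ⨁-δ′ a _) ⟩
        ⨁ (λ b → (w == φ b) ∧ (ζ a b ∧ adj K a b)) xor ⨁ (λ b → (w == φ b) ∧ (ζ b a ∧ adj K b a))
          ≡⟨ trans (sym (⨁-xor _ _)) (⨁-cong λ b → trans (cong₂ (λ p q → (p ∧ (ζ a b ∧ adj K a b)) xor (p ∧ (ζ b a ∧ q))) (==-sym w (φ b)) (Graph.sym K b a))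
               (solve 4 (λ p q r s → (p :* (q :* r)) :+ (p :* (s :* r)) := p :* (r :* (q :+ s))) refl (φ b == w) (ζ a b) (adj K a b) (ζ b a))) ⟩
        ⨁ (λ b → (φ b == w) ∧ z a b) ∎

  solution-or-certificate : (∃ λ x → Solution K Γ U φ x) ⊎ Certificate K Γ U φ
  solution-or-certificate with fredholm (n * N) A (λ i → rhs (splitAt n i))
  ... | inj₁ (x̂ , h) = inj₁ (_ , solution x̂ h)
  ... | inj₂ (ŷ , h , hb) = inj₂ (certificate ŷ h hb)

module CFI {N : ℕ} (Γ : Graph N) (U : Fin N) where

  -- A vertex v of Γ together with N bits. The bits at non-neighbours of v are kept as well; they
  -- create twins and make the coding uniform in v.
  Vertex : Set
  Vertex = Fin (N * 2 ^ N)

  base : Vertex → Fin N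
  base p = proj₁ (remQuot (2 ^ N) p)

  bits : Vertex → Fin N → Bool
  bits p w = fromBit (finToFun (proj₂ (remQuot {N} (2 ^ N) p)) w)

  encode : Fin N → (Fin N → Bool) → Vertex
  encode v S = combine v (funToFin (toBit ∘ S))

  base-encode : ∀ v S → base (encode v S) ≡ v
  base-encode v S = cong proj₁ (Fin.remQuot-combine v (funToFin (toBit ∘ S)))

  bits-encode : ∀ v S w → bits (encode v S) w ≡ S w
  bits-encode v S w = trans (cong (λ r → fromBit (finToFun (proj₂ r) w)) (Fin.remQuot-combine v (funToFin (toBit ∘ S))))
    (trans (cong fromBit (Fin.finToFun-funToFin (toBit ∘ S) w)) (fromBit-toBit (S w)))

  vertex-ext : ∀ p q → base p ≡ base q → (∀ w → bits p w ≡ bits q w) → p ≡ q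
  vertex-ext p q eb es = trans (sym (Fin.combine-remQuot {N} (2 ^ N) p)) (trans (cong₂ combine eb rem) (Fin.combine-remQuot {N} (2 ^ N) q))
    where
    rem : proj₂ (remQuot {N} (2 ^ N) p) ≡ proj₂ (remQuot {N} (2 ^ N) q)
    rem = trans (sym (Fin.funToFin-finToFin {N} {2} _)) (trans (funToFin-cong λ w → fromBit-injective _ _ (es w)) (Fin.funToFin-finToFin {N} {2} _))

  shift : Vertex → (Fin N → Bool) → Vertex
  shift p x = encode (base p) (λ w → bits p w xor x w)

  parity : Vertex → Bool
  parity p = ⨁ (λ w → adj Γ (base p) w ∧ bits p w)

  -- A vertex (v , S) of the wrong parity is kept, but as an isolated vertex.
  good : Bool → Vertex → Bool
  good b p = not (parity p xor (b ∧ (base p == U)))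

  cfi-adj : Bool → Vertex → Vertex → Bool
  cfi-adj b p q = adj Γ (base p) (base q) ∧ ((good b p ∧ good b q) ∧ not (bits p (base q) xor bits q (base p)))

  cfi : Bool → Graph (N * 2 ^ N)
  cfi b = record
    { adj = cfi-adj b
    ; sym = λ p q → cong₂ _∧_ (Graph.sym Γ (base p) (base q)) (cong₂ _∧_ (∧-comm (good b p) (good b q)) (cong not (xor-comm (bits p (base q)) (bits q (base p)))))
    ; irrefl = λ p → cong (_∧ ((good b p ∧ good b p) ∧ not (bits p (base p) xor bits p (base p)))) (Graph.irrefl Γ (base p)) }

  module _ {b p q} (e : cfi-adj b p q ≡ true) where
    private
      rest = ∧-snd {adj Γ (base p) (base q)} e
      goods = ∧-fst {good b p ∧ good b q} rest

    cfi-base : adj Γ (base p) (base q) ≡ true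
    cfi-base = ∧-fst {adj Γ (base p) (base q)} e

    cfi-goodˡ : parity p ≡ b ∧ (base p == U)
    cfi-goodˡ = xor≡false⇒≡ (not-true (∧-fst {good b p} goods))

    cfi-goodʳ : parity q ≡ b ∧ (base q == U)
    cfi-goodʳ = xor≡false⇒≡ (not-true (∧-snd {good b p} goods))

    cfi-bits : bits p (base q) ≡ bits q (base p)
    cfi-bits = xor≡false⇒≡ (not-true (∧-snd {good b p ∧ good b q} rest))

  cfi-adj⁺ : ∀ {b p q} → adj Γ (base p) (base q) ≡ true → parity p ≡ b ∧ (base p == U) → parity q ≡ b ∧ (base q == U) →
    bits p (base q) ≡ bits q (base p) → cfi-adj b p q ≡ true
  cfi-adj⁺ {b} {p} {q} e gp gq bs = ∧-true e (∧-true (∧-true (eq gp) (eq gq)) (eq bs))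
    where
    eq : ∀ {s t} → s ≡ t → not (s xor t) ≡ true
    eq {s} refl = cong not (xor-same s)

  private
    parity-shift : ∀ p x → parity (shift p x) ≡ parity p xor ⨁ (λ w → adj Γ (base p) w ∧ x w)
    parity-shift p x = trans (⨁-cong λ w → trans (cong₂ (λ v t → adj Γ v w ∧ t) (base-encode (base p) _) (bits-encode (base p) _ w)) (∧-distribˡ-xor (adj Γ (base p) w) (bits p w) (x w))) (⨁-xor _ _)

  module Translate {n : ℕ} (K : Graph n) where
    chosen : (Fin n → Fin N) → Fin n → Fin N → Bool
    chosen φ with solution-or-certificate K Γ U φ
    ... | inj₁ (x , _) = x
    ... | inj₂ _ = λ _ _ → false

    chosen-solution : ∀ φ → ¬ Certificate K Γ U φ → Solution K Γ U φ (chosen φ)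
    chosen-solution φ none with solution-or-certificate K Γ U φ
    ... | inj₁ (_ , S) = S
    ... | inj₂ C = ⊥-elim (none C)

    -- The solution is looked up through the code of the projection, so that it only depends on the values of f.
    φ̂ : (Fin n → Vertex) → Fin n → Fin N
    φ̂ f = finToFun (funToFin (base ∘ f))

    φ̂≗ : ∀ f a → φ̂ f a ≡ base (f a)
    φ̂≗ f = Fin.finToFun-funToFin (base ∘ f)

    -- The shift follows the solution chosen for the projection of `f`. Its vertex equations flip
    -- the parity exactly over `U`, which interchanges the even and the odd graph.
    Θ : (Fin n → Vertex) → Fin n → Vertex
    Θ f a = shift (f a) (chosen (φ̂ f) a)

    base-Θ : ∀ f a → base (Θ f a) ≡ base (f a)
    base-Θ f a = base-encode (base (f a)) _

    -- The projection survives `Θ` and determines the shift, so two maps with the same image were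
    -- shifted by the same amount.
    Θ-inj : ∀ f g → (∀ a → Θ f a ≡ Θ g a) → ∀ a → f a ≡ g a
    Θ-inj f g e a = vertex-ext (f a) (g a) (base-eq a) λ w → begin
      bits (f a) w ≡⟨ solve 2 (λ s t → s := (s :+ t) :+ t) refl (bits (f a) w) (x w) ⟩
      (bits (f a) w xor x w) xor x w ≡⟨ cong (_xor x w) (sym (bits-encode (base (f a)) _ w)) ⟩
      bits (Θ f a) w xor x w ≡⟨ cong₂ _xor_ (cong (λ p → bits p w) (e a)) (cong (λ c → chosen (finToFun c) a w) same) ⟩
      bits (Θ g a) w xor x′ w ≡⟨ cong (_xor x′ w) (bits-encode (base (g a)) _ w) ⟩
      (bits (g a) w xor x′ w) xor x′ w ≡⟨ solve 2 (λ s t → (s :+ t) :+ t := s) refl (bits (g a) w) (x′ w) ⟩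
      bits (g a) w ∎
      where
      x = chosen (φ̂ f) a
      x′ = chosen (φ̂ g) a
      base-eq : ∀ a → base (f a) ≡ base (g a)
      base-eq a = trans (sym (base-Θ f a)) (trans (cong base (e a)) (base-Θ g a))
      same : funToFin (base ∘ f) ≡ funToFin (base ∘ g)
      same = funToFin-cong base-eq

    φ̂-hom : ∀ {b} f → IsHom K (cfi b) f → IsHom K Γ (φ̂ f)
    φ̂-hom f h u v e = trans (cong₂ (adj Γ) (φ̂≗ f u) (φ̂≗ f v)) (cfi-base (h u v e))

    Θ-hom : ∀ {b} f → ¬ Certificate K Γ U (φ̂ f) → IsHom K (cfi b) f → IsHom K (cfi (not b)) (Θ f)
    Θ-hom {b} f none h u v e = cfi-adj⁺
        (trans (cong₂ (adj Γ) (base-Θ f u) (base-Θ f v)) (cfi-base (h u v e)))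
        (flip u (cfi-goodˡ (h u v e))) (flip v (cfi-goodʳ (h u v e))) (begin
      bits (Θ f u) (base (Θ f v)) ≡⟨ trans (cong (bits (Θ f u)) (base-Θ f v)) (bits-encode (base (f u)) _ _) ⟩
      bits (f u) (base (f v)) xor x u (base (f v)) ≡⟨ cong₂ _xor_ (cfi-bits (h u v e)) (trans (cong (x u) (sym (φ̂≗ f v))) (trans (S.edge u v e) (cong (x v) (φ̂≗ f u)))) ⟩
      bits (f v) (base (f u)) xor x v (base (f u)) ≡⟨ sym (trans (cong (bits (Θ f v)) (base-Θ f u)) (bits-encode (base (f v)) _ _)) ⟩
      bits (Θ f v) (base (Θ f u)) ∎)
      where
      x = chosen (φ̂ f)
      module S = Solution (chosen-solution (φ̂ f) none)
      flip : ∀ a → parity (f a) ≡ b ∧ (base (f a) == U) → parity (Θ f a) ≡ not b ∧ (base (Θ f a) == U)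
      flip a g = begin
        parity (Θ f a) ≡⟨ parity-shift (f a) (x a) ⟩
        parity (f a) xor ⨁ (λ w → adj Γ (base (f a)) w ∧ x a w)
          ≡⟨ cong₂ _xor_ g (trans (⨁-cong λ w → cong (λ t → adj Γ t w ∧ x a w) (sym (φ̂≗ f a))) (trans (S.vertex a) (cong (_== U) (φ̂≗ f a)))) ⟩
        (b ∧ (base (f a) == U)) xor (base (f a) == U) ≡⟨ negate b (base (f a) == U) ⟩
        not b ∧ (base (f a) == U) ≡⟨ cong (λ t → not b ∧ (t == U)) (sym (base-Θ f a)) ⟩
        not b ∧ (base (Θ f a) == U) ∎
        where
        negate : ∀ s t → (s ∧ t) xor t ≡ not s ∧ t
        negate true t = xor-same t
        negate false t = refl

  -- One system governs both the passage from even to odd and the way back, so `Θ` is an injection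
  -- in either direction and no inverse has to be built.
  cfi-indistinguishable : ∀ {n} (K : Graph n) → (∀ φ → IsHom K Γ φ → ¬ Certificate K Γ U φ) → hom K (cfi false) ≡ hom K (cfi true)
  cfi-indistinguishable K none = ℕ.≤-antisym (le false) (le true)
    where
    open Translate K
    le : ∀ b → hom K (cfi b) ≤ hom K (cfi (not b))
    le b = hom-≤ K (cfi b) (cfi (not b)) Θ (λ f h → Θ-hom {b} f (none _ (φ̂-hom {b} f h)) h) Θ-inj

  module _ (nbr : ∀ v → ∃ λ w → adj Γ v w ≡ true) where
    open Translate Γ

    private
      bits-solution : ∀ f → IsHom Γ (cfi true) f → Solution Γ Γ U (φ̂ f) (λ a w → bits (f a) w)
      bits-solution f h = record
        -- Vertices of wrong parity exist as isolated vertices; the neighbour `w` puts `f a` on an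
        -- edge, which certifies its parity.
        { vertex = λ a → let (w , e) = nbr a in
            trans (⨁-cong λ w → cong (λ t → adj Γ t w ∧ bits (f a) w) (φ̂≗ f a)) (trans (cfi-goodˡ (h a w e)) (cong (_== U) (sym (φ̂≗ f a))))
        ; edge = λ a b e → trans (cong (bits (f a)) (φ̂≗ f b)) (trans (cfi-bits (h a b e)) (cong (bits (f b)) (sym (φ̂≗ f a)))) }

      no-certificate : ∀ f → IsHom Γ (cfi true) f → ¬ Certificate Γ Γ U (φ̂ f)
      no-certificate f h C = certificate⇒¬solution Γ Γ U (φ̂ f) (φ̂-hom {true} f h) C _ (bits-solution f h)

      section : Fin N → Vertex
      section v = encode v (λ _ → false)

      section-hom : IsHom Γ (cfi false) section
      section-hom u v e = cfi-adj⁺ (trans (cong₂ (adj Γ) (base-encode u _) (base-encode v _)) e) (even u) (even v)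
        (trans (bits-encode u _ _) (sym (bits-encode v _ _)))
        where
        even : ∀ v → parity (section v) ≡ false
        even v = ⨁-false λ w → trans (cong (adj Γ _ w ∧_) (bits-encode v _ w)) (∧-zeroʳ _)

      identity-certificate : ∀ φ → (∀ v → φ v ≡ v) → Certificate Γ Γ U φ
      identity-certificate φ φ-id = record
        { y = λ _ → true ; z = adj Γ ; z-sym = Graph.sym Γ ; z-adj = λ _ _ e → e
        ; balance = λ a w e → sym (trans (⨁-cong λ b → cong (λ t → (t == w) ∧ adj Γ a b) (φ-id b)) (trans (⨁-δ w (adj Γ a)) (trans (cong (λ t → adj Γ t w) (sym (φ-id a))) e)))
        ; odd = trans (⨁-cong λ a → cong (λ t → (t == U) ∧ true) (φ-id a)) (⨁-δ U (λ _ → true)) }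

    -- A homomorphism from Γ to the odd graph solves its own system by its bits, so `Θ` sends all of
    -- them to the even graph. The section v ↦ (v , ∅) is missed: a preimage would project to the
    -- identity, which has the all-ones certificate.
    cfi-distinguished : hom Γ (cfi true) < hom Γ (cfi false)
    cfi-distinguished = hom-< Γ (cfi true) (cfi false) Θ (λ f h → Θ-hom {true} f (no-certificate f h) h) Θ-inj section section-hom
      λ f h e → no-certificate f h (identity-certificate (φ̂ f) λ v → trans (φ̂≗ f v) (trans (sym (base-Θ f v)) (trans (cong base (e v)) (base-encode v _))))

-- Reachability and rooted trees

Path : ∀ {n} → Adj n → Fin n → Fin n → Set
Path A = Star (λ u v → A u v ≡ true)

firstOr-default : ∀ {n} {A : Set} {d d′ : A} (p : Fin n → Bool) (g : Fin n → A) {i} → p i ≡ true → firstOr d p g ≡ firstOr d′ p g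
firstOr-default {suc n} p g {i} pi with p zero in eq
... | true = refl
firstOr-default {suc n} p g {zero} pi | false = ⊥-elim (true≢false pi eq)
firstOr-default {suc n} p g {suc i} pi | false = firstOr-default (p ∘ suc) (g ∘ suc) {i} pi

least : (p : ℕ → Bool) → ∀ m → p m ≡ true → ∃ λ i → p i ≡ true × i ≤ m × (∀ j → j < i → p j ≡ false)
least p zero pm = zero , pm , z≤n , λ _ ()
least p (suc m) pm with true-or-false (p zero)
... | inj₁ p0 = zero , p0 , z≤n , λ _ ()
... | inj₂ p0 = let (i , pi , i≤m , min) = least (p ∘ suc) m pm in
    suc i , pi , s≤s i≤m , λ { zero _ → p0 ; (suc j) (s≤s j<i) → min j j<i }

module _ {n : ℕ} (A : Adj n) where

  reachK⇒Path : ∀ k {u w} → reachK k A u w ≡ true → Path A u w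
  reachK⇒Path zero {u} {w} h rewrite ==⇒≡ u w h = ε
  reachK⇒Path (suc k) {u} {w} h with ∨-case {reachK k A u w} h
  ... | inj₁ q = reachK⇒Path k q
  ... | inj₂ q = let (x , e) = anyF⁻ _ q in reachK⇒Path k (∧-fst {reachK k A u x} e) ◅◅ (∧-snd {reachK k A u x} e ◅ ε)

  reachK-step : ∀ k {u x w} → reachK k A u x ≡ true → A x w ≡ true → reachK (suc k) A u w ≡ true
  reachK-step k {u} {x} {w} h e = ∨-injʳ {reachK k A u w} (anyF⁺ _ x (∧-true h e))

  reachK-mono : ∀ {j k u w} → j ≤ k → reachK j A u w ≡ true → reachK k A u w ≡ true
  reachK-mono {j} {k} {u} {w} j≤k h = go (ℕ.≤⇒≤′ j≤k)
    where
    go : ∀ {k} → j ≤′ k → reachK k A u w ≡ true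
    go (≤′-reflexive refl) = h
    go (≤′-step q) = ∨-injˡ (go q)

  private
    Closed : Fin n → ℕ → Set
    Closed u k = ∀ w → reachK (suc k) A u w ≡ true → reachK k A u w ≡ true

    -- Until the reached set is closed under neighbours, every step adds a vertex, so its size
    -- exceeds the number of steps. Hence the n steps built into `reach` suffice.
    grow : ∀ u k → (∃ λ j → j ≤ k × Closed u j) ⊎ (k < cnt (reachK k A u))
    grow u zero = inj₂ (ℕ.≤-trans (ℕ.≤-reflexive (sym (∑-δ u))) (cnt-mono λ i e → trans (==-sym u i) e))
    grow u (suc k) with grow u k
    ... | inj₁ (j , j≤k , c) = inj₁ (j , ℕ.m≤n⇒m≤1+n j≤k , c)
    ... | inj₂ h with search (λ w → reachK (suc k) A u w ∧ not (reachK k A u w))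
    ...   | inj₂ none = inj₁ (k , ℕ.n≤1+n k , λ w q → case true-or-false (reachK k A u w) of λ where
              (inj₁ r) → r
              (inj₂ r) → ⊥-elim (true≢false (∧-true q (cong not r)) (none w)))
    ...   | inj₁ (w , q) = inj₂ (ℕ.≤-trans (s≤s (ℕ.≤-trans h (cnt-mono {p = reachK k A u} {q = λ i → reachK (suc k) A u i ∧ not (i == w)} λ i r → ∧-true (∨-injˡ r)
              (cong not (≢⇒==false {u = i} {w} λ { refl → true≢false r (not-true (∧-snd {reachK (suc k) A u w} q)) })))))
              (cnt-remove (reachK (suc k) A u) w (∧-fst {reachK (suc k) A u w} q)))

    saturated : ∀ u → ∃ λ j → j ≤ n × Closed u j
    saturated u with grow u n
    ... | inj₁ c = c
    ... | inj₂ h = ⊥-elim (ℕ.<-irrefl refl (ℕ.≤-trans h (ℕ.≤-trans (ℕ.m≤m+n _ _) (ℕ.≤-reflexive (cnt-not (reachK n A u))))))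

  Path⇒reach : ∀ {u w} → Path A u w → reach A u w ≡ true
  Path⇒reach {u} p = let (j , j≤n , c) = saturated u in reachK-mono j≤n (go j c (reachK-mono {0} {j} {u} {u} z≤n (==-refl u)) p)
    where
    go : ∀ j → Closed u j → ∀ {x w} → reachK j A u x ≡ true → Path A x w → reachK j A u w ≡ true
    go j c h ε = h
    go j c h (e ◅ p) = go j c (c _ (reachK-step j h e)) p

  reach⇒Path : ∀ {u w} → reach A u w ≡ true → Path A u w
  reach⇒Path = reachK⇒Path n

  reach-refl : ∀ u → reach A u u ≡ true
  reach-refl u = Path⇒reach ε

  reach-trans : ∀ {u v w} → reach A u v ≡ true → reach A v w ≡ true → reach A u w ≡ true
  reach-trans p q = Path⇒reach (reach⇒Path p ◅◅ reach⇒Path q)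

  reach-edge : ∀ {u v} → A u v ≡ true → reach A u v ≡ true
  reach-edge e = Path⇒reach (e ◅ ε)

  module Components (A-sym : ∀ u v → A u v ≡ A v u) where

    reach-sym : ∀ {u v} → reach A u v ≡ true → reach A v u ≡ true
    reach-sym p = Path⇒reach (reverse (λ {u} {v} e → trans (A-sym v u) e) (reach⇒Path p))

    reach-cong : ∀ {u v} → reach A u v ≡ true → ∀ w → reach A u w ≡ reach A v w
    reach-cong p w = iff⇒≡ (reach-trans (reach-sym p)) (reach-trans p)

    -- The least vertex of the component, in accordance with the choice of roots in `numComps`.
    rep : Fin n → Fin n
    rep u = firstOr u (reach A u) id

    rep-reach : ∀ u → reach A u (rep u) ≡ true
    rep-reach u = let (j , r , e) = firstOr-some {d = u} (reach A u) id (reach-refl u) in trans (cong (reach A u) e) r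

    rep-cong : ∀ {u v} → reach A u v ≡ true → rep u ≡ rep v
    rep-cong {u} {v} p = trans (firstOr-cong (reach-cong p)) (firstOr-default (reach A v) id (reach-refl v))

    rep⇒reach : ∀ {u v} → rep u ≡ rep v → reach A u v ≡ true
    rep⇒reach {u} {v} e = reach-trans (rep-reach u) (subst (λ t → reach A t v ≡ true) (sym e) (reach-sym (rep-reach v)))

    rep-idem : ∀ u → rep (rep u) ≡ rep u
    rep-idem u = rep-cong (reach-sym (rep-reach u))

module Rooted {s : ℕ} (T : Adj (suc s)) (tree : IsTree T) where
  open IsTree tree renaming (sym to T-sym; irrefl to T-irrefl)

  root : Fin (suc s)
  root = zero

  private
    depth-spec : ∀ v → ∃ λ i → reachK i T root v ≡ true × i ≤ suc s × (∀ j → j < i → reachK j T root v ≡ false)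
    depth-spec v = least (λ i → reachK i T root v) (suc s) (connected root v)

  depth : Fin (suc s) → ℕ
  depth v = proj₁ (depth-spec v)

  depth-bound : ∀ v → depth v ≤ suc s
  depth-bound v = proj₁ (proj₂ (proj₂ (depth-spec v)))

  private
    depth-reach : ∀ v → reachK (depth v) T root v ≡ true
    depth-reach v = proj₁ (proj₂ (depth-spec v))

    depth-min : ∀ v j → reachK j T root v ≡ true → depth v ≤ j
    depth-min v j h with depth v ℕ.≤? j
    ... | yes q = q
    ... | no q = ⊥-elim (true≢false h (proj₂ (proj₂ (proj₂ (depth-spec v))) j (ℕ.≰⇒> q)))

    parent-spec : ∀ v → v ≢ root → ∃ λ x → T x v ≡ true × depth v ≡ suc (depth x)
    parent-spec v v≢ with depth v in eq
    ... | zero = ⊥-elim (v≢ (sym (==⇒≡ root v (subst (λ i → reachK i T root v ≡ true) eq (depth-reach v)))))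
    ... | suc i with ∨-case {reachK i T root v} (subst (λ i → reachK i T root v ≡ true) eq (depth-reach v))
    ...   | inj₁ h = ⊥-elim (ℕ.<-irrefl refl (ℕ.≤-trans (ℕ.≤-reflexive (sym eq)) (depth-min v i h)))
    ...   | inj₂ h = let (x , q) = anyF⁻ _ h in x , ∧-snd {reachK i T root x} q , ℕ.≤-antisym
              (subst (_≤ suc (depth x)) eq (depth-min v (suc (depth x)) (reachK-step T (depth x) (depth-reach x) (∧-snd {reachK i T root x} q))))
              (s≤s (depth-min x i (∧-fst {reachK i T root x} q)))

  parent : Fin (suc s) → Fin (suc s)
  parent v with v ≟ root
  ... | yes _ = root
  ... | no v≢ = proj₁ (parent-spec v v≢)

  parent-edge : ∀ v → v ≢ root → T (parent v) v ≡ true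
  parent-edge v v≢ with v ≟ root
  ... | yes e = ⊥-elim (v≢ e)
  ... | no ne = proj₁ (proj₂ (parent-spec v ne))

  parent-depth : ∀ v → v ≢ root → depth v ≡ suc (depth (parent v))
  parent-depth v v≢ with v ≟ root
  ... | yes e = ⊥-elim (v≢ e)
  ... | no ne = proj₂ (proj₂ (parent-spec v ne))

  private
    up : Fin (suc s) → Fin (suc s) → Bool
    up u v = not (u == root) ∧ (v == parent u)

    up-≢ : ∀ u v → up u v ≡ true → u ≢ root
    up-≢ u v h e = true≢false (≡⇒== e) (not-true (∧-fst {not (u == root)} h))

    up-parent : ∀ u v → up u v ≡ true → v ≡ parent u
    up-parent u v h = ==⇒≡ v (parent u) (∧-snd {not (u == root)} h)

    exclusive : ∀ p₁ p₂ p₃ p₄ q → (p₁ ≡ true → q ≡ true) → (p₂ ≡ true → q ≡ true) → (p₃ ≡ true → q ≡ true) → (p₄ ≡ true → q ≡ true) →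
      (p₁ ≡ true → p₂ ≡ true → ⊥) → (p₁ ∨ p₂ ≡ true → p₃ ∨ p₄ ≡ true → ⊥) → (p₃ ≡ true → p₄ ≡ true → ⊥) →
      (⟦ p₁ ⟧ + ⟦ p₂ ⟧) + (⟦ p₃ ⟧ + ⟦ p₄ ⟧) ≤ ⟦ q ⟧
    exclusive true true _ _ _ _ _ _ _ e _ _ = ⊥-elim (e refl refl)
    exclusive _ _ true true _ _ _ _ _ _ _ e = ⊥-elim (e refl refl)
    exclusive true false true false _ _ _ _ _ _ e _ = ⊥-elim (e refl refl)
    exclusive true false false true _ _ _ _ _ _ e _ = ⊥-elim (e refl refl)
    exclusive false true true false _ _ _ _ _ _ e _ = ⊥-elim (e refl refl)
    exclusive false true false true _ _ _ _ _ _ e _ = ⊥-elim (e refl refl)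
    exclusive true false false false q h _ _ _ _ _ _ rewrite h refl = s≤s z≤n
    exclusive false true false false q _ h _ _ _ _ _ rewrite h refl = s≤s z≤n
    exclusive false false true false q _ _ h _ _ _ _ rewrite h refl = s≤s z≤n
    exclusive false false false true q _ _ _ h _ _ _ rewrite h refl = s≤s z≤n
    exclusive false false false false q _ _ _ _ _ _ _ = z≤n

    ∑-point : ∀ {n} b (x : Fin n) → ∑ (λ v → ⟦ b ∧ (v == x) ⟧) ≡ ⟦ b ⟧
    ∑-point true x = ∑-δ x
    ∑-point false x = ∑-0 λ _ → refl

    ∑∑-point : ∀ {n} (a b : Fin n) → ∑ (λ u → ∑ (λ v → ⟦ (u == a) ∧ (v == b) ⟧)) ≡ 1
    ∑∑-point a b = trans (∑-cong λ u → ∑-point (u == a) b) (∑-δ a)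

    ∑∑-up : ∑ (λ u → ∑ (λ v → ⟦ up u v ⟧)) ≡ s
    ∑∑-up = trans (∑-cong λ u → ∑-point (not (u == root)) (parent u))
      (ℕ.suc-injective (trans (cong (_+ cnt (λ u → not (u == root))) (sym (∑-δ root))) (cnt-not (_== root))))

    numDarts≡ : numDarts T full ≡ ∑ (λ u → ∑ (λ v → ⟦ T u v ⟧))
    numDarts≡ = trans (sumF≡∑ _ _) (∑-cong λ u → countF≡cnt _ _)

  -- An edge of T that is not a parent edge would give T at least s + 1 edges.
  tree-edge : ∀ a b → T a b ≡ true → (b ≢ root × parent b ≡ a) ⊎ (a ≢ root × parent a ≡ b)
  tree-edge a b e with true-or-false (up b a) | true-or-false (up a b)
  ... | inj₁ h | _ = inj₁ (up-≢ b a h , sym (up-parent b a h))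
  ... | _ | inj₁ h = inj₂ (up-≢ a b h , sym (up-parent a b h))
  ... | inj₂ nba | inj₂ nab = ⊥-elim (ℕ.<-irrefl refl (ℕ.≤-trans (ℕ.≤-reflexive (sym (⌊n+n/2⌋ (suc s)))) (ℕ.≤-trans (ℕ.⌊n/2⌋-mono many) (ℕ.≤-reflexive edges))))
    where
    ⌊n+n/2⌋ : ∀ n → ⌊ n + n /2⌋ ≡ n
    ⌊n+n/2⌋ n = sym (ℕ.n≡⌊n+n/2⌋ n)
    here₃ : ∀ u v → (u == a) ∧ (v == b) ≡ true → u ≡ a × v ≡ b
    here₃ u v h = ==⇒≡ u a (∧-fst {u == a} h) , ==⇒≡ v b (∧-snd {u == a} h)
    here₄ : ∀ u v → (u == b) ∧ (v == a) ≡ true → u ≡ b × v ≡ a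
    here₄ u v h = ==⇒≡ u b (∧-fst {u == b} h) , ==⇒≡ v a (∧-snd {u == b} h)
    up⇒T : ∀ u v → up u v ≡ true → T u v ≡ true
    up⇒T u v h = trans (cong (T u) (up-parent u v h)) (trans (T-sym u (parent u)) (parent-edge u (up-≢ u v h)))
    up-antisym : ∀ u v → up u v ≡ true → up v u ≡ true → ⊥
    up-antisym u v h h′ = ℕ.<-irrefl refl (ℕ.≤-trans (ℕ.m≤n⇒m≤1+n (ℕ.≤-reflexive (sym eq₂))) (ℕ.≤-reflexive (sym eq₁)))
      where
      eq₁ : depth u ≡ suc (depth v)
      eq₁ = trans (parent-depth u (up-≢ u v h)) (cong (suc ∘ depth) (sym (up-parent u v h)))
      eq₂ : depth v ≡ suc (depth u)
      eq₂ = trans (parent-depth v (up-≢ v u h′)) (cong (suc ∘ depth) (sym (up-parent v u h′)))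
    cross : ∀ u v → up u v ∨ up v u ≡ true → ((u == a) ∧ (v == b)) ∨ ((u == b) ∧ (v == a)) ≡ true → ⊥
    cross u v h h′ with ∨-case {(u == a) ∧ (v == b)} h′
    ... | inj₁ q with here₃ u v q
    ...   | refl , refl = [ (λ r → true≢false r nab) , (λ r → true≢false r nba) ]′ (∨-case {up u v} h)
    cross u v h h′ | inj₂ q with here₄ u v q
    ...   | refl , refl = [ (λ r → true≢false r nba) , (λ r → true≢false r nab) ]′ (∨-case {up u v} h)
    pointwise : ∀ u v → (⟦ up u v ⟧ + ⟦ up v u ⟧) + (⟦ (u == a) ∧ (v == b) ⟧ + ⟦ (u == b) ∧ (v == a) ⟧) ≤ ⟦ T u v ⟧
    pointwise u v = exclusive (up u v) (up v u) _ _ (T u v) (up⇒T u v) (λ h → trans (T-sym u v) (up⇒T v u h))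
      (λ h → case here₃ u v h of λ { (refl , refl) → e }) (λ h → case here₄ u v h of λ { (refl , refl) → trans (T-sym u v) e })
      (up-antisym u v) (cross u v)
      (λ h h′ → case (here₃ u v h , here₄ u v h′) of λ { ((refl , refl) , (eq , _)) → true≢false e (subst (λ t → T u t ≡ false) eq (T-irrefl u)) })
    many : suc s + suc s ≤ numDarts T full
    many = ℕ.≤-trans (ℕ.≤-reflexive (sym total)) (ℕ.≤-trans (∑-mono λ u → ∑-mono λ v → pointwise u v) (ℕ.≤-reflexive (sym numDarts≡)))
      where
      total : ∑ (λ u → ∑ (λ v → (⟦ up u v ⟧ + ⟦ up v u ⟧) + (⟦ (u == a) ∧ (v == b) ⟧ + ⟦ (u == b) ∧ (v == a) ⟧))) ≡ suc s + suc s
      total = trans (∑-cong λ u → trans (∑-+ _ _) (cong₂ _+_ (∑-+ _ _) (∑-+ _ _)))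
        (trans (∑-+ _ _) (trans (cong₂ _+_ (trans (∑-+ _ _) (cong₂ _+_ ∑∑-up (trans (∑-swap (λ u v → ⟦ up v u ⟧)) ∑∑-up))) (trans (∑-+ _ _) (cong₂ _+_ (∑∑-point a b) (∑∑-point b a))))
          (trans (ℕ.+-comm (s + s) 2) (cong suc (sym (ℕ.+-suc s s))))))

  -- Ancestry, built from the lower end upwards: each step peels off one parent of `x`, the shape in
  -- which the edges of `T` are known.
  data Below (t : Fin (suc s)) : Fin (suc s) → Set where
    here : Below t t
    up-from : ∀ {x} → x ≢ root → Below t (parent x) → Below t x

  below-root : ∀ x → Below root x
  below-root x = go (depth x) x refl
    where
    go : ∀ d x → depth x ≡ d → Below root x
    go d x e with x ≟ root
    ... | yes refl = here
    go zero x e | no ne = case trans (sym e) (parent-depth x ne) of λ ()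
    go (suc d) x e | no ne = up-from ne (go d (parent x) (ℕ.suc-injective (trans (sym (parent-depth x ne)) e)))

  below-depth : ∀ {t x} → Below t x → depth t ≤ depth x
  below-depth here = ℕ.≤-refl
  below-depth {t} {x} (up-from ne b) = ℕ.≤-trans (below-depth b) (ℕ.≤-trans (ℕ.n≤1+n _) (ℕ.≤-reflexive (sym (parent-depth x ne))))

  below-child : ∀ {t x} → Below t x → x ≢ t → ∃ λ c → c ≢ root × parent c ≡ t × Below c x
  below-child here ne = ⊥-elim (ne refl)
  below-child {t} {x} (up-from x≢ b) ne with parent x ≟ t
  ... | yes e = x , x≢ , e , here
  ... | no q = let (c , c≢ , e , b′) = below-child b q in c , c≢ , e , up-from x≢ b′

  -- All edges are parent edges, so a subtree can only be left through its top. This confines a flap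
  -- to one child and puts its attachments into the adhesion.
  below-edge : ∀ {c a b} → Below c a → T a b ≡ true → Below c b ⊎ (a ≡ c × b ≡ parent c)
  below-edge {c} {a} {b} h e with tree-edge a b e
  ... | inj₁ (b≢ , refl) = inj₁ (up-from b≢ h)
  ... | inj₂ (a≢ , refl) with h
  ...   | here = inj₂ (refl , refl)
  ...   | up-from _ h′ = inj₁ h′

-- The intersection form of a rotation system

iter-suc : ∀ {A : Set} (f : A → A) i x → iter f i (f x) ≡ f (iter f i x)
iter-suc f zero x = refl
iter-suc f (suc i) x = cong f (iter-suc f i x)

iter-+ : ∀ {A : Set} (f : A → A) i j x → iter f (i + j) x ≡ iter f i (iter f j x)
iter-+ f zero j x = refl
iter-+ f (suc i) j x = cong f (iter-+ f i j x)

pre : (ℕ → Bool) → ℕ → Bool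
pre f zero = false
pre f (suc m) = pre f m xor f m

-- ord f g m is the sum of f i ∧ g j over i < j < m.
ord : (ℕ → Bool) → (ℕ → Bool) → ℕ → Bool
ord f g zero = false
ord f g (suc m) = ord f g m xor (pre f m ∧ g m)

pre-cong : ∀ {f g} m → (∀ i → f i ≡ g i) → pre f m ≡ pre g m
pre-cong zero e = refl
pre-cong (suc m) e = cong₂ _xor_ (pre-cong m e) (e m)

pre-xor : ∀ f g m → pre (λ i → f i xor g i) m ≡ pre f m xor pre g m
pre-xor f g zero = refl
pre-xor f g (suc m) rewrite pre-xor f g m = solve 4 (λ a b c d → (a :+ b) :+ (c :+ d) := (a :+ c) :+ (b :+ d)) refl (pre f m) (pre g m) (f m) (g m)

pre-∧ʳ : ∀ f b m → pre f m ∧ b ≡ pre (λ i → f i ∧ b) m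
pre-∧ʳ f b zero = refl
pre-∧ʳ f b (suc m) = trans (∧-distribʳ-xor b (pre f m) (f m)) (cong (_xor (f m ∧ b)) (pre-∧ʳ f b m))

pre-false : ∀ f m → (∀ i → f i ≡ false) → pre f m ≡ false
pre-false f zero h = refl
pre-false f (suc m) h rewrite pre-false f m h = h m

pre-⨁ : ∀ {n} (f : ℕ → Fin n → Bool) m → ⨁ (λ u → pre (λ i → f i u) m) ≡ pre (λ i → ⨁ (f i)) m
pre-⨁ f zero = ⨁-false λ _ → refl
pre-⨁ f (suc m) = trans (⨁-xor _ _) (cong (_xor ⨁ (f m)) (pre-⨁ f m))

pre-telescope : ∀ (k : ℕ → Bool) m → pre (λ i → k i xor k (suc i)) m ≡ k 0 xor k m
pre-telescope k zero = sym (xor-same (k 0))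
pre-telescope k (suc m) rewrite pre-telescope k m = solve 3 (λ a b c → (a :+ b) :+ (b :+ c) := a :+ c) refl (k 0) (k m) (k (suc m))

pre-unique : ∀ (p : ℕ → Bool) m i → i < m → p i ≡ true → (∀ j → j < m → p j ≡ true → j ≡ i) → pre p m ≡ true
pre-unique p (suc m) i (s≤s i≤m) pi uniq with i ℕ.≟ m
... | yes refl = cong₂ _xor_ (none m ℕ.≤-refl) pi
  where
  none : ∀ k → k ≤ m → pre p k ≡ false
  none zero _ = refl
  none (suc k) k<m = cong₂ _xor_ (none k (ℕ.<⇒≤ k<m)) (¬true⇒false λ pk → ℕ.<-irrefl (uniq k (ℕ.m≤n⇒m≤1+n k<m) pk) k<m)
... | no i≢m = cong₂ _xor_ (pre-unique p m i (ℕ.≤∧≢⇒< i≤m i≢m) pi (λ j j<m → uniq j (ℕ.m≤n⇒m≤1+n j<m)))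
                 (¬true⇒false λ pm → i≢m (sym (uniq m ℕ.≤-refl pm)))

ord-cong : ∀ {f f′ g g′} m → (∀ i → f i ≡ f′ i) → (∀ i → g i ≡ g′ i) → ord f g m ≡ ord f′ g′ m
ord-cong zero e e′ = refl
ord-cong (suc m) e e′ = cong₂ _xor_ (ord-cong m e e′) (cong₂ _∧_ (pre-cong m e) (e′ m))

ord-xorˡ : ∀ f f′ g m → ord (λ i → f i xor f′ i) g m ≡ ord f g m xor ord f′ g m
ord-xorˡ f f′ g zero = refl
ord-xorˡ f f′ g (suc m) rewrite ord-xorˡ f f′ g m | pre-xor f f′ m =
  solve 5 (λ a b c d e → (a :+ b) :+ ((c :+ d) :* e) := (a :+ c :* e) :+ (b :+ d :* e)) refl (ord f g m) (ord f′ g m) (pre f m) (pre f′ m) (g m)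

ord-xorʳ : ∀ f g g′ m → ord f (λ i → g i xor g′ i) m ≡ ord f g m xor ord f g′ m
ord-xorʳ f g g′ zero = refl
ord-xorʳ f g g′ (suc m) rewrite ord-xorʳ f g g′ m =
  solve 5 (λ a b c d e → (a :+ b) :+ (c :* (d :+ e)) := (a :+ c :* d) :+ (b :+ c :* e)) refl (ord f g m) (ord f g′ m) (pre f m) (g m) (g′ m)

ord-false : ∀ f g m → (∀ i j → f i ∧ g j ≡ false) → ord f g m ≡ false
ord-false f g zero h = refl
ord-false f g (suc m) h rewrite ord-false f g m h = trans (pre-∧ʳ f (g m) m) (pre-false _ m λ i → h i m)

-- The product of the two sums splits into the pairs i < j, the pairs i > j and the diagonal.
ord-sym : ∀ f g m → ord f g m xor ord g f m ≡ (pre f m ∧ pre g m) xor pre (λ i → f i ∧ g i) m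
ord-sym f g zero = refl
ord-sym f g (suc m) = begin
  (ord f g m xor (pre f m ∧ g m)) xor (ord g f m xor (pre g m ∧ f m))
    ≡⟨ solve 4 (λ a b c d → (a :+ b) :+ (c :+ d) := (a :+ c) :+ (b :+ d)) refl (ord f g m) (pre f m ∧ g m) (ord g f m) (pre g m ∧ f m) ⟩
  (ord f g m xor ord g f m) xor ((pre f m ∧ g m) xor (pre g m ∧ f m)) ≡⟨ cong (_xor ((pre f m ∧ g m) xor (pre g m ∧ f m))) (ord-sym f g m) ⟩
  ((pre f m ∧ pre g m) xor pre (λ i → f i ∧ g i) m) xor ((pre f m ∧ g m) xor (pre g m ∧ f m))
    ≡⟨ solve 5 (λ p q d f g → ((p :* q) :+ d) :+ ((p :* g) :+ (q :* f)) := ((p :+ f) :* (q :+ g)) :+ (d :+ f :* g)) refl (pre f m) (pre g m) (pre (λ i → f i ∧ g i) m) (f m) (g m) ⟩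
  ((pre f m xor f m) ∧ (pre g m xor g m)) xor (pre (λ i → f i ∧ g i) m xor (f m ∧ g m)) ∎

lt : ∀ {n} → Fin n → Fin n → Bool
lt u v = does (toℕ u ℕ.<? toℕ v)

lt-true : ∀ {n} {u v : Fin n} → toℕ u < toℕ v → lt u v ≡ true
lt-true {u = u} {v} h = dec-true (toℕ u ℕ.<? toℕ v) h

lt-false : ∀ {n} {u v : Fin n} → ¬ (toℕ u < toℕ v) → lt u v ≡ false
lt-false {u = u} {v} h = dec-false (toℕ u ℕ.<? toℕ v) h

data Order {n} (u v : Fin n) : Set where
  below : lt u v ≡ true → lt v u ≡ false → Order u v
  equal : u ≡ v → lt u v ≡ false → Order u v
  above : lt u v ≡ false → lt v u ≡ true → Order u v

order : ∀ {n} (u v : Fin n) → Order u v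
order u v with ℕ.<-cmp (toℕ u) (toℕ v)
... | tri< a _ c = below (lt-true a) (lt-false c)
... | tri≈ a b _ = equal (Fin.toℕ-injective b) (lt-false a)
... | tri> a _ c = above (lt-false a) (lt-true c)

⨁⨁-unordered : ∀ {n} (f : Fin n → Fin n → Bool) → (∀ u → f u u ≡ false) →
  ⨁ (λ u → ⨁ (f u)) ≡ ⨁ (λ u → ⨁ (λ v → lt u v ∧ (f u v xor f v u)))
⨁⨁-unordered f d = begin
  ⨁ (λ u → ⨁ (f u)) ≡⟨ ⨁-cong (λ u → trans (⨁-cong λ v → split u v) (⨁-xor _ _)) ⟩
  ⨁ (λ u → ⨁ (λ v → lt u v ∧ f u v) xor ⨁ (λ v → lt v u ∧ f u v)) ≡⟨ ⨁-xor _ _ ⟩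
  ⨁ (λ u → ⨁ (λ v → lt u v ∧ f u v)) xor ⨁ (λ u → ⨁ (λ v → lt v u ∧ f u v)) ≡⟨ cong (⨁ (λ u → ⨁ (λ v → lt u v ∧ f u v)) xor_) (⨁-swap _) ⟩
  ⨁ (λ u → ⨁ (λ v → lt u v ∧ f u v)) xor ⨁ (λ u → ⨁ (λ v → lt u v ∧ f v u)) ≡⟨ sym (trans (⨁-cong λ u → trans (⨁-cong λ v → ∧-distribˡ-xor (lt u v) (f u v) (f v u)) (⨁-xor _ _)) (⨁-xor _ _)) ⟩
  ⨁ (λ u → ⨁ (λ v → lt u v ∧ (f u v xor f v u))) ∎
  where
  split : ∀ u v → f u v ≡ (lt u v ∧ f u v) xor (lt v u ∧ f u v)
  split u v with order u v
  ... | below p q rewrite p | q = sym (xor-identityʳ (f u v))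
  ... | equal refl q rewrite q = d u
  ... | above p q rewrite p | q = refl

module Form {n : ℕ} {A : Adj n} {X : Mask n} (R : RotSystem A X)
    (E-sym : ∀ u v → adjM A X u v ≡ adjM A X v u) (E-irrefl : ∀ u → adjM A X u u ≡ false) where
  open RotSystem R public

  E : Adj n
  E = adjM A X

  Chain : Set
  Chain = Fin n → Fin n → Bool

  record IsChain (x : Chain) : Set where
    field
      symm : ∀ u v → x u v ≡ x v u
      supp : ∀ u v → x u v ≡ true → E u v ≡ true
    diag : ∀ u → x u u ≡ false
    diag u = ¬true⇒false λ h → true≢false (supp u u h) (E-irrefl u)
  open IsChain public

  ∂ : Chain → Fin n → Bool
  ∂ x a = ⨁ (x a)

  start : Fin n → Fin n
  start a = firstOr a (E a) id

  start-nbr : ∀ {a u} → E a u ≡ true → E a (start a) ≡ true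
  start-nbr {a} e = let (j , Ej , eq) = firstOr-some {d = a} (E a) id e in trans (cong (E a) eq) Ej

  seq : Fin n → ℕ → Fin n
  seq a i = iter (ρ a) i (start a)

  private
    period : ∀ a → E a (start a) ≡ true → ∃ λ i → iter (ρ a) (suc i) (start a) ≡ start a × (∀ j → j < i → iter (ρ a) (suc j) (start a) ≢ start a)
    period a e =
      let (m , q) = cyclic a (ρ a (start a)) (start a) (ρ-closed a (start a) e) e
          p = λ i → iter (ρ a) (suc i) (start a) == start a
          (i , pi , _ , min) = least p m (≡⇒== (trans (sym (iter-suc (ρ a) m (start a))) q))
      in i , ==⇒≡ _ _ pi , λ j j<i h → true≢false (≡⇒== h) (min j j<i)

  len : Fin n → ℕ
  len a with true-or-false (E a (start a))
  ... | inj₁ e = suc (proj₁ (period a e))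
  ... | inj₂ _ = 0

  seq-nbr : ∀ a i → E a (start a) ≡ true → E a (seq a i) ≡ true
  seq-nbr a zero e = e
  seq-nbr a (suc i) e = ρ-closed a (seq a i) (seq-nbr a i e)

  seq-closes : ∀ a → seq a (len a) ≡ start a
  seq-closes a with true-or-false (E a (start a))
  ... | inj₁ e = proj₁ (proj₂ (period a e))
  ... | inj₂ _ = refl

  private
    seq-cancel : ∀ a i j → E a (start a) ≡ true → seq a i ≡ seq a (i + j) → start a ≡ seq a j
    seq-cancel a zero j e h = h
    seq-cancel a (suc i) j e h = seq-cancel a i j e (trans (sym (ρ'ρ a _ (seq-nbr a i e))) (trans (cong (ρ' a) h) (ρ'ρ a _ (seq-nbr a (i + j) e))))

    seq-distinct< : ∀ a i j → i < j → j < len a → E a (start a) ≡ true → seq a i ≢ seq a j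
    seq-distinct< a i j i<j j<l e h with true-or-false (E a (start a))
    ... | inj₂ q = true≢false e q
    ... | inj₁ e′ with j ∸ i in eq
    ...   | zero = ℕ.<-irrefl refl (ℕ.≤-trans i<j (ℕ.m∸n≡0⇒m≤n eq))
    ...   | suc d = proj₂ (proj₂ (period a e′)) d (ℕ.≤-trans (ℕ.≤-trans (ℕ.≤-reflexive (sym eq)) (ℕ.m∸n≤m j i)) (s≤s⁻¹ j<l))
                    (sym (seq-cancel a i (suc d) e (trans h (cong (seq a) (trans (sym (ℕ.m+[n∸m]≡n (ℕ.<⇒≤ i<j))) (cong (i +_) eq))))))

    seq-distinct : ∀ a i j → i < len a → j < len a → E a (start a) ≡ true → seq a i ≡ seq a j → i ≡ j
    seq-distinct a i j i<l j<l e h with ℕ.<-cmp i j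
    ... | tri< i<j _ _ = ⊥-elim (seq-distinct< a i j i<j j<l e h)
    ... | tri≈ _ i≡j _ = i≡j
    ... | tri> _ _ j<i = ⊥-elim (seq-distinct< a j i j<i i<l e (sym h))

    len-positive : ∀ a → E a (start a) ≡ true → ∃ λ l → len a ≡ suc l
    len-positive a e with true-or-false (E a (start a))
    ... | inj₁ _ = _ , refl
    ... | inj₂ q = ⊥-elim (true≢false e q)

    seq-wrap : ∀ a → E a (start a) ≡ true → ∀ i → ∃ λ j → j < len a × seq a j ≡ seq a i
    seq-wrap a e zero = 0 , subst (0 <_) (sym (proj₂ (len-positive a e))) (s≤s z≤n) , refl
    seq-wrap a e (suc i) with seq-wrap a e i
    ... | j , j<l , h with suc j ℕ.<? len a
    ...   | yes sj<l = suc j , sj<l , cong (ρ a) h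
    ...   | no sj≮l = 0 , subst (0 <_) (sym (proj₂ (len-positive a e))) (s≤s z≤n) ,
              trans (sym (seq-closes a)) (trans (cong (seq a) (ℕ.≤-antisym (ℕ.≮⇒≥ sj≮l) j<l)) (cong (ρ a) h))

    seq-covers : ∀ a w → E a w ≡ true → ∃ λ i → i < len a × seq a i ≡ w
    seq-covers a w ew =
      let e = start-nbr ew
          (i , q) = cyclic a (start a) w e ew
          (j , j<l , h) = seq-wrap a e i
      in j , j<l , trans h q

  -- Every neighbour occurs in the rotation by `cyclic`, and only once because `len` is the first
  -- return to `start a`.
  ring-sum : ∀ a (f : Fin n → Bool) → (∀ u → f u ≡ true → E a u ≡ true) → ⨁ f ≡ pre (λ i → f (seq a i)) (len a)
  ring-sum a f sup = begin
    ⨁ f ≡⟨ ⨁-cong (λ u → once u) ⟩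
    ⨁ (λ u → pre (λ i → (seq a i == u) ∧ f u) (len a)) ≡⟨ pre-⨁ (λ i u → (seq a i == u) ∧ f u) (len a) ⟩
    pre (λ i → ⨁ (λ u → (seq a i == u) ∧ f u)) (len a) ≡⟨ pre-cong (len a) (λ i → ⨁-δ′ (seq a i) f) ⟩
    pre (λ i → f (seq a i)) (len a) ∎
    where
    once : ∀ u → f u ≡ pre (λ i → (seq a i == u) ∧ f u) (len a)
    once u with true-or-false (f u)
    ... | inj₂ q = trans q (sym (pre-false _ (len a) λ i → trans (cong ((seq a i == u) ∧_) q) (∧-zeroʳ _)))
    ... | inj₁ q = let (i , i<l , h) = seq-covers a u (sup u q) in
      trans q (sym (trans (pre-cong (len a) λ j → trans (cong ((seq a j == u) ∧_) q) (∧-identityʳ _))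
        (pre-unique (λ j → seq a j == u) (len a) i i<l (≡⇒== h)
          (λ j j<l pj → seq-distinct a j i j<l i<l (start-nbr (sup u q)) (trans (==⇒≡ (seq a j) u pj) (sym h))))))

  -- The cyclic order at `a` is cut open at `start a`. Moving the cut past one edge changes the
  -- value by multiples of the degrees of `x` and `y` at `a`, hence not at all for cycles.
  local : Fin n → Chain → Chain → Bool
  local a x y = ord (λ i → x a (seq a i)) (λ i → y a (seq a i)) (len a)

  edgeTerm : Chain → Chain → Bool
  edgeTerm x y = ⨁ (λ u → ⨁ (λ v → (lt u v ∧ not (sig u v)) ∧ (x u v ∧ y u v)))

  -- The intersection form. Perturbing the second chain off the first, every untwisted common edge
  -- contributes one crossing besides those at the vertices.
  B : Chain → Chain → Bool
  B x y = ⨁ (λ a → local a x y) xor edgeTerm x y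

  B-congˡ : ∀ {x x′} y → (∀ u v → x u v ≡ x′ u v) → B x y ≡ B x′ y
  B-congˡ y e = cong₂ _xor_ (⨁-cong λ a → ord-cong (len a) (λ i → e a _) (λ _ → refl))
    (⨁-cong λ u → ⨁-cong λ v → cong (λ t → (lt u v ∧ not (sig u v)) ∧ (t ∧ y u v)) (e u v))

  B-xorˡ : ∀ x x′ y → B (λ u v → x u v xor x′ u v) y ≡ B x y xor B x′ y
  B-xorˡ x x′ y = trans (cong₂ _xor_
      (trans (⨁-cong λ a → ord-xorˡ (λ i → x a (seq a i)) (λ i → x′ a (seq a i)) _ (len a)) (⨁-xor _ _))
      (trans (⨁-cong λ u → trans (⨁-cong λ v → solve 4 (λ p q r s → p :* ((q :+ r) :* s) := p :* (q :* s) :+ p :* (r :* s)) refl (lt u v ∧ not (sig u v)) (x u v) (x′ u v) (y u v)) (⨁-xor _ _)) (⨁-xor _ _)))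
    (solve 4 (λ a b c d → (a :+ b) :+ (c :+ d) := (a :+ c) :+ (b :+ d)) refl (⨁ (λ a → local a x y)) (⨁ (λ a → local a x′ y)) (edgeTerm x y) (edgeTerm x′ y))

  B-xorʳ : ∀ x y y′ → B x (λ u v → y u v xor y′ u v) ≡ B x y xor B x y′
  B-xorʳ x y y′ = trans (cong₂ _xor_
      (trans (⨁-cong λ a → ord-xorʳ (λ i → x a (seq a i)) (λ i → y a (seq a i)) (λ i → y′ a (seq a i)) (len a)) (⨁-xor _ _))
      (trans (⨁-cong λ u → trans (⨁-cong λ v → solve 4 (λ p q r s → p :* (q :* (r :+ s)) := p :* (q :* r) :+ p :* (q :* s)) refl (lt u v ∧ not (sig u v)) (x u v) (y u v) (y′ u v)) (⨁-xor _ _)) (⨁-xor _ _)))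
    (solve 4 (λ a b c d → (a :+ b) :+ (c :+ d) := (a :+ c) :+ (b :+ d)) refl (⨁ (λ a → local a x y)) (⨁ (λ a → local a x y′)) (edgeTerm x y) (edgeTerm x y′))

  B-disjoint : ∀ x y → (∀ a u w → x a u ∧ y a w ≡ false) → B x y ≡ false
  B-disjoint x y h = cong₂ _xor_ (⨁-false λ a → ord-false _ _ (len a) λ i j → h a _ _)
    (⨁-false λ u → ⨁-false λ v → trans (cong ((lt u v ∧ not (sig u v)) ∧_) (h u v v)) (∧-zeroʳ _))

  B-zeroˡ : ∀ x y → (∀ u v → x u v ≡ false) → B x y ≡ false
  B-zeroˡ x y h = B-disjoint x y λ a u w → cong (_∧ y a w) (h a u)

  B-scaleˡ : ∀ b x y → B (λ u v → b ∧ x u v) y ≡ b ∧ B x y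
  B-scaleˡ true x y = refl
  B-scaleˡ false x y = B-zeroˡ _ y λ _ _ → refl

  B-⨁ˡ : ∀ {m} (x : Fin m → Chain) y → B (λ u v → ⨁ (λ j → x j u v)) y ≡ ⨁ (λ j → B (x j) y)
  B-⨁ˡ {zero} x y = trans (B-zeroˡ _ y λ _ _ → ⨁-zero _) (sym (⨁-zero _))
  B-⨁ˡ {suc m} x y = trans (B-congˡ y λ u v → ⨁-suc _) (trans (B-xorˡ (x zero) _ y) (trans (cong (B (x zero) y xor_) (B-⨁ˡ (x ∘ suc) y)) (sym (⨁-suc _))))

  -- By `ord-sym` the two orders at a vertex add up to the product of the boundaries plus the common
  -- edges there. A common edge is met at both of its ends and cancels, as does `edgeTerm`, which is
  -- symmetric.
  B-sym : ∀ x y → IsChain x → IsChain y → B x y xor B y x ≡ ⨁ (λ a → ∂ x a ∧ ∂ y a)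
  B-sym x y cx cy = begin
    B x y xor B y x ≡⟨ solve 4 (λ a b c d → (a :+ b) :+ (c :+ d) := (a :+ c) :+ (b :+ d)) refl (⨁ (λ a → local a x y)) (edgeTerm x y) (⨁ (λ a → local a y x)) (edgeTerm y x) ⟩
    (⨁ (λ a → local a x y) xor ⨁ (λ a → local a y x)) xor (edgeTerm x y xor edgeTerm y x)
      ≡⟨ cong₂ _xor_ (sym (⨁-xor _ _)) (trans (cong (edgeTerm x y xor_) (⨁-cong λ u → ⨁-cong λ v → cong ((lt u v ∧ not (sig u v)) ∧_) (∧-comm (y u v) (x u v)))) (xor-same (edgeTerm x y))) ⟩
    ⨁ (λ a → local a x y xor local a y x) xor false ≡⟨ xor-identityʳ _ ⟩
    ⨁ (λ a → local a x y xor local a y x) ≡⟨ ⨁-cong (λ a → trans (ord-sym _ _ (len a)) (cong₂ _xor_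
        (cong₂ _∧_ (sym (ring-sum a (x a) (supp cx a))) (sym (ring-sum a (y a) (supp cy a))))
        (sym (ring-sum a (λ u → x a u ∧ y a u) λ u h → supp cx a u (∧-fst {x a u} h))))) ⟩
    ⨁ (λ a → (∂ x a ∧ ∂ y a) xor ⨁ (λ u → x a u ∧ y a u)) ≡⟨ ⨁-xor _ _ ⟩
    ⨁ (λ a → ∂ x a ∧ ∂ y a) xor ⨁ (λ a → ⨁ (λ u → x a u ∧ y a u))
      ≡⟨ cong (⨁ (λ a → ∂ x a ∧ ∂ y a) xor_) (⨁⨁-symmetric (λ a u → cong₂ _∧_ (symm cx a u) (symm cy a u)) (λ a → cong (_∧ y a a) (diag cx a))) ⟩
    ⨁ (λ a → ∂ x a ∧ ∂ y a) xor false ≡⟨ xor-identityʳ _ ⟩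
    ⨁ (λ a → ∂ x a ∧ ∂ y a) ∎

  Labelling : Set
  Labelling = Fin n → Fin n → Bool → Bool

  -- A function on faces, as a function on face-tracing states that is constant along each
  -- traversal and unchanged when the traversal is reversed.
  record IsFaceLabelling (q : Labelling) : Set where
    field
      along : ∀ u v s → E u v ≡ true → q u v s ≡ q v (if s xor sig u v then ρ v u else ρ' v u) (s xor sig u v)
      reversed : ∀ u v s → E u v ≡ true → q u v s ≡ q v u (not (s xor sig u v))

    -- The traversal that arrives at `a` from `u` with updated bit `true` leaves towards `ρ a u`.
    -- Thus `q a u true` labels the corner before `u` in the rotation, and `q a u false` the corner
    -- after it.
    corner : ∀ a u → E a u ≡ true → q a u false ≡ q a (ρ a u) true
    corner a u e = begin
      q a u false ≡⟨ cong (λ t → q a u (not t)) (sym toggled) ⟩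
      q a u (not (s xor sig u a)) ≡⟨ sym (reversed u a s e′) ⟩
      q u a s ≡⟨ along u a s e′ ⟩
      q a (if s xor sig u a then ρ a u else ρ' a u) (s xor sig u a) ≡⟨ cong (λ t → q a (if t then ρ a u else ρ' a u) t) toggled ⟩
      q a (ρ a u) true ∎
      where
      s = true xor sig u a
      e′ = trans (E-sym u a) e
      toggled : s xor sig u a ≡ true
      toggled = solve 1 (λ t → (con true :+ t) :+ t := con true) refl (sig u a)

  -- The mod 2 boundary of the set of faces labelled `true`: the edges whose two sides carry
  -- different labels.
  faceChain : Labelling → Chain
  faceChain q u v = E u v ∧ (q u v true xor q u v false)

  module _ {q : Labelling} (Q : IsFaceLabelling q) where
    open IsFaceLabelling Q

    faceChain-isChain : IsChain (faceChain q)
    faceChain-isChain = record { supp = λ u v → ∧-fst {E u v} ; symm = λ u v → begin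
        E u v ∧ (q u v true xor q u v false)
          ≡⟨ ∧-congʳ-if {E u v} (λ e → trans (cong₂ _xor_ (reversed u v true e) (reversed u v false e)) (both (q v u) (sig u v))) ⟩
        E u v ∧ (q v u true xor q v u false) ≡⟨ cong (_∧ (q v u true xor q v u false)) (E-sym u v) ⟩
        E v u ∧ (q v u true xor q v u false) ∎ }
      where
      both : ∀ (f : Bool → Bool) t → f (not (true xor t)) xor f (not (false xor t)) ≡ f true xor f false
      both f true = refl
      both f false = xor-comm (f false) (f true)

    private
      faceChain-seq : ∀ a → E a (start a) ≡ true → ∀ i → faceChain q a (seq a i) ≡ q a (seq a i) true xor q a (seq a (suc i)) true
      faceChain-seq a e i = trans (cong (_∧ (q a (seq a i) true xor q a (seq a i) false)) (seq-nbr a i e)) (cong (q a (seq a i) true xor_) (corner a (seq a i) (seq-nbr a i e)))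

      pre-faceChain : ∀ a m → E a (start a) ≡ true → pre (λ i → faceChain q a (seq a i)) m ≡ q a (start a) true xor q a (seq a m) true
      pre-faceChain a m e = trans (pre-cong m (faceChain-seq a e)) (pre-telescope (λ i → q a (seq a i) true) m)

    -- Around a vertex the differences of corner labels telescope, and the rotation closes up.
    ∂-faceChain : ∀ a → ∂ (faceChain q) a ≡ false
    ∂-faceChain a = case true-or-false (E a (start a)) of λ where
      (inj₁ e) → trans (ring-sum a _ (λ u → ∧-fst {E a u})) (trans (pre-faceChain a (len a) e) (trans (cong (λ t → q a (start a) true xor q a t true) (seq-closes a)) (xor-same (q a (start a) true))))
      (inj₂ e) → ⨁-false λ u → ¬true⇒false λ h → true≢false (start-nbr (∧-fst {E a u} h)) e

    private
      -- Summation by parts: the partial sums of the face chain are corner labels relative to the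
      -- first corner, and the first corner is multiplied by the boundary of `y`, which vanishes.
      local-face : ∀ a y → IsChain y → ∂ y a ≡ false → local a (faceChain q) y ≡ ⨁ (λ u → y a u ∧ q a u true)
      local-face a y cy ∂y = case true-or-false (E a (start a)) of λ where
          (inj₂ e) → trans (ord-false _ _ (len a) (λ i j → ¬true⇒false λ h → true≢false (start-nbr (∧-fst {E a (seq a i)} (∧-fst {faceChain q a (seq a i)} h))) e))
              (sym (⨁-false λ u → ¬true⇒false λ h → true≢false (start-nbr (supp cy a u (∧-fst {y a u} h))) e))
          (inj₁ e) → begin
            local a (faceChain q) y ≡⟨ go e (len a) ⟩
            (q a (start a) true ∧ pre (λ i → y a (seq a i)) (len a)) xor pre (λ i → y a (seq a i) ∧ q a (seq a i) true) (len a)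
              ≡⟨ cong₂ _xor_ (trans (cong (q a (start a) true ∧_) (trans (sym (ring-sum a (y a) (supp cy a))) ∂y)) (∧-zeroʳ _)) (sym (ring-sum a (λ u → y a u ∧ q a u true) λ u h → supp cy a u (∧-fst {y a u} h))) ⟩
            ⨁ (λ u → y a u ∧ q a u true) ∎
        where
        go : E a (start a) ≡ true → ∀ m → ord (λ i → faceChain q a (seq a i)) (λ i → y a (seq a i)) m ≡ (q a (start a) true ∧ pre (λ i → y a (seq a i)) m) xor pre (λ i → y a (seq a i) ∧ q a (seq a i) true) m
        go e zero = sym (trans (xor-identityʳ _) (∧-zeroʳ (q a (start a) true)))
        go e (suc m) = trans (cong₂ (λ s t → s xor (t ∧ y a (seq a m))) (go e m) (pre-faceChain a m e))
          (solve 5 (λ k p d l y → ((k :* p) :+ d) :+ ((k :+ l) :* y) := (k :* (p :+ y)) :+ (d :+ y :* l)) refl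
            (q a (start a) true) (pre (λ i → y a (seq a i)) m) (pre (λ i → y a (seq a i) ∧ q a (seq a i) true) m) (q a (seq a m) true) (y a (seq a m)))

    -- After `local-face`, an edge of `y` collects one corner label at each end. For an untwisted
    -- edge these lie on its two sides, for a twisted edge on the same side; this is precisely what
    -- `edgeTerm` compensates.
    B-face : ∀ y → IsChain y → (∀ a → ∂ y a ≡ false) → B (faceChain q) y ≡ false
    B-face y cy ∂y = begin
      B (faceChain q) y ≡⟨ cong (_xor edgeTerm (faceChain q) y) (⨁-cong λ a → local-face a y cy (∂y a)) ⟩
      ⨁ (λ a → ⨁ (λ u → y a u ∧ q a u true)) xor edgeTerm (faceChain q) y
        ≡⟨ cong (_xor edgeTerm (faceChain q) y) (trans (⨁⨁-unordered (λ a u → y a u ∧ q a u true) (λ a → cong (_∧ q a a true) (diag cy a))) (⨁-cong λ u → ⨁-cong λ v → edgewise u v)) ⟩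
      edgeTerm (faceChain q) y xor edgeTerm (faceChain q) y ≡⟨ xor-same (edgeTerm (faceChain q) y) ⟩
      false ∎
      where
      sides : ∀ u v → E u v ≡ true → q u v true xor q v u true ≡ not (sig u v) ∧ (q u v true xor q u v false)
      sides u v e with sig u v | reversed u v true e | reversed u v false e
      ... | true | r | _ = trans (cong (q u v true xor_) (sym r)) (xor-same (q u v true))
      ... | false | _ | r = cong (q u v true xor_) (sym r)
      edgewise : ∀ u v → lt u v ∧ ((y u v ∧ q u v true) xor (y v u ∧ q v u true)) ≡ (lt u v ∧ not (sig u v)) ∧ (faceChain q u v ∧ y u v)
      edgewise u v = begin
        lt u v ∧ ((y u v ∧ q u v true) xor (y v u ∧ q v u true)) ≡⟨ cong (λ t → lt u v ∧ ((y u v ∧ q u v true) xor (t ∧ q v u true))) (symm cy v u) ⟩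
        lt u v ∧ ((y u v ∧ q u v true) xor (y u v ∧ q v u true)) ≡⟨ cong (lt u v ∧_) (sym (∧-distribˡ-xor (y u v) _ _)) ⟩
        lt u v ∧ (y u v ∧ (q u v true xor q v u true))
          ≡⟨ cong (lt u v ∧_) (∧-congʳ-if {y u v} λ h → trans (sides u v (supp cy u v h)) (cong (not (sig u v) ∧_) (cong (_∧ (q u v true xor q u v false)) (sym (supp cy u v h))))) ⟩
        lt u v ∧ (y u v ∧ (not (sig u v) ∧ faceChain q u v))
          ≡⟨ solve 4 (λ l y s f → l :* (y :* (s :* f)) := (l :* s) :* (f :* y)) refl (lt u v) (y u v) (not (sig u v)) (faceChain q u v) ⟩
        (lt u v ∧ not (sig u v)) ∧ (faceChain q u v ∧ y u v) ∎

    module _ (zero-chain : ∀ u v → faceChain q u v ≡ false) where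
      private
        across : ∀ a u → E a u ≡ true → q a u true ≡ q a u false
        across a u e = xor≡false⇒≡ (trans (cong (_∧ (q a u true xor q a u false)) (sym e)) (zero-chain a u))

        either : ∀ a u s → E a u ≡ true → q a u s ≡ q a u true
        either a u true e = refl
        either a u false e = sym (across a u e)

        along-ring : ∀ a u i → E a u ≡ true → E a (iter (ρ a) i u) ≡ true × q a u true ≡ q a (iter (ρ a) i u) true
        along-ring a u zero e = e , refl
        along-ring a u (suc i) e = let (e′ , h) = along-ring a u i e in
          ρ-closed a _ e′ , trans h (trans (across a _ e′) (corner a _ e′))

        at-vertex : ∀ a u w → E a u ≡ true → E a w ≡ true → q a u true ≡ q a w true
        at-vertex a u w eu ew = let (i , h) = cyclic a u w eu ew in trans (proj₂ (along-ring a u i eu)) (cong (λ t → q a t true) h)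

      -- If no edge separates different labels, they agree across edges, around vertices and
      -- therefore along paths. So the face boundaries satisfy only one relation per component with
      -- an edge.
      label-constant : ∀ {a b} → Path E a b → ∀ u w s → E a u ≡ true → E b w ≡ true → q a u s ≡ q b w true
      label-constant {a} ε u w s eu ew = trans (either a u s eu) (at-vertex a u w eu ew)
      label-constant {a} {b} (_◅_ {j = c} e p) u w s eu ew = begin
        q a u s ≡⟨ trans (either a u s eu) (at-vertex a u c eu e) ⟩
        q a c true ≡⟨ reversed a c true e ⟩
        q c a (not (true xor sig a c)) ≡⟨ label-constant p a w _ (trans (E-sym c a) e) ew ⟩
        q b w true ∎

-- Faces as classes of face-tracing states

all-upTo : ∀ (p : ℕ → Bool) m → all p (upTo m) ≡ true → ∀ i → i < m → p i ≡ true
all-upTo p m h i i<m = go id m h i i<m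
  where
  go : ∀ (g : ℕ → ℕ) m → all p (applyUpTo g m) ≡ true → ∀ i → i < m → p (g i) ≡ true
  go g (suc m) h zero _ = ∧-fst h
  go g (suc m) h (suc i) (s≤s i<m) = go (g ∘ suc) m (∧-snd {p (g 0)} h) i i<m

module Faces {n : ℕ} {A : Adj n} {X : Mask n} (R : RotSystem A X)
    (E-sym : ∀ u v → adjM A X u v ≡ adjM A X v u) (E-irrefl : ∀ u → adjM A X u u ≡ false) where
  open Form R E-sym E-irrefl

  flip : State n → State n
  flip (u , v , s) = v , u , not (s xor sig u v)

  Valid : State n → Set
  Valid (u , v , s) = E u v ≡ true

  trace-valid : ∀ x → Valid x → Valid (trace R x)
  trace-valid (u , v , s) e with s xor sig u v
  ... | true = ρ-closed v u (trans (E-sym v u) e)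
  ... | false = ρ'-closed v u (trans (E-sym v u) e)

  flip-valid : ∀ x → Valid x → Valid (flip x)
  flip-valid (u , v , s) e = trans (E-sym v u) e

  flip-flip : ∀ x → flip (flip x) ≡ x
  flip-flip (u , v , s) = cong (λ t → u , v , t) (trans (cong (λ t → not (not (s xor sig u v) xor t)) (sig-sym v u)) (go s (sig u v)))
    where
    go : ∀ s t → not (not (s xor t) xor t) ≡ s
    go true true = refl
    go true false = refl
    go false true = refl
    go false false = refl

  private
    toggle-back : ∀ b {t t′} → t ≡ t′ → not (b xor t) xor t′ ≡ not b
    toggle-back true {true} refl = refl
    toggle-back true {false} refl = refl
    toggle-back false {true} refl = refl
    toggle-back false {false} refl = refl

  -- Reversal conjugates `trace` to its inverse. This makes `trace` injective on valid states and
  -- turns orbits into orbits under `flip`.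
  trace-flip-trace : ∀ x → Valid x → trace R (flip (trace R x)) ≡ flip x
  trace-flip-trace (u , v , s) e with s xor sig u v
  ... | true = trans (cong (λ t → v , (if t then ρ v (ρ v u) else ρ' v (ρ v u)) , t) (toggle-back true (sig-sym v (ρ v u))))
                     (cong (λ t → v , t , false) (ρ'ρ v u (trans (E-sym v u) e)))
  ... | false = trans (cong (λ t → v , (if t then ρ v (ρ' v u) else ρ' v (ρ' v u)) , t) (toggle-back false (sig-sym v (ρ' v u))))
                      (cong (λ t → v , t , true) (ρρ' v u (trans (E-sym v u) e)))

  M : ℕ
  M = n * (n * 2)

  enc : State n → Fin M
  enc (u , v , s) = combine u (combine v (toBit s))

  private
    assemble : Fin n → Fin n × Fin 2 → State n
    assemble u (v , b) = u , v , fromBit b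

  dec : Fin M → State n
  dec i = let (u , r) = remQuot {n} (n * 2) i in assemble u (remQuot 2 r)

  dec-enc : ∀ x → dec (enc x) ≡ x
  dec-enc (u , v , s) = trans (cong (λ { (u , r) → assemble u (remQuot 2 r) }) (Fin.remQuot-combine u (combine v (toBit s))))
    (trans (cong (assemble u) (Fin.remQuot-combine v (toBit s))) (cong (λ t → u , v , t) (fromBit-toBit s)))

  enc-dec : ∀ i → enc (dec i) ≡ i
  enc-dec i = trans (cong (combine (proj₁ (remQuot {n} (n * 2) i))) (inner (proj₂ (remQuot {n} (n * 2) i)))) (Fin.combine-remQuot {n} (n * 2) i)
    where
    toBit-fromBit : ∀ b → toBit (fromBit b) ≡ b
    toBit-fromBit zero = refl
    toBit-fromBit (suc zero) = refl
    inner : ∀ r → combine (proj₁ (remQuot {n} 2 r)) (toBit (fromBit (proj₂ (remQuot {n} 2 r)))) ≡ r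
    inner r = trans (cong (combine (proj₁ (remQuot {n} 2 r))) (toBit-fromBit _)) (Fin.combine-remQuot {n} 2 r)

  code≡ : ∀ x → code R x ≡ toℕ (enc x)
  code≡ (u , v , s) = sym (begin
    toℕ (combine u (combine v (toBit s))) ≡⟨ Fin.toℕ-combine u (combine v (toBit s)) ⟩
    (n * 2) * toℕ u + toℕ (combine v (toBit s)) ≡⟨ cong ((n * 2) * toℕ u +_) (Fin.toℕ-combine v (toBit s)) ⟩
    (n * 2) * toℕ u + (2 * toℕ v + toℕ (toBit s))
      ≡⟨ cong₂ _+_ (trans (ℕ.*-comm (n * 2) (toℕ u)) (cong (toℕ u *_) (ℕ.*-comm n 2))) (cong₂ _+_ (ℕ.*-comm 2 (toℕ v)) (bit s)) ⟩
    toℕ u * (2 * n) + (toℕ v * 2 + (if s then 1 else 0)) ≡⟨ sym (ℕ.+-assoc (toℕ u * (2 * n)) (toℕ v * 2) _) ⟩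
    code R (u , v , s) ∎)
    where
    bit : ∀ s → toℕ (toBit s) ≡ (if s then 1 else 0)
    bit true = refl
    bit false = refl

  code-injective : ∀ {x y} → code R x ≡ code R y → x ≡ y
  code-injective {x} {y} e = trans (sym (dec-enc x)) (trans (cong dec (Fin.toℕ-injective (trans (sym (code≡ x)) (trans e (code≡ y))))) (dec-enc y))

  iter-valid : ∀ i x → Valid x → Valid (iter (trace R) i x)
  iter-valid zero x v = v
  iter-valid (suc i) x v = trace-valid (iter (trace R) i x) (iter-valid i x v)

  Orbit : State n → State n → Set
  Orbit x y = ∃ λ i → iter (trace R) i x ≡ y

  orbit-trans : ∀ {x y z} → Orbit x y → Orbit y z → Orbit x z
  orbit-trans {x} (i , refl) (j , refl) = j + i , iter-+ (trace R) j i x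

  private
    untrace : State n → State n
    untrace x = flip (trace R (flip x))

    untrace-trace : ∀ x → Valid x → untrace (trace R x) ≡ x
    untrace-trace x v = trans (cong flip (trace-flip-trace x v)) (flip-flip x)

    cancel : ∀ i j x → Valid x → iter (trace R) i x ≡ iter (trace R) (i + j) x → x ≡ iter (trace R) j x
    cancel zero j x v h = h
    cancel (suc i) j x v h = cancel i j x v (trans (sym (untrace-trace _ (iter-valid i x v))) (trans (cong untrace h) (untrace-trace _ (iter-valid (i + j) x v))))

    repeats : ∀ x → ∃ λ i → ∃ λ j → i < j × j ≤ M × iter (trace R) i x ≡ iter (trace R) j x
    repeats x with Fin.pigeonhole (ℕ.n<1+n M) (λ k → enc (iter (trace R) (toℕ k) x))
    ... | i , j , i<j , e = toℕ i , toℕ j , i<j , s≤s⁻¹ (Fin.toℕ<n j) , trans (sym (dec-enc _)) (trans (cong dec e) (dec-enc _))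

    trace-back : ∀ x → Valid x → Orbit (trace R x) x
    trace-back x v with repeats x
    ... | i , j , i<j , _ , e with j ∸ i in eq
    ...   | zero = ⊥-elim (ℕ.<-irrefl refl (ℕ.≤-trans i<j (ℕ.m∸n≡0⇒m≤n eq)))
    ...   | suc d = d , trans (iter-suc (trace R) d x) (sym (cancel i (suc d) x v (trans e (cong (λ k → iter (trace R) k x) (trans (sym (ℕ.m+[n∸m]≡n (ℕ.<⇒≤ i<j))) (cong (i +_) eq))))))

  orbit-sym : ∀ {x y} → Valid x → Orbit x y → Orbit y x
  orbit-sym {x} v (zero , refl) = 0 , refl
  orbit-sym {x} v (suc i , refl) = orbit-trans (trace-back (iter (trace R) i x) (iter-valid i x v)) (orbit-sym v (i , refl))

  orbit-flip : ∀ {x y} → Valid x → Orbit x y → Orbit (flip x) (flip y)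
  orbit-flip {x} v (i , e) = orbit-sym (subst (λ t → Valid (flip t)) e (flip-valid (iter (trace R) i x) (iter-valid i x v))) (go i e)
    where
    go : ∀ i {y} → iter (trace R) i x ≡ y → Orbit (flip y) (flip x)
    go zero refl = 0 , refl
    go (suc i) refl = orbit-trans (1 , trace-flip-trace (iter (trace R) i x) (iter-valid i x v)) (go i refl)

  private
    -- `isRep` inspects the iterates up to `M` only, so the whole orbit has to appear among them.
    bounded : ∀ x i → ∃ λ j → j ≤ M × iter (trace R) j x ≡ iter (trace R) i x
    bounded x i with repeats x
    ... | a , b , a<b , b≤M , e = go i
      where
      go : ∀ i → ∃ λ j → j ≤ M × iter (trace R) j x ≡ iter (trace R) i x
      go zero = 0 , z≤n , refl
      go (suc i) with go i
      ... | j , j≤M , h with j ℕ.<? M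
      ...   | yes j<M = suc j , j<M , cong (trace R) h
      -- At j = M the repetition at a < b shortens M = b + (M ∸ b) to a + (M ∸ b), which leaves room
      -- for the next step.
      ...   | no j≮M = suc (a + (M ∸ b)) , ℕ.≤-trans (ℕ.+-monoˡ-< (M ∸ b) a<b) (ℕ.≤-reflexive (ℕ.m+[n∸m]≡n b≤M)) , cong (trace R) (begin
          iter (trace R) (a + (M ∸ b)) x ≡⟨ cong (λ k → iter (trace R) k x) (ℕ.+-comm a (M ∸ b)) ⟩
          iter (trace R) ((M ∸ b) + a) x ≡⟨ iter-+ (trace R) (M ∸ b) a x ⟩
          iter (trace R) (M ∸ b) (iter (trace R) a x) ≡⟨ cong (iter (trace R) (M ∸ b)) e ⟩
          iter (trace R) (M ∸ b) (iter (trace R) b x) ≡⟨ sym (iter-+ (trace R) (M ∸ b) b x) ⟩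
          iter (trace R) ((M ∸ b) + b) x ≡⟨ cong (λ k → iter (trace R) k x) (trans (ℕ.m∸n+n≡m b≤M) (ℕ.≤-antisym (ℕ.≮⇒≥ j≮M) j≤M)) ⟩
          iter (trace R) j x ≡⟨ h ⟩
          iter (trace R) i x ∎)

  M≡ : M ≡ 2 * n * n
  M≡ = trans (cong (n *_) (ℕ.*-comm n 2)) (ℕ.*-comm n (2 * n))

  isRep⁻ : ∀ {x y} → isRep R x ≡ true → Orbit x y → code R x ≤ code R y
  isRep⁻ {x} h (i , refl) = let (j , j≤M , e) = bounded x i in
    subst (λ t → code R x ≤ code R t) e (ℕ.≤ᵇ⇒≤ _ _ (subst T (sym (all-upTo _ _ h j (s≤s (ℕ.≤-trans j≤M (ℕ.≤-reflexive M≡))))) _))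

  isRep-unique : ∀ {x y} → Valid x → isRep R x ≡ true → isRep R y ≡ true → Orbit x y → x ≡ y
  isRep-unique v rx ry o = code-injective (ℕ.≤-antisym (isRep⁻ rx o) (isRep⁻ ry (orbit-sym v o)))

  validᵇ : Fin M → Bool
  validᵇ i = E (proj₁ (dec i)) (proj₁ (proj₂ (dec i)))

  private
    -- Faces are the components of this graph on codes of states, so that `rep` supplies a canonical
    -- representative of each.
    S : Adj M
    S i j = (validᵇ i ∧ validᵇ j) ∧ (((j == enc (trace R (dec i))) ∨ (i == enc (trace R (dec j)))) ∨ ((j == enc (flip (dec i))) ∨ (i == enc (flip (dec j)))))

    S-sym : ∀ i j → S i j ≡ S j i
    S-sym i j = cong₂ _∧_ (∧-comm (validᵇ i) (validᵇ j)) (cong₂ _∨_ (∨-comm (j == enc (trace R (dec i))) _) (∨-comm (j == enc (flip (dec i))) _))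

  open Components S S-sym using () renaming (rep to class; rep-cong to class-cong; rep⇒reach to class⇒reach; rep-idem to class-idem; rep-reach to class-reach) public

  private
    S-trace : ∀ x → Valid x → class (enc x) ≡ class (enc (trace R x))
    S-trace x v = class-cong (reach-edge S (∧-true (∧-true (subst Valid (sym (dec-enc x)) v) (subst Valid (sym (dec-enc (trace R x))) (trace-valid x v)))
      (∨-injˡ (∨-injˡ (≡⇒== (cong (enc ∘ trace R) (sym (dec-enc x))))))))

    S-flip : ∀ x → Valid x → class (enc x) ≡ class (enc (flip x))
    S-flip x v = class-cong (reach-edge S (∧-true (∧-true (subst Valid (sym (dec-enc x)) v) (subst Valid (sym (dec-enc (flip x))) (flip-valid x v)))
      (∨-injʳ {(enc (flip x) == enc (trace R (dec (enc x)))) ∨ (enc x == enc (trace R (dec (enc (flip x)))))} (∨-injˡ (≡⇒== (cong (enc ∘ flip) (sym (dec-enc x))))))))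

  labelling : (Fin M → Bool) → Labelling
  labelling c u v s = c (class (enc (u , v , s)))

  labelling-isFace : ∀ c → IsFaceLabelling (labelling c)
  labelling-isFace c = record
    { along = λ u v s e → cong c (S-trace (u , v , s) e)
    ; reversed = λ u v s e → cong c (S-flip (u , v , s) e) }

  private
    enc-== : ∀ i x → (i == enc x) ≡ true → dec i ≡ x
    enc-== i x h = trans (cong dec (==⇒≡ i (enc x) h)) (dec-enc x)

    reachable : ∀ {x i j} → Valid x → Orbit x (dec i) ⊎ Orbit (flip x) (dec i) → Path S i j → Orbit x (dec j) ⊎ Orbit (flip x) (dec j)
    reachable v o ε = o
    reachable {x} {i} v o (_◅_ {j = j} e p) = reachable v (step o) p
      where
      Vj : Valid (dec j)
      Vj = ∧-snd {validᵇ i} (∧-fst {validᵇ i ∧ validᵇ j} e)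
      move : Orbit (dec i) (dec j) ⊎ flip (dec i) ≡ dec j
      move with ∨-case {(j == enc (trace R (dec i))) ∨ (i == enc (trace R (dec j)))} (∧-snd {validᵇ i ∧ validᵇ j} e)
      ... | inj₁ h with ∨-case {j == enc (trace R (dec i))} h
      ...   | inj₁ q = inj₁ (1 , sym (enc-== j _ q))
      ...   | inj₂ q = inj₁ (orbit-sym Vj (1 , sym (enc-== i _ q)))
      move | inj₂ h with ∨-case {j == enc (flip (dec i))} h
      ...   | inj₁ q = inj₂ (sym (enc-== j _ q))
      ...   | inj₂ q = inj₂ (trans (cong flip (enc-== i _ q)) (flip-flip (dec j)))
      step : Orbit x (dec i) ⊎ Orbit (flip x) (dec i) → Orbit x (dec j) ⊎ Orbit (flip x) (dec j)
      step o with move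
      step (inj₁ o) | inj₁ m = inj₁ (orbit-trans o m)
      step (inj₂ o) | inj₁ m = inj₂ (orbit-trans o m)
      step (inj₁ o) | inj₂ m = inj₂ (subst (Orbit (flip x)) m (orbit-flip v o))
      step (inj₂ o) | inj₂ m = inj₁ (subst (λ t → Orbit t (dec j)) (flip-flip x) (subst (Orbit (flip (flip x))) m (orbit-flip (flip-valid x v) o)))

  isFace : Fin M → Bool
  isFace i = validᵇ i ∧ (class i == i)

  isOrbitRep : Fin M → Bool
  isOrbitRep i = validᵇ i ∧ isRep R (dec i)

  private
    class-valid : ∀ i → validᵇ i ≡ true → validᵇ (class i) ≡ true
    class-valid i v = go (reach⇒Path S (class-reach i)) v
      where
      go : ∀ {i j} → Path S i j → validᵇ i ≡ true → validᵇ j ≡ true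
      go ε v = v
      go {i} (_◅_ {j = j} e p) _ = go p (∧-snd {validᵇ i} (∧-fst {validᵇ i ∧ validᵇ j} e))

    class-orbit : ∀ i → validᵇ i ≡ true → Orbit (dec (class i)) (dec i) ⊎ Orbit (flip (dec (class i))) (dec i)
    class-orbit i v = reachable (class-valid i v) (inj₁ (0 , refl)) (reach⇒Path S (class⇒reach {class i} {i} (class-idem i)))

    dec-injective : ∀ i j → dec i ≡ dec j → i ≡ j
    dec-injective i j e = trans (sym (enc-dec i)) (trans (cong enc e) (enc-dec j))

    sideOf : {P Q : Set} → P ⊎ Q → Bool
    sideOf (inj₁ _) = true
    sideOf (inj₂ _) = false

    -- The orbit of a state contains the representative of its face or the reversal of it. Recording
    -- which one splits the orbit representatives into two parts, each of which injects into the
    -- faces.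
    side : ∀ i → validᵇ i ≡ true → Bool
    side i v = sideOf (class-orbit i v)

    common : ∀ {x y z} → Valid x → (o : Orbit x y ⊎ Orbit (flip x) y) (o′ : Orbit x z ⊎ Orbit (flip x) z) → sideOf o ≡ sideOf o′ →
      ∃ λ w → Valid w × Orbit w y × Orbit w z
    common {x} v (inj₁ o) (inj₁ o′) _ = x , v , o , o′
    common {x} v (inj₂ o) (inj₂ o′) _ = flip x , flip-valid x v , o , o′

    sideOf-subst : ∀ {k k′} j (e : k ≡ k′) (o : Orbit (dec k) (dec j) ⊎ Orbit (flip (dec k)) (dec j)) →
      sideOf (subst (λ k → Orbit (dec k) (dec j) ⊎ Orbit (flip (dec k)) (dec j)) e o) ≡ sideOf o
    sideOf-subst j refl o = refl

    same-side : ∀ i j vi vj → class i ≡ class j → side i vi ≡ side j vj → ∃ λ x → Valid x × Orbit x (dec i) × Orbit x (dec j)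
    same-side i j vi vj e h = common {dec (class i)} {dec i} {dec j} (class-valid i vi) (class-orbit i vi)
      (subst (λ k → Orbit (dec k) (dec j) ⊎ Orbit (flip (dec k)) (dec j)) (sym e) (class-orbit j vj))
      (trans h (sym (sideOf-subst j (sym e) (class-orbit j vj))))

    sidedAt : ∀ i → validᵇ i ≡ true ⊎ validᵇ i ≡ false → Bool → Bool
    sidedAt i (inj₁ v) b = not (side i v xor b)
    sidedAt i (inj₂ _) b = false

    sided : Fin M → Bool → Bool
    sided i = sidedAt i (true-or-false (validᵇ i))

    sided-covers : ∀ i → validᵇ i ≡ true → sided i true ∨ sided i false ≡ true
    sided-covers i v = go (true-or-false (validᵇ i))
      where
      two : ∀ b → not (b xor true) ∨ not (b xor false) ≡ true
      two true = refl
      two false = refl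
      go : ∀ d → sidedAt i d true ∨ sidedAt i d false ≡ true
      go (inj₁ v′) = two (side i v′)
      go (inj₂ q) = ⊥-elim (true≢false v q)

    sided⁻ : ∀ i b → sided i b ≡ true → Σ (validᵇ i ≡ true) λ v → side i v ≡ b
    sided⁻ i b = go (true-or-false (validᵇ i))
      where
      go : ∀ d → sidedAt i d b ≡ true → Σ (validᵇ i ≡ true) λ v → side i v ≡ b
      go (inj₁ v) h = v , xor≡false⇒≡ (not-true h)

    -- States of one face on one side share an orbit, and an orbit has only one state of least code.
    sided-bound : ∀ b → cnt (λ i → isOrbitRep i ∧ sided i b) ≤ cnt isFace
    sided-bound b = cnt-≤ _ isFace (λ i _ → class i)
      (λ i h → ∧-true (class-valid i (∧-fst {validᵇ i} (∧-fst {isOrbitRep i} h))) (≡⇒== (class-idem i)))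
      λ i hi j hj e →
        let (vi , si) = sided⁻ i b (∧-snd {isOrbitRep i} hi)
            (vj , sj) = sided⁻ j b (∧-snd {isOrbitRep j} hj)
            (x , v , oi , oj) = same-side i j vi vj e (trans si (sym sj))
        in dec-injective i j (isRep-unique {dec i} {dec j} vi (∧-snd {validᵇ i} (∧-fst {isOrbitRep i} hi)) (∧-snd {validᵇ j} (∧-fst {isOrbitRep j} hj)) (orbit-trans {dec i} {x} {dec j} (orbit-sym {x} {dec i} v oi) oj))

  numOrbits≡ : numOrbits R ≡ cnt isOrbitRep
  numOrbits≡ = begin
    numOrbits R ≡⟨ trans (sumF≡∑ n _) (∑-cong λ u → sumF≡∑ n _) ⟩
    ∑ (λ u → ∑ (λ v → (if E u v ∧ isRep R (u , v , true) then 1 else 0) + (if E u v ∧ isRep R (u , v , false) then 1 else 0)))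
      ≡⟨ ∑-cong (λ u → ∑-cong λ v → trans (cong₂ _+_ (if≡ (E u v ∧ isRep R (u , v , true))) (if≡ (E u v ∧ isRep R (u , v , false)))) (trans (ℕ.+-comm ⟦ E u v ∧ isRep R (u , v , true) ⟧ _)
           (sym (trans (∑-suc _) (cong₂ _+_ (at u v false) (trans (∑-suc _) (trans (cong₂ _+_ (at u v true) (∑-zero _)) (ℕ.+-identityʳ _)))))))) ⟩
    ∑ (λ u → ∑ (λ v → ∑ (λ b → ⟦ isOrbitRep (combine u (combine v b)) ⟧))) ≡⟨ ∑-cong (λ u → sym (∑-combine n _)) ⟩
    ∑ (λ u → ∑ (λ r → ⟦ isOrbitRep (combine u r) ⟧)) ≡⟨ sym (∑-combine n _) ⟩
    cnt isOrbitRep ∎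
    where
    if≡ : ∀ b → (if b then 1 else 0) ≡ ⟦ b ⟧
    if≡ true = refl
    if≡ false = refl
    at : ∀ u v s → ⟦ isOrbitRep (combine u (combine v (toBit s))) ⟧ ≡ ⟦ E u v ∧ isRep R (u , v , s) ⟧
    at u v s = cong (λ x → ⟦ E (proj₁ x) (proj₁ (proj₂ x)) ∧ isRep R x ⟧) (dec-enc (u , v , s))

  numOrbits≤ : numOrbits R ≤ cnt isFace + cnt isFace
  numOrbits≤ = ℕ.≤-trans (ℕ.≤-reflexive numOrbits≡)
    (ℕ.≤-trans (cnt-mono {q = λ i → (isOrbitRep i ∧ sided i true) ∨ (isOrbitRep i ∧ sided i false)} λ i h →
        trans (sym (∧-distribˡ-∨ (isOrbitRep i) (sided i true) (sided i false))) (∧-true h (sided-covers i (∧-fst {validᵇ i} h))))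
      (ℕ.≤-trans (cnt-∨ _ _) (ℕ.+-mono-≤ (sided-bound true) (sided-bound false))))

-- Rank and Euler genus

firstOr-min : ∀ {n} (d : Fin n) (p : Fin n → Bool) {i} → p i ≡ true → toℕ (firstOr d p id) ≤ toℕ i
firstOr-min {n} d p {i} pi = go {n} p id (λ _ → refl) pi
  where
  go : ∀ {m k} (p : Fin m → Bool) (g : Fin m → Fin n) → (∀ i → toℕ (g i) ≡ k + toℕ i) → ∀ {i} → p i ≡ true → toℕ (firstOr d p g) ≤ k + toℕ i
  go {suc m} {k} p g h {i} pi with p zero in eq
  ... | true = ℕ.≤-trans (ℕ.≤-reflexive (trans (h zero) (ℕ.+-identityʳ k))) (ℕ.m≤m+n k (toℕ i))
  go {suc m} {k} p g h {zero} pi | false = ⊥-elim (true≢false pi eq)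
  go {suc m} {k} p g h {suc i} pi | false = ℕ.≤-trans (go {m} {suc k} (p ∘ suc) (g ∘ suc) (λ i → trans (h (suc i)) (ℕ.+-suc k (toℕ i))) pi) (ℕ.≤-reflexive (sym (ℕ.+-suc k (toℕ i))))

T⇒≡ : ∀ {b} → T b → b ≡ true
T⇒≡ {true} _ = refl

module GenusBound {n : ℕ} {A : Adj n} {X : Mask n} (R : RotSystem A X)
    (E-sym : ∀ u v → adjM A X u v ≡ adjM A X v u) (E-irrefl : ∀ u → adjM A X u u ≡ false) where
  open Form R E-sym E-irrefl
  open Faces R E-sym E-irrefl
  open Components E E-sym

  private
    isRoot : Mask n
    isRoot v = X v ∧ allF n (λ u → not (X u ∧ reach E u v) ∨ (toℕ v ≤ᵇ toℕ u))

    hasNbr : Mask n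
    hasNbr v = anyF n (E v)

    E⇒Xˡ : ∀ {u v} → E u v ≡ true → X u ≡ true
    E⇒Xˡ {u} e = ∧-fst {X u} e

    E⇒Xʳ : ∀ {u v} → E u v ≡ true → X v ≡ true
    E⇒Xʳ {u} {v} e = ∧-fst {X v} (∧-snd {X u} e)

    path-X : ∀ {u v} → Path E u v → X u ≡ true → X v ≡ true
    path-X ε h = h
    path-X (e ◅ p) _ = path-X p (E⇒Xʳ e)

    rep-root : ∀ u → X u ≡ true → isRoot (rep u) ≡ true
    rep-root u Xu = ∧-true (path-X (reach⇒Path E (rep-reach u)) Xu) (allF⁺ _ λ w → case true-or-false (X w ∧ reach E w (rep u)) of λ where
      (inj₂ h) → ∨-injˡ (cong not h)
      (inj₁ h) → ∨-injʳ {not (X w ∧ reach E w (rep u))} (T⇒≡ (ℕ.≤⇒≤ᵇ (firstOr-min u (reach E u) (reach-trans E (rep-reach u) (reach-sym (∧-snd {X w} h)))))))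

    rep-start : ∀ u v → E u v ≡ true → E (rep u) (start (rep u)) ≡ true
    rep-start u v e = go (reach⇒Path E (reach-sym (rep-reach u)))
      where
      go : ∀ {r} → Path E r u → E r (start r) ≡ true
      go ε = start-nbr e
      go (e′ ◅ _) = start-nbr e′

    Coord : Set
    Coord = (Fin n × Fin n) ⊎ (Fin n ⊎ Fin n)

    dim : ℕ
    dim = n * n + (n + n)

    coord : Fin dim → Coord
    coord j = [ (λ p → inj₁ (remQuot n p)) , (λ k → inj₂ (splitAt n k)) ]′ (splitAt (n * n) j)

    pairC : Fin n → Fin n → Fin dim
    pairC u v = combine u v ↑ˡ (n + n)

    faceC vertexC : Fin n → Fin dim
    faceC w = (n * n) ↑ʳ (w ↑ˡ n)
    vertexC w = (n * n) ↑ʳ (n ↑ʳ w)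

    coord-pair : ∀ u v → coord (pairC u v) ≡ inj₁ (u , v)
    coord-pair u v = trans (cong [ _ , _ ]′ (Fin.splitAt-↑ˡ (n * n) (combine u v) (n + n))) (cong inj₁ (Fin.remQuot-combine u v))

    coord-face : ∀ w → coord (faceC w) ≡ inj₂ (inj₁ w)
    coord-face w = trans (cong [ _ , _ ]′ (Fin.splitAt-↑ʳ (n * n) (n + n) (w ↑ˡ n))) (cong inj₂ (Fin.splitAt-↑ˡ n w n))

    coord-vertex : ∀ w → coord (vertexC w) ≡ inj₂ (inj₂ w)
    coord-vertex w = trans (cong [ _ , _ ]′ (Fin.splitAt-↑ʳ (n * n) (n + n) (n ↑ʳ w))) (cong inj₂ (Fin.splitAt-↑ʳ n n w))

    coord-⨁ : ∀ (f : Coord → Bool) → ⨁ (λ j → f (coord j)) ≡ ⨁ (λ u → ⨁ (λ v → f (inj₁ (u , v)))) xor (⨁ (λ w → f (inj₂ (inj₁ w))) xor ⨁ (λ w → f (inj₂ (inj₂ w))))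
    coord-⨁ f = trans (⨁-+ (n * n) _) (cong₂ _xor_
      (trans (⨁-* n _) (⨁-cong λ u → ⨁-cong λ v → cong f (coord-pair u v)))
      (trans (⨁-+ n _) (cong₂ _xor_ (⨁-cong λ w → cong f (coord-face w)) (⨁-cong λ w → cong f (coord-vertex w)))))

    coord-∑ : ∀ (f : Coord → ℕ) → ∑ (λ j → f (coord j)) ≡ ∑ (λ u → ∑ (λ v → f (inj₁ (u , v)))) + (∑ (λ w → f (inj₂ (inj₁ w))) + ∑ (λ w → f (inj₂ (inj₂ w))))
    coord-∑ f = trans (∑-split (n * n) _) (cong₂ _+_
      (trans (∑-combine n _) (∑-cong λ u → ∑-cong λ v → cong f (coord-pair u v)))
      (trans (∑-split n _) (cong₂ _+_ (∑-cong λ w → cong f (coord-face w)) (∑-cong λ w → cong f (coord-vertex w)))))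

    -- Coordinates: the edges, and one more per component for each of the two families,
    -- which pins down the constant solutions.
    maskL : Coord → Bool
    maskL (inj₁ (u , v)) = lt u v ∧ E u v
    maskL (inj₂ (inj₁ w)) = isRoot w ∧ hasNbr w
    maskL (inj₂ (inj₂ w)) = isRoot w

    β₀ : Fin n → Coord → Bool
    β₀ w (inj₁ (u , v)) = (w == u) xor (w == v)
    β₀ w (inj₂ (inj₁ _)) = false
    β₀ w (inj₂ (inj₂ w′)) = w == w′

    β : Fin n → Fin dim → Bool
    β w j = β₀ w (coord j)

    L : Mask dim
    L j = maskL (coord j)

    -- On the edges, the row of `w` is the star of `w`, so the pairing evaluates the boundary of `x`
    -- at `w`.
    chain-orth : ∀ x → IsChain x → ∀ w → ∂ x w ≡ false → ⨁ (λ u → ⨁ (λ v → (lt u v ∧ E u v) ∧ (x u v ∧ ((w == u) xor (w == v))))) ≡ false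
    chain-orth x cx w ∂x = begin
      ⨁ (λ u → ⨁ (λ v → (lt u v ∧ E u v) ∧ (x u v ∧ ((w == u) xor (w == v)))))
        ≡⟨ ⨁-cong (λ u → ⨁-cong λ v → edgewise u v) ⟩
      ⨁ (λ u → ⨁ (λ v → lt u v ∧ (((w == u) ∧ x u v) xor ((w == v) ∧ x v u))))
        ≡⟨ sym (⨁⨁-unordered (λ u v → (w == u) ∧ x u v) λ u → trans (cong ((w == u) ∧_) (diag cx u)) (∧-zeroʳ _)) ⟩
      ⨁ (λ u → ⨁ (λ v → (w == u) ∧ x u v)) ≡⟨ trans (⨁-cong λ u → sym (⨁-∧ˡ (w == u) (x u))) (⨁-δ′ w _) ⟩
      ∂ x w ≡⟨ ∂x ⟩
      false ∎
      where
      edgewise : ∀ u v → (lt u v ∧ E u v) ∧ (x u v ∧ ((w == u) xor (w == v))) ≡ lt u v ∧ (((w == u) ∧ x u v) xor ((w == v) ∧ x v u))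
      edgewise u v = trans (trans (∧-assoc (lt u v) (E u v) _) (cong (lt u v ∧_) (trans (absorb (E u v) (x u v) (supp cx u v))
          (trans (∧-comm (x u v) _) (∧-distribʳ-xor (x u v) (w == u) (w == v))))))
        (cong (λ t → lt u v ∧ (((w == u) ∧ x u v) xor ((w == v) ∧ t))) (symm cx u v))
        where
        absorb : ∀ a b {c} → (b ≡ true → a ≡ true) → a ∧ (b ∧ c) ≡ b ∧ c
        absorb a true h rewrite h refl = refl
        absorb a false h = ∧-zeroʳ a

    -- A sum of stars that contains no edge has coefficients constant on components, and the extra
    -- coordinate at the root forces the constant to be `false`.
    β-independent : Independent X L β
    β-independent c sup h u = ¬true⇒false λ cu → true≢false (trans (sym (path-constant (reach⇒Path E (rep-reach u)))) cu)
        (trans (sym (trans (⨁-cong λ w → trans (cong (λ k → c w ∧ β₀ w k) (coord-vertex (rep u))) (∧-comm (c w) _)) (⨁-δ (rep u) c)))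
          (h (vertexC (rep u)) (trans (cong maskL (coord-vertex (rep u))) (rep-root u (sup u cu)))))
      where
      pair-value : ∀ u v → comb c β (pairC u v) ≡ c u xor c v
      pair-value u v = trans (⨁-cong λ w → trans (cong (λ k → c w ∧ β₀ w k) (coord-pair u v))
          (solve 3 (λ a b d → a :* (b :+ d) := b :* a :+ d :* a) refl (c w) (w == u) (w == v)))
        (trans (⨁-xor _ _) (cong₂ _xor_ (⨁-δ u c) (⨁-δ v c)))
      edge : ∀ u v → E u v ≡ true → lt u v ≡ true → c u ≡ c v
      edge u v e l = xor≡false⇒≡ (trans (sym (pair-value u v)) (h (pairC u v) (trans (cong maskL (coord-pair u v)) (∧-true l e))))
      edge′ : ∀ u v → E u v ≡ true → c u ≡ c v
      edge′ u v e with order u v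
      ... | below l _ = edge u v e l
      ... | equal refl _ = refl
      ... | above _ l = sym (edge v u (trans (E-sym v u) e) l)
      path-constant : ∀ {u v} → Path E u v → c u ≡ c v
      path-constant ε = refl
      path-constant (e ◅ p) = trans (edge′ _ _ e) (path-constant p)

  module _ {r : ℕ} (good : Mask r) (C C′ : Fin r → Chain)
      (C-chain : ∀ i → good i ≡ true → IsChain (C i)) (∂C : ∀ i → good i ≡ true → ∀ a → ∂ (C i) a ≡ false)
      (C′-chain : ∀ i → good i ≡ true → IsChain (C′ i)) (∂C′ : ∀ i → good i ≡ true → ∀ a → ∂ (C′ i) a ≡ false)
      (dual : ∀ i j → good i ≡ true → good j ≡ true → B (C i) (C′ j) ≡ (i == j)) where
    private
      -- The face boundaries of one component sum to zero. The extra coordinate breaks this relation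
      -- by reading the label of one corner at the root.
      α₀ : Fin M ⊎ Fin r → Coord → Bool
      α₀ (inj₁ x) (inj₁ (u , v)) = faceChain (labelling (_== x)) u v
      α₀ (inj₁ x) (inj₂ (inj₁ w)) = labelling (_== x) w (start w) true
      α₀ (inj₁ x) (inj₂ (inj₂ w)) = false
      α₀ (inj₂ i) (inj₁ (u , v)) = C i u v
      α₀ (inj₂ i) (inj₂ _) = false

      maskF : Fin M ⊎ Fin r → Bool
      maskF (inj₁ x) = isFace x
      maskF (inj₂ i) = good i

      α : Fin (M + r) → Fin dim → Bool
      α i j = α₀ (splitAt M i) (coord j)

      F : Mask (M + r)
      F i = maskF (splitAt M i)

      cnt-F : cnt F ≡ cnt isFace + cnt good
      cnt-F = trans (∑-split M _) (cong₂ _+_ (∑-cong λ x → cong (⟦_⟧ ∘ maskF) (Fin.splitAt-↑ˡ M x r)) (∑-cong λ i → cong (⟦_⟧ ∘ maskF) (Fin.splitAt-↑ʳ M r i)))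

      orthogonal : Orthogonal F X L α β
      orthogonal i w Fi Xw = trans (coord-⨁ (λ k → maskL k ∧ (α₀ (splitAt M i) k ∧ β₀ w k))) (go (splitAt M i) Fi)
        where
        go : ∀ k → maskF k ≡ true → ⨁ (λ u → ⨁ (λ v → (lt u v ∧ E u v) ∧ (α₀ k (inj₁ (u , v)) ∧ ((w == u) xor (w == v)))))
          xor (⨁ (λ w′ → (isRoot w′ ∧ hasNbr w′) ∧ (α₀ k (inj₂ (inj₁ w′)) ∧ false)) xor ⨁ (λ w′ → isRoot w′ ∧ (α₀ k (inj₂ (inj₂ w′)) ∧ (w == w′)))) ≡ false
        go (inj₁ x) _ = cong₂ _xor_ (chain-orth _ (faceChain-isChain (labelling-isFace (_== x))) w (∂-faceChain (labelling-isFace (_== x)) w))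
          (cong₂ _xor_ (⨁-false λ w′ → trans (cong ((isRoot w′ ∧ hasNbr w′) ∧_) (∧-zeroʳ _)) (∧-zeroʳ _)) (⨁-false λ w′ → ∧-zeroʳ _))
        go (inj₂ j) g = cong₂ _xor_ (chain-orth _ (C-chain j g) w (∂C j g w))
          (cong₂ _xor_ (⨁-false λ w′ → ∧-zeroʳ _) (⨁-false λ w′ → ∧-zeroʳ _))

      module Independence (c : Fin (M + r) → Bool) (sup : ∀ i → c i ≡ true → F i ≡ true) (h : ∀ j → L j ≡ true → comb c α j ≡ false) where
        cF : Fin M → Bool
        cF x = c (x ↑ˡ r)

        cP : Fin r → Bool
        cP i = c (M ↑ʳ i)

        comb-split : ∀ j → comb c α j ≡ ⨁ (λ x → cF x ∧ α₀ (inj₁ x) (coord j)) xor ⨁ (λ i → cP i ∧ α₀ (inj₂ i) (coord j))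
        comb-split j = trans (⨁-+ M _) (cong₂ _xor_ (⨁-cong λ x → cong (λ k → cF x ∧ α₀ k (coord j)) (Fin.splitAt-↑ˡ M x r)) (⨁-cong λ i → cong (λ k → cP i ∧ α₀ k (coord j)) (Fin.splitAt-↑ʳ M r i)))

        P-good : ∀ i → cP i ≡ true → good i ≡ true
        P-good i e = trans (sym (cong maskF (Fin.splitAt-↑ʳ M r i))) (sup (M ↑ʳ i) e)

        q : Labelling
        q = labelling cF

        pieces : Chain
        pieces u v = ⨁ (λ i → cP i ∧ C i u v)

        D : Chain
        D u v = faceChain q u v xor pieces u v

        faces-sum : ∀ u v → ⨁ (λ x → cF x ∧ faceChain (labelling (_== x)) u v) ≡ faceChain q u v
        faces-sum u v = trans (⨁-cong λ x → solve 4 (λ a b c d → a :* (b :* (c :+ d)) := b :* (c :* a :+ d :* a)) refl (cF x) (E u v) (k₁ == x) (k₂ == x))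
          (trans (sym (⨁-∧ˡ (E u v) _)) (cong (E u v ∧_) (trans (⨁-xor _ _) (cong₂ _xor_ (⨁-δ′ k₁ cF) (⨁-δ′ k₂ cF)))))
          where
          k₁ = class (enc (u , v , true))
          k₂ = class (enc (u , v , false))

        D-edge : ∀ u v → E u v ≡ true → lt u v ≡ true → D u v ≡ false
        D-edge u v e l = trans (sym (trans (comb-split (pairC u v)) (trans (cong (λ k → ⨁ (λ x → cF x ∧ α₀ (inj₁ x) k) xor ⨁ (λ i → cP i ∧ α₀ (inj₂ i) k)) (coord-pair u v)) (cong (_xor pieces u v) (faces-sum u v)))))
          (h (pairC u v) (trans (cong maskL (coord-pair u v)) (∧-true l e)))

        D-symm : ∀ u v → D u v ≡ D v u
        D-symm u v = cong₂ _xor_ (symm (faceChain-isChain (labelling-isFace cF)) u v) (⨁-cong λ i → ∧-congʳ-if {cP i} λ e → symm (C-chain i (P-good i e)) u v)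

        D-supp : ∀ u v → E u v ≡ false → D u v ≡ false
        D-supp u v e = cong₂ _xor_ (cong (_∧ (q u v true xor q u v false)) e) (⨁-false λ i → ¬true⇒false λ k → true≢false (supp (C-chain i (P-good i (∧-fst {cP i} k))) u v (∧-snd {cP i} k)) e)

        D-zero : ∀ u v → D u v ≡ false
        D-zero u v with true-or-false (E u v)
        ... | inj₂ e = D-supp u v e
        ... | inj₁ e with order u v
        ...   | below l _ = D-edge u v e l
        ...   | equal refl _ = ⊥-elim (true≢false e (E-irrefl u))
        ...   | above _ l = trans (D-symm u v) (D-edge v u (trans (E-sym v u) e) l)

        -- Pairing the vanishing combination `D` with `C′ i` under `B` kills the face boundaries
        -- and, by duality, leaves exactly the coefficient `cP i`.
        P-zero : ∀ i → cP i ≡ false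
        P-zero i = ¬true⇒false λ e → let g = P-good i e in true≢false e (begin
          cP i ≡⟨ sym (⨁-δ i cP) ⟩
          ⨁ (λ j → (j == i) ∧ cP j) ≡⟨ ⨁-cong (λ j → trans (∧-comm (j == i) (cP j)) (trans (∧-congʳ-if {cP j} λ e′ → sym (dual j i (P-good j e′) g)) (sym (B-scaleˡ (cP j) (C j) (C′ i))))) ⟩
          ⨁ (λ j → B (λ u v → cP j ∧ C j u v) (C′ i)) ≡⟨ sym (B-⨁ˡ _ (C′ i)) ⟩
          B pieces (C′ i) ≡⟨ cong (_xor B pieces (C′ i)) (sym (B-face (labelling-isFace cF) (C′ i) (C′-chain i g) (∂C′ i g))) ⟩
          B (faceChain q) (C′ i) xor B pieces (C′ i) ≡⟨ sym (B-xorˡ (faceChain q) pieces (C′ i)) ⟩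
          B D (C′ i) ≡⟨ B-zeroˡ D (C′ i) D-zero ⟩
          false ∎)

        face-zero : ∀ u v → faceChain q u v ≡ false
        face-zero u v = trans (sym (trans (cong (faceChain q u v xor_) (⨁-false λ i → cong (_∧ C i u v) (P-zero i))) (xor-identityʳ _))) (D-zero u v)

        root-zero : ∀ w → isRoot w ≡ true → E w (start w) ≡ true → q w (start w) true ≡ false
        root-zero w rt e = trans (sym (trans (comb-split (faceC w)) (trans (cong (λ k → ⨁ (λ x → cF x ∧ α₀ (inj₁ x) k) xor ⨁ (λ i → cP i ∧ α₀ (inj₂ i) k)) (coord-face w))
            (trans (cong₂ _xor_ (trans (⨁-cong λ x → ∧-comm (cF x) _) (⨁-δ′ (class (enc (w , start w , true))) cF)) (⨁-false λ i → ∧-zeroʳ _)) (xor-identityʳ _)))))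
          (h (faceC w) (trans (cong maskL (coord-face w)) (∧-true rt (anyF⁺ (E w) (start w) e))))

        -- Without the cycles, the coefficients form a labelling with zero boundary. It is constant
        -- on components and `false` at the roots.
        F-zero : ∀ x → cF x ≡ false
        F-zero x = ¬true⇒false λ e →
          let f = trans (sym (cong maskF (Fin.splitAt-↑ˡ M x r))) (sup (x ↑ˡ r) e)
              (u , v , s) = dec x
              edge = ∧-fst {validᵇ x} f
              label : q u v s ≡ true
              label = trans (cong cF (trans (cong class (enc-dec x)) (==⇒≡ (class x) x (∧-snd {validᵇ x} f)))) e
          in true≢false label (trans (label-constant (labelling-isFace cF) face-zero (reach⇒Path E (rep-reach u)) v (start (rep u)) s edge (rep-start u v edge))
               (root-zero (rep u) (rep-root u (E⇒Xˡ edge)) (rep-start u v edge)))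

        all-zero : ∀ i → c i ≡ false
        all-zero i = trans (cong c (sym (Fin.join-splitAt M r i))) (go (splitAt M i))
          where
          go : ∀ k → c ([ _↑ˡ r , M ↑ʳ_ ]′ k) ≡ false
          go (inj₁ x) = F-zero x
          go (inj₂ k) = P-zero k

      α-independent : Independent F L α
      α-independent c sup h = Independence.all-zero c sup h

      edgeCount : ℕ
      edgeCount = ∑ (λ u → ∑ (λ v → ⟦ lt u v ∧ E u v ⟧))

      numEdges≡ : numEdges A X ≡ edgeCount
      numEdges≡ = trans (cong ⌊_/2⌋ darts) (sym (ℕ.n≡⌊n+n/2⌋ edgeCount))
        where
        split : ∀ u v → ⟦ E u v ⟧ ≡ ⟦ lt u v ∧ E u v ⟧ + ⟦ lt v u ∧ E v u ⟧
        split u v with order u v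
        ... | below p q rewrite p | q = sym (ℕ.+-identityʳ _)
        ... | equal refl q rewrite q = cong ⟦_⟧ (E-irrefl u)
        ... | above p q rewrite p | q = cong ⟦_⟧ (E-sym u v)
        darts : numDarts A X ≡ edgeCount + edgeCount
        darts = trans (sumF≡∑ n _) (trans (∑-cong λ u → trans (countF≡cnt n _) (trans (∑-cong λ v → split u v) (∑-+ _ _)))
          (trans (∑-+ _ _) (cong (edgeCount +_) (∑-swap (λ u v → ⟦ lt v u ∧ E v u ⟧)))))

      roots-bound : cnt (λ w → isRoot w ∧ hasNbr w) + numIsolated A X ≤ numComps A X
      roots-bound = ℕ.≤-trans (ℕ.≤-reflexive (trans (cong (cnt (λ w → isRoot w ∧ hasNbr w) +_) (countF≡cnt n _)) (sym (∑-+ _ _))))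
          (ℕ.≤-trans (∑-mono λ w → go (isRoot w) (hasNbr w) (X w) (isolated w)) (ℕ.≤-reflexive (sym (countF≡cnt n _))))
        where
        go : ∀ a b c → (c ≡ true → b ≡ false → a ≡ true) → ⟦ a ∧ b ⟧ + ⟦ c ∧ not b ⟧ ≤ ⟦ a ⟧
        go true true true h = s≤s z≤n
        go true true false h = s≤s z≤n
        go true false true h = s≤s z≤n
        go true false false h = z≤n
        go false true true h = z≤n
        go false true false h = z≤n
        go false false false h = z≤n
        go false false true h = ⊥-elim (true≢false (h refl refl) refl)
        isolated : ∀ w → X w ≡ true → hasNbr w ≡ false → isRoot w ≡ true
        isolated w Xw iso = subst (λ t → isRoot t ≡ true) (alone (reach⇒Path E (rep-reach w))) (rep-root w Xw)
          where
          alone : ∀ {v} → Path E w v → v ≡ w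
          alone ε = refl
          alone (_◅_ {j = v} e p) = ⊥-elim (true≢false (anyF⁺ (E w) v e) iso)

      -- Face boundaries and the given cycles are orthogonal to the cuts spanned by the stars. The
      -- coordinates added at the roots restore independence on both sides, at the price of one per
      -- component and family.
      dimension : (cnt isFace + cnt good) + numVerts X ≤ numEdges A X + (cnt (λ w → isRoot w ∧ hasNbr w) + numComps A X)
      dimension = ℕ.≤-trans (ℕ.≤-reflexive (cong₂ _+_ (sym cnt-F) (countF≡cnt n X)))
        (ℕ.≤-trans (orthogonal-dim dim F X L α β α-independent β-independent orthogonal)
          (ℕ.≤-reflexive (trans (coord-∑ (λ k → ⟦ maskL k ⟧)) (cong₂ _+_ (sym numEdges≡) (cong (cnt (λ w → isRoot w ∧ hasNbr w) +_) (sym (countF≡cnt n isRoot)))))))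

    genus-bound : ∀ g → 2 * numComps A X + numEdges A X ≤ g + numVerts X + numFaces R → cnt good ≤ g
    genus-bound g h = euler-arithmetic dimension roots-bound h
      (ℕ.≤-trans (ℕ.⌊n/2⌋-mono numOrbits≤) (ℕ.≤-reflexive (sym (ℕ.n≡⌊n+n/2⌋ (cnt isFace)))))

-- The van Kampen obstruction of K₅

module Kuratowski {n : ℕ} {A : Adj n} {X : Mask n} (R : RotSystem A X)
    (E-sym : ∀ u v → adjM A X u v ≡ adjM A X v u) (E-irrefl : ∀ u → adjM A X u u ≡ false) where
  open Form R E-sym E-irrefl

  -- A homological almost embedding of K₅: a chain map sending disjoint simplices to chains with disjoint supports.
  record AlmostK₅ (over : Fin n → Fin 5 → Bool) : Set where
    field
      over-unique : ∀ {a i j} → over a i ≡ true → over a j ≡ true → i ≡ j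
      vertex : Fin 5 → Fin n → Bool
      edge : Fin 5 → Fin 5 → Chain
      vertex-over : ∀ i a → vertex i a ≡ true → over a i ≡ true
      edge-chain : ∀ i j → i ≢ j → IsChain (edge i j)
      edge-over : ∀ i j a u → edge i j a u ≡ true → over a i ∨ over a j ≡ true
      edge-∂ : ∀ i j → i ≢ j → ∀ a → ∂ (edge i j) a ≡ vertex i a xor vertex j a
      vertex-odd : ⨁ (vertex zero) ≡ true

  private
    pattern v₁ = suc zero
    pattern v₂ = suc (suc zero)
    pattern v₃ = suc (suc (suc zero))
    pattern v₄ = suc (suc (suc (suc zero)))

  xor-chain : ∀ {x y} → IsChain x → IsChain y → IsChain (λ u v → x u v xor y u v)
  xor-chain {x} {y} cx cy = record
    { symm = λ u v → cong₂ _xor_ (symm cx u v) (symm cy u v)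
    ; supp = λ u v h → case true-or-false (x u v) of λ where
        (inj₁ e) → supp cx u v e
        (inj₂ e) → supp cy u v (trans (cong (_xor y u v) (sym e)) h) }

  record DualCycles (over : Fin n → Fin 5 → Bool) : Set where
    field
      Z Z′ : Chain
      Z-chain : IsChain Z
      Z′-chain : IsChain Z′
      Z-∂ : ∀ a → ∂ Z a ≡ false
      Z′-∂ : ∀ a → ∂ Z′ a ≡ false
      Z-over : ∀ a u → Z a u ≡ true → ∃ λ i → over a i ≡ true
      Z′-over : ∀ a u → Z′ a u ≡ true → ∃ λ i → over a i ≡ true
      crossing : B Z Z′ ≡ true

  module _ {over : Fin n → Fin 5 → Bool} (K : AlmostK₅ over) where
    open AlmostK₅ K

    private
      spoke : Fin 5 → Chain
      spoke = edge zero

      triangle : Fin 5 → Fin 5 → Chain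
      triangle i j u v = (spoke i u v xor spoke j u v) xor edge i j u v

      triangle-chain : ∀ {i j} → zero ≢ i → zero ≢ j → i ≢ j → IsChain (triangle i j)
      triangle-chain i≢ j≢ i≢j = xor-chain (xor-chain (edge-chain _ _ i≢) (edge-chain _ _ j≢)) (edge-chain _ _ i≢j)

      triangle-∂ : ∀ {i j} → zero ≢ i → zero ≢ j → i ≢ j → ∀ a → ∂ (triangle i j) a ≡ false
      triangle-∂ {i} {j} i≢ j≢ i≢j a = trans (⨁-xor _ _) (trans (cong₂ _xor_ (trans (⨁-xor _ _) (cong₂ _xor_ (edge-∂ zero i i≢ a) (edge-∂ zero j j≢ a))) (edge-∂ i j i≢j a))
        (solve 3 (λ x y z → ((x :+ y) :+ (x :+ z)) :+ (y :+ z) := con false) refl (vertex zero a) (vertex i a) (vertex j a)))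

      edge-over′ : ∀ i j a u → edge i j a u ≡ true → ∃ λ k → over a k ≡ true
      edge-over′ i j a u h = case ∨-case {over a i} (edge-over i j a u h) of λ where
        (inj₁ e) → i , e
        (inj₂ e) → j , e

      triangle-over : ∀ i j a u → triangle i j a u ≡ true → ∃ λ k → over a k ≡ true
      triangle-over i j a u h with true-or-false (spoke i a u) | true-or-false (spoke j a u)
      ... | inj₁ e | _ = edge-over′ _ _ a u e
      ... | inj₂ _ | inj₁ e = edge-over′ _ _ a u e
      ... | inj₂ e | inj₂ e′ = edge-over′ _ _ a u (trans (cong₂ (λ s t → (s xor t) xor edge i j a u) (sym e) (sym e′)) h)

      edge-disjoint : ∀ {i j k l} → i ≢ k → i ≢ l → j ≢ k → j ≢ l → B (edge i j) (edge k l) ≡ false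
      edge-disjoint {i} {j} {k} {l} ik il jk jl = B-disjoint (edge i j) (edge k l) λ a u w → ¬true⇒false λ h →
        case (∨-case {over a i} (edge-over i j a u (∧-fst {edge i j a u} h)) ,′ ∨-case {over a k} (edge-over k l a w (∧-snd {edge i j a u} h))) of λ where
          (inj₁ p , inj₁ q) → ik (over-unique p q)
          (inj₁ p , inj₂ q) → il (over-unique p q)
          (inj₂ p , inj₁ q) → jk (over-unique p q)
          (inj₂ p , inj₂ q) → jl (over-unique p q)

      -- The edge opposite to `zero` in one triangle is disjoint from the whole other triangle, so
      -- only spokes meet.
      B-triangles : ∀ {i j k l} → zero ≢ i → zero ≢ j → zero ≢ k → zero ≢ l → i ≢ k → i ≢ l → j ≢ k → j ≢ l →
        B (triangle i j) (triangle k l) ≡ (B (spoke i) (spoke k) xor B (spoke i) (spoke l)) xor (B (spoke j) (spoke k) xor B (spoke j) (spoke l))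
      B-triangles {i} {j} {k} {l} i0 j0 k0 l0 ik il jk jl = begin
        B (triangle i j) (triangle k l) ≡⟨ trans (B-xorˡ _ (edge i j) _) (cong₂ _xor_ (trans (B-xorˡ (spoke i) (spoke j) _) (cong₂ _xor_ (row (spoke i)) (row (spoke j)))) (row (edge i j))) ⟩
        (((s i k xor s i l) xor B (spoke i) (edge k l)) xor ((s j k xor s j l) xor B (spoke j) (edge k l))) xor ((B (edge i j) (spoke k) xor B (edge i j) (spoke l)) xor B (edge i j) (edge k l))
          ≡⟨ cong₂ _xor_ (cong₂ _xor_ (drop (s i k xor s i l) (edge-disjoint k0 l0 ik il)) (drop (s j k xor s j l) (edge-disjoint k0 l0 jk jl)))
               (trans (drop (B (edge i j) (spoke k) xor B (edge i j) (spoke l)) (edge-disjoint ik il jk jl)) (cong₂ _xor_ (edge-disjoint (i0 ∘ sym) ik (j0 ∘ sym) jk) (edge-disjoint (i0 ∘ sym) il (j0 ∘ sym) jl))) ⟩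
        ((s i k xor s i l) xor (s j k xor s j l)) xor false ≡⟨ xor-identityʳ _ ⟩
        (s i k xor s i l) xor (s j k xor s j l) ∎
        where
        s : Fin 5 → Fin 5 → Bool
        s i k = B (spoke i) (spoke k)
        row : ∀ x → B x (triangle k l) ≡ (B x (spoke k) xor B x (spoke l)) xor B x (edge k l)
        row x = trans (B-xorʳ x _ (edge k l)) (cong (_xor B x (edge k l)) (B-xorʳ x (spoke k) (spoke l)))
        drop : ∀ a {b} → b ≡ false → a xor b ≡ a
        drop a refl = xor-identityʳ _

      -- The boundaries of two spokes share only the 0-chain over `zero`, and its augmentation is
      -- odd.
      spokes : ∀ {i j} → zero ≢ i → zero ≢ j → i ≢ j → B (spoke i) (spoke j) xor B (spoke j) (spoke i) ≡ true
      spokes {i} {j} i≢ j≢ i≢j = trans (B-sym (spoke i) (spoke j) (edge-chain _ _ i≢) (edge-chain _ _ j≢)) (trans (⨁-cong λ a → trans (cong₂ _∧_ (edge-∂ zero i i≢ a) (edge-∂ zero j j≢ a)) (meet a)) vertex-odd)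
        where
        apart : ∀ {i j} → i ≢ j → ∀ a → vertex i a ∧ vertex j a ≡ false
        apart {i} {j} ne a = ¬true⇒false λ h → ne (over-unique (vertex-over i a (∧-fst {vertex i a} h)) (vertex-over j a (∧-snd {vertex i a} h)))
        meet : ∀ a → (vertex zero a xor vertex i a) ∧ (vertex zero a xor vertex j a) ≡ vertex zero a
        meet a = trans (solve 3 (λ x y z → (x :+ y) :* (x :+ z) := x :* x :+ (x :* z :+ (x :* y :+ y :* z))) refl (vertex zero a) (vertex i a) (vertex j a))
          (trans (cong₂ _xor_ (∧-idem (vertex zero a)) (cong₂ _xor_ (apart j≢ a) (cong₂ _xor_ (apart i≢ a) (apart i≢j a)))) (xor-identityʳ _))

      -- After expansion the pairs of spokes v₂, v₃, v₄ occur in both orders, and everything else cancels.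
      odd-crossings : (B (triangle v₁ v₂) (triangle v₃ v₄) xor B (triangle v₁ v₃) (triangle v₂ v₄)) xor B (triangle v₁ v₄) (triangle v₂ v₃) ≡ true
      odd-crossings = begin
        (B (triangle v₁ v₂) (triangle v₃ v₄) xor B (triangle v₁ v₃) (triangle v₂ v₄)) xor B (triangle v₁ v₄) (triangle v₂ v₃)
          ≡⟨ cong₂ _xor_ (cong₂ _xor_ (B-triangles (λ ()) (λ ()) (λ ()) (λ ()) (λ ()) (λ ()) (λ ()) (λ ())) (B-triangles (λ ()) (λ ()) (λ ()) (λ ()) (λ ()) (λ ()) (λ ()) (λ ())))
               (B-triangles (λ ()) (λ ()) (λ ()) (λ ()) (λ ()) (λ ()) (λ ()) (λ ())) ⟩
        (((s v₁ v₃ xor s v₁ v₄) xor (s v₂ v₃ xor s v₂ v₄)) xor ((s v₁ v₂ xor s v₁ v₄) xor (s v₃ v₂ xor s v₃ v₄))) xor ((s v₁ v₂ xor s v₁ v₃) xor (s v₄ v₂ xor s v₄ v₃))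
          ≡⟨ solve 9 (λ s12 s13 s14 s23 s24 s32 s34 s42 s43 → (((s13 :+ s14) :+ (s23 :+ s24)) :+ ((s12 :+ s14) :+ (s32 :+ s34))) :+ ((s12 :+ s13) :+ (s42 :+ s43)) := ((s23 :+ s32) :+ (s24 :+ s42)) :+ (s34 :+ s43)) refl
               (s v₁ v₂) (s v₁ v₃) (s v₁ v₄) (s v₂ v₃) (s v₂ v₄) (s v₃ v₂) (s v₃ v₄) (s v₄ v₂) (s v₄ v₃) ⟩
        ((s v₂ v₃ xor s v₃ v₂) xor (s v₂ v₄ xor s v₄ v₂)) xor (s v₃ v₄ xor s v₄ v₃)
          ≡⟨ cong₂ _xor_ (cong₂ _xor_ (spokes (λ ()) (λ ()) (λ ())) (spokes (λ ()) (λ ()) (λ ()))) (spokes (λ ()) (λ ()) (λ ())) ⟩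
        true ∎
        where
        s : Fin 5 → Fin 5 → Bool
        s i k = B (spoke i) (spoke k)

      dual : ∀ {i j k l} → zero ≢ i → zero ≢ j → zero ≢ k → zero ≢ l → i ≢ j → k ≢ l → B (triangle i j) (triangle k l) ≡ true → DualCycles over
      dual {i} {j} {k} {l} i0 j0 k0 l0 ij kl h = record
        { Z = triangle i j ; Z′ = triangle k l ; Z-chain = triangle-chain i0 j0 ij ; Z′-chain = triangle-chain k0 l0 kl
        ; Z-∂ = triangle-∂ i0 j0 ij ; Z′-∂ = triangle-∂ k0 l0 kl ; Z-over = triangle-over i j ; Z′-over = triangle-over k l ; crossing = h }

    -- Of three values with odd sum one is `true`. Which one may differ from copy to copy, so the
    -- record forgets the triangles behind the cycles.
    dualCycles : DualCycles over
    dualCycles = case (true-or-false (B (triangle v₁ v₂) (triangle v₃ v₄)) ,′ true-or-false (B (triangle v₁ v₃) (triangle v₂ v₄))) of λ where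
      (inj₁ h , _) → dual (λ ()) (λ ()) (λ ()) (λ ()) (λ ()) (λ ()) h
      (inj₂ _ , inj₁ h) → dual (λ ()) (λ ()) (λ ()) (λ ()) (λ ()) (λ ()) h
      (inj₂ h , inj₂ h′) → dual (λ ()) (λ ()) (λ ()) (λ ()) (λ ()) (λ ())
        (trans (cong₂ (λ s t → (s xor t) xor B (triangle v₁ v₄) (triangle v₂ v₃)) (sym h) (sym h′)) odd-crossings)

-- Localising a certificate in one bag

cnt-true : ∀ n → cnt {n} (λ _ → true) ≡ n
cnt-true n = trans (sym (ℕ.+-identityʳ _)) (trans (cong (cnt {n} (λ _ → true) +_) (sym (∑-0 {n} λ _ → refl))) (cnt-not {n} (λ _ → true)))

-- The core of dominating vertices spreads parities past any separator of size k; the disjoint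
-- five-cliques carry the genus.
record Target (k r : ℕ) {N : ℕ} (Γ : Graph N) : Set where
  field
    core : Fin (suc k) → Fin N
    core-injective : ∀ {i j} → core i ≡ core j → i ≡ j
    core-adj : ∀ i w → w ≢ core i → adj Γ (core i) w ≡ true
    block : Fin r → Fin 5 → Fin N
    block-injective : ∀ {b b′ i i′} → block b i ≡ block b′ i′ → b ≡ b′ × i ≡ i′
    block-adj : ∀ b {i i′} → i ≢ i′ → adj Γ (block b i) (block b i′) ≡ true

module Parity {n N k r : ℕ} (K : Graph n) (Γ : Graph N) (target : Target k r Γ) (U : Fin N)
    (φ : Fin n → Fin N) (cert : Certificate K Γ U φ) where
  open Certificate cert public
  open Target target public

  parity : Mask n → Fin N → Bool
  parity M w = ⨁ (λ a → (M a ∧ (φ a == w)) ∧ y a)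

  hits : Mask n → Fin N → Bool
  hits S w = anyF n (λ a → S a ∧ (φ a == w))

  hits⁺ : ∀ S w a → S a ≡ true → φ a ≡ w → hits S w ≡ true
  hits⁺ S w a Sa e = anyF⁺ _ a (∧-true Sa (≡⇒== e))

  Boundary : Mask n → Mask n → Set
  Boundary M S = ∀ a b → M a ≡ true → adj K a b ≡ true → M b ≡ false → S b ≡ true

  -- An edge over w w′ that starts in M ends in M.
  transfer : ∀ M S → Boundary M S → ∀ w w′ → hits S w ≡ false → hits S w′ ≡ false → ∀ a b →
    (M a ∧ (φ a == w)) ∧ ((φ b == w′) ∧ z a b) ≡ (M b ∧ (φ b == w′)) ∧ ((φ a == w) ∧ z b a)
  transfer M S bd w w′ hw hw′ a b = iff⇒≡ (move hw′ a b) (move hw b a)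
    where
    stays : ∀ {a b v} → hits S v ≡ false → adj K a b ≡ true → (φ b == v) ≡ true → M a ≡ true → M b ≡ true
    stays {a} {b} {v} h ad e Ma = case true-or-false (M b) of λ where
      (inj₁ q) → q
      (inj₂ q) → ⊥-elim (true≢false (hits⁺ S v b (bd a b Ma ad q) (==⇒≡ (φ b) v e)) h)
    move : ∀ {w w′} → hits S w′ ≡ false → ∀ a b → (M a ∧ (φ a == w)) ∧ ((φ b == w′) ∧ z a b) ≡ true → (M b ∧ (φ b == w′)) ∧ ((φ a == w) ∧ z b a) ≡ true
    move {w} {w′} hw′ a b h =
      let Ma = ∧-fst {M a} (∧-fst {M a ∧ (φ a == w)} h)
          ea = ∧-snd {M a} (∧-fst {M a ∧ (φ a == w)} h)
          eb = ∧-fst {φ b == w′} (∧-snd {M a ∧ (φ a == w)} h)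
          zab = ∧-snd {φ b == w′} (∧-snd {M a ∧ (φ a == w)} h)
      in ∧-true (∧-true (stays hw′ (z-adj a b zab) eb Ma) eb) (∧-true ea (trans (z-sym b a) zab))

  -- By `balance` both sides count the edges of `z` over w w′ inside `M`, once from either end: no
  -- such edge leaves `M`, because its outer end would be in `S`.
  parity-edge : ∀ M S → Boundary M S → ∀ w w′ → adj Γ w w′ ≡ true → hits S w ≡ false → hits S w′ ≡ false → parity M w ≡ parity M w′
  parity-edge M S bd w w′ e hw hw′ = begin
    ⨁ (λ a → (M a ∧ (φ a == w)) ∧ y a) ≡⟨ ⨁-cong (λ a → expand a w w′ e) ⟩
    ⨁ (λ a → ⨁ (λ b → (M a ∧ (φ a == w)) ∧ ((φ b == w′) ∧ z a b))) ≡⟨ ⨁-swap _ ⟩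
    ⨁ (λ b → ⨁ (λ a → (M a ∧ (φ a == w)) ∧ ((φ b == w′) ∧ z a b))) ≡⟨ ⨁-cong (λ b → ⨁-cong λ a → transfer M S bd w w′ hw hw′ a b) ⟩
    ⨁ (λ b → ⨁ (λ a → (M b ∧ (φ b == w′)) ∧ ((φ a == w) ∧ z b a))) ≡⟨ ⨁-cong (λ b → sym (expand b w′ w (trans (Graph.sym Γ w′ w) e))) ⟩
    ⨁ (λ b → (M b ∧ (φ b == w′)) ∧ y b) ∎
    where
    expand : ∀ a w w′ → adj Γ w w′ ≡ true → (M a ∧ (φ a == w)) ∧ y a ≡ ⨁ (λ b → (M a ∧ (φ a == w)) ∧ ((φ b == w′) ∧ z a b))
    expand a w w′ e = trans (∧-congʳ-if {M a ∧ (φ a == w)} λ h → balance a w′ (trans (cong (λ v → adj Γ v w′) (==⇒≡ (φ a) w (∧-snd {M a} h))) e)) (⨁-∧ˡ (M a ∧ (φ a == w)) _)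

  free-core : ∀ S → cnt S ≤ k → ∃ λ i → hits S (core i) ≡ false
  free-core S small with search (λ i → not (hits S (core i)))
  ... | inj₁ (i , h) = i , not-true h
  ... | inj₂ none = ⊥-elim (ℕ.<-irrefl refl (ℕ.≤-trans (ℕ.≤-trans (ℕ.≤-reflexive (sym (cnt-true (suc k))))
          (cnt-≤ (λ _ → true) S (λ i _ → proj₁ (witness i)) (λ i _ → ∧-fst {S (proj₁ (witness i))} (proj₂ (witness i)))
            (λ i _ j _ e → core-injective (trans (sym (image i)) (trans (cong φ e) (image j)))))) small))
    where
    witness : ∀ i → ∃ λ a → S a ∧ (φ a == core i) ≡ true
    witness i = anyF⁻ _ (case true-or-false (hits S (core i)) of λ where
      (inj₁ h) → h
      (inj₂ h) → ⊥-elim (true≢false (cong not h) (none i)))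
    image : ∀ i → φ (proj₁ (witness i)) ≡ core i
    image i = ==⇒≡ (φ (proj₁ (witness i))) (core i) (∧-snd {S (proj₁ (witness i))} (proj₂ (witness i)))

  -- At most k fibres are hit, so one of the k + 1 core vertices is free. It is adjacent to
  -- everything else, and every other free vertex is compared with it.
  parity-constant : ∀ M S → Boundary M S → cnt S ≤ k → ∀ w w′ → hits S w ≡ false → hits S w′ ≡ false → parity M w ≡ parity M w′
  parity-constant M S bd small w w′ hw hw′ = let (i , hi) = free-core S small in trans (to-core i hi w hw) (sym (to-core i hi w′ hw′))
    where
    to-core : ∀ i → hits S (core i) ≡ false → ∀ w → hits S w ≡ false → parity M w ≡ parity M (core i)
    to-core i hi w hw with w ≟ core i
    ... | yes refl = refl
    ... | no ne = sym (parity-edge M S bd (core i) w (core-adj i w ne) hi hw)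

  module Flaps (X : Mask n) where
    Out : Adj n
    Out = adjM (adj K) (λ a → not (X a))

    Out-sym : ∀ a b → Out a b ≡ Out b a
    Out-sym a b = trans (cong (λ t → not (X a) ∧ (not (X b) ∧ t)) (Graph.sym K a b)) (solve 3 (λ p q r → p :* (q :* r) := q :* (p :* r)) refl (not (X a)) (not (X b)) (adj K b a))

    flap : Fin n → Mask n
    flap d a = reach Out d a

    attached : Fin n → Mask n
    attached d a = X a ∧ anyF n (λ c → adj K a c ∧ (not (X c) ∧ flap d c))

    flap-outside : ∀ {d a} → X d ≡ false → flap d a ≡ true → X a ≡ false
    flap-outside {d} Xd h = go (reach⇒Path Out h) Xd
      where
      go : ∀ {u v} → Path Out u v → X u ≡ false → X v ≡ false
      go ε q = q
      go {u} (_◅_ {j = w} e p) _ = go p (not-true (∧-fst {not (X w)} (∧-snd {not (X u)} e)))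

    flap-boundary : ∀ d → X d ≡ false → Boundary (flap d) (attached d)
    flap-boundary d Xd a b Da ad Db = case true-or-false (X b) of λ where
        (inj₁ Xb) → ∧-true Xb (anyF⁺ _ a (∧-true (trans (Graph.sym K b a) ad) (∧-true (cong not Xa) Da)))
        (inj₂ Xb) → ⊥-elim (true≢false (reach-trans Out Da (reach-edge Out (∧-true (cong not Xa) (∧-true (cong not Xb) ad)))) Db)
      where
      Xa = flap-outside Xd Da

  -- `C` is the odd side reached in the tree, cut off by `Sep` inside the bag. Evenness is required
  -- of the flaps meeting `C`, and only over fibres missed by their attachments, where
  -- `parity-constant` can apply.
  record Localised {t : ℕ} (β : Fin t → Mask n) : Set where
    field
      node : Fin t
      C Sep : Mask n
      boundary : Boundary C Sep
      Sep⊆β : ∀ a → Sep a ≡ true → β node a ≡ true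
      Sep-small : cnt Sep ≤ k
      C-odd : ∀ w → hits Sep w ≡ false → parity C w ≡ true
    open Flaps (β node) public
    field
      flaps-even : ∀ d → C d ≡ true → β node d ≡ false → ∀ w → hits (attached d) w ≡ false → parity (flap d) w ≡ false

  module Descent {s : ℕ} (T : Adj (suc s)) (tree : IsTree T) (β : Fin (suc s) → Mask n)
      (coverV : ∀ v → ∃ λ x → β x v ≡ true)
      (coverE : ∀ u v → adj K u v ≡ true → ∃ λ x → β x u ∧ β x v ≡ true)
      (subtree : ∀ v x y → β x v ≡ true → β y v ≡ true → reach (adjM T (λ z → β z v)) x y ≡ true)
      (adhesion : ∀ x y → T x y ≡ true → countF n (λ v → β x v ∧ β y v) ≤ k) where
    open Rooted T tree

    private
      record Search (t : Fin (suc s)) : Set where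
        field
          C Sep : Mask n
          boundary : Boundary C Sep
          Sep⊆β : ∀ a → Sep a ≡ true → β t a ≡ true
          Sep-small : cnt Sep ≤ k
          C-odd : ∀ w → hits Sep w ≡ false → parity C w ≡ true
          -- This invariant keeps every flap in `C` below a child of `t`, so that the search never
          -- has to turn back upwards.
          nested : ∀ a x → C a ≡ true → β x a ≡ true → Below t x

      module Child (t c : Fin (suc s)) (c≢ : c ≢ root) (pc : parent c ≡ t) where
        open Flaps (β t)

        stay : ∀ {a x y} → β t a ≡ false → Path (adjM T (λ z → β z a)) x y → Below c x → Below c y
        stay ta ε b = b
        stay {a} {x} ta (_◅_ {j = y} e p) b with below-edge b (∧-snd {β y a} (∧-snd {β x a} e))
        ... | inj₁ b′ = stay ta p b′
        ... | inj₂ (_ , y≡) = ⊥-elim (true≢false (∧-fst {β y a} (∧-snd {β x a} e)) (trans (cong (λ q → β q a) (trans y≡ pc)) ta))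

        bags : ∀ {a x} → β t a ≡ false → β x a ≡ true → Below c x → ∀ y → β y a ≡ true → Below c y
        bags {a} {x} ta xa b y ya = stay ta (reach⇒Path _ (subtree a x y xa ya)) b

        flap-bags : ∀ {d x} → β t d ≡ false → β x d ≡ true → Below c x → ∀ a y → flap d a ≡ true → β y a ≡ true → Below c y
        flap-bags td xd b a y h ya = go (reach⇒Path Out h) td xd b
          where
          go : ∀ {u x} → Path Out u a → β t u ≡ false → β x u ≡ true → Below c x → Below c y
          go ε tu xu b = bags tu xu b y ya
          go {u} (_◅_ {j = v} e p) tu xu b =
            let tv = not-true (∧-fst {not (β t v)} (∧-snd {not (β t u)} e))
                (x′ , q) = coverE u v (∧-snd {not (β t v)} (∧-snd {not (β t u)} e))
            in go p tv (∧-snd {β x′ u} q) (bags tu xu b x′ (∧-fst {β x′ u} q))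

        ¬below-t : ¬ Below c t
        ¬below-t b = ℕ.<-irrefl refl (ℕ.≤-trans (ℕ.≤-reflexive (sym (trans (parent-depth c c≢) (cong (suc ∘ depth) pc)))) (below-depth b))

        exit : ∀ {a x} → Path (adjM T (λ z → β z a)) x t → Below c x → β c a ≡ true
        exit ε b = ⊥-elim (¬below-t b)
        exit {a} {x} (_◅_ {j = y} e p) b with below-edge b (∧-snd {β y a} (∧-snd {β x a} e))
        ... | inj₁ b′ = exit p b′
        ... | inj₂ (x≡ , _) = subst (λ q → β q a ≡ true) x≡ (∧-fst {β x a} e)

        -- An attachment lies in the bag of `t` and shares a bag below `c` with a vertex of the
        -- flap. The bags containing it are connected in the tree, so they include that of `c`.
        attached⊆ : ∀ {d x} → β t d ≡ false → β x d ≡ true → Below c x → ∀ a → attached d a ≡ true → β c a ≡ true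
        attached⊆ {d} td xd b a h =
          let (v , q) = anyF⁻ _ (∧-snd {β t a} h)
              (x′ , m) = coverE a v (∧-fst {adj K a v} q)
              low = flap-bags td xd b v x′ (∧-snd {not (β t v)} (∧-snd {adj K a v} q)) (∧-snd {β x′ a} m)
          in exit (reach⇒Path _ (subtree a x′ t (∧-fst {β x′ a} m) (∧-fst {β t a} h))) low

        child-edge : T t c ≡ true
        child-edge = trans (cong (λ q → T q c) (sym pc)) (parent-edge c c≢)

      -- If some relevant flap is odd, it becomes the new `C` one level lower, with its attachments,
      -- a part of the adhesion, as separator. Depth grows with every step and never exceeds s + 1,
      -- so the fuel lasts.
      descend : ∀ fuel t → suc (suc s) ≤ fuel + depth t → Search t → Localised β
      descend zero t h _ = ⊥-elim (ℕ.<-irrefl refl (ℕ.≤-trans h (depth-bound t)))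
      descend (suc fuel) t h S = case search oddFlap of λ where
          (inj₂ none) → record
            { node = t ; C = C ; Sep = Sep ; boundary = boundary ; Sep⊆β = Sep⊆β ; Sep-small = Sep-small ; C-odd = C-odd
            ; flaps-even = λ d Cd td w hw → ¬true⇒false λ pd → true≢false
                (∧-true (∧-true Cd (cong not td)) (anyF⁺ _ w (∧-true (cong not hw) pd))) (none d) }
          (inj₁ (d , q)) →
            let Cd = ∧-fst {C d} (∧-fst {C d ∧ not (β t d)} q)
                td = not-true (∧-snd {C d} (∧-fst {C d ∧ not (β t d)} q))
                (w , m) = anyF⁻ _ (∧-snd {C d ∧ not (β t d)} q)
                hw = not-true (∧-fst {not (hits (attached d) w)} m)
                (x , xd) = coverV d
                (c , c≢ , pc , b) = below-child (nested d x Cd xd) (λ { refl → true≢false xd td })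
                open Child t c c≢ pc
                small : cnt (attached d) ≤ k
                small = ℕ.≤-trans (cnt-mono λ a ha → ∧-true (∧-fst {β t a} ha) (attached⊆ td xd b a ha))
                          (ℕ.≤-trans (ℕ.≤-reflexive (sym (countF≡cnt n _))) (adhesion t c child-edge))
            in descend fuel c (ℕ.≤-trans h (ℕ.≤-reflexive (trans (sym (ℕ.+-suc fuel (depth t))) (cong (fuel +_) (sym (trans (parent-depth c c≢) (cong (suc ∘ depth) pc)))))))
                 (record { C = flap d ; Sep = attached d ; boundary = flap-boundary d td ; Sep⊆β = attached⊆ td xd b ; Sep-small = small
                         -- Oddness was found over one fibre `w` only; since the separator is small
                         -- it spreads to all fibres it misses.
                         ; C-odd = λ w′ hw′ → trans (parity-constant (flap d) (attached d) (flap-boundary d td) small w′ w hw′ hw) (∧-snd {not (hits (attached d) w)} m)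
                         ; nested = λ a y fa ya → flap-bags td xd b a y fa ya })
        where
        open Search S
        open Flaps (β t)
        oddFlap : Fin n → Bool
        oddFlap d = (C d ∧ not (β t d)) ∧ anyF N (λ w → not (hits (attached d) w) ∧ parity (flap d) w)

    localise : Localised β
    localise = descend (suc (suc s)) root (ℕ.m≤m+n _ _) (record
      -- The search starts with all of K and no separator: `y` is odd over `U`, hence over every
      -- vertex of Γ.
      { C = λ _ → true ; Sep = λ _ → false ; boundary = λ _ _ _ _ () ; Sep⊆β = λ _ ()
      ; Sep-small = ℕ.≤-trans (ℕ.≤-reflexive (∑-0 λ _ → refl)) z≤n
      ; C-odd = λ w hw → trans (parity-constant (λ _ → true) (λ _ → false) (λ _ _ _ _ ()) (ℕ.≤-trans (ℕ.≤-reflexive (∑-0 λ _ → refl)) z≤n) w U hw none) odd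
      ; nested = λ a x _ _ → below-root x })
      where
      none : hits (λ _ → false) U ≡ false
      none = ¬true⇒false λ h → case proj₂ (anyF⁻ (λ a → false ∧ (φ a == U)) h) of λ ()

-- Pushing a certificate into a torso

module Push {n N k r t : ℕ} (K : Graph n) (Γ : Graph N) (target : Target k r Γ) (U : Fin N)
    (φ : Fin n → Fin N) (cert : Certificate K Γ U φ) {β : Fin t → Mask n}
    (loc : Parity.Localised K Γ target U φ cert β) where
  open Parity K Γ target U φ cert
  open Localised loc
  open Components Out Out-sym

  X : Mask n
  X = β node

  Tor : Adj n
  Tor = torso (adj K) X

  private
    flap-C : ∀ {a b} → C a ≡ true → X a ≡ false → flap a b ≡ true → C b ≡ true
    flap-C Ca Xa h = go (reach⇒Path Out h) Ca
      where
      go : ∀ {u v} → Path Out u v → C u ≡ true → C v ≡ true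
      go ε q = q
      go {u} (_◅_ {j = v} e p) Cu = go p (case true-or-false (C v) of λ where
        (inj₁ q) → q
        (inj₂ q) → ⊥-elim (true≢false (Sep⊆β v (boundary u v Cu (∧-snd {not (X v)} (∧-snd {not (X u)} e)) q)) (not-true (∧-fst {not (X v)} (∧-snd {not (X u)} e)))))

    attached-cong : ∀ {a b} → flap a b ≡ true → ∀ p → attached a p ≡ attached b p
    attached-cong {a} {b} h p = cong (X p ∧_) (iff⇒≡ (λ q → let (c , m) = anyF⁻ _ q in anyF⁺ _ c (trans (cong (λ u → adj K p c ∧ (not (X c) ∧ u)) (reach-cong (reach-sym h) c)) m))
      (λ q → let (c , m) = anyF⁻ _ q in anyF⁺ _ c (trans (cong (λ u → adj K p c ∧ (not (X c) ∧ u)) (reach-cong h c)) m)))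

    hits-cong : ∀ {a b} → flap a b ≡ true → ∀ w → hits (attached a) w ≡ hits (attached b) w
    hits-cong {a} {b} h w = iff⇒≡ (λ q → let (c , m) = anyF⁻ _ q in anyF⁺ _ c (trans (cong (_∧ (φ c == w)) (sym (attached-cong h c))) m))
      (λ q → let (c , m) = anyF⁻ _ q in anyF⁺ _ c (trans (cong (_∧ (φ c == w)) (attached-cong h c)) m))

    attached-X : ∀ d p → attached d p ≡ true → X p ≡ true
    attached-X d p = ∧-fst {X p}

    Tor-attached : ∀ {d p q} → p ≢ q → attached d p ≡ true → attached d q ≡ true → Tor p q ≡ true
    Tor-attached {d} {p} {q} ne hp hq =
      let (c , m) = anyF⁻ _ (∧-snd {X p} hp)
          (c′ , m′) = anyF⁻ _ (∧-snd {X q} hq)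
          m₂ = ∧-snd {adj K p c} m
          m₂′ = ∧-snd {adj K q c′} m′
      in ∧-true (attached-X d p hp) (∧-true (attached-X d q hq) (∧-true (cong not (≢⇒==false ne)) (∨-injʳ {adj K p q}
           (anyF⁺ _ c (anyF⁺ _ c′ (∧-true (∧-fst {not (X c)} m₂) (∧-true (∧-fst {not (X c′)} m₂′) (∧-true (∧-fst {adj K p c} m) (∧-true (∧-fst {adj K q c′} m′)
             (reach-trans Out (reach-sym (∧-snd {not (X c)} m₂)) (∧-snd {not (X c′)} m₂′))))))))))) 

    anchor : Fin N → Fin n → Fin n
    anchor w d = firstOr d (λ p → attached d p ∧ (φ p == w)) id

    anchor-spec : ∀ w d → hits (attached d) w ≡ true → attached d (anchor w d) ≡ true × φ (anchor w d) ≡ w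
    anchor-spec w d h =
      let (p , m) = anyF⁻ (λ p → attached d p ∧ (φ p == w)) h
          (j , q , e) = firstOr-some {d = d} (λ p → attached d p ∧ (φ p == w)) id m
      in trans (cong (attached d) e) (∧-fst {attached d j} q) , trans (cong φ e) (==⇒≡ (φ j) w (∧-snd {attached d j} q))

    anchor-cong : ∀ {a b} w → flap a b ≡ true → hits (attached a) w ≡ true → anchor w a ≡ anchor w b
    anchor-cong {a} {b} w h q = let (p , m) = anyF⁻ (λ p → attached a p ∧ (φ p == w)) q in
      trans (firstOr-default (λ p → attached a p ∧ (φ p == w)) id m) (firstOr-cong λ p → cong (_∧ (φ p == w)) (attached-cong h p))

    -- A flap is moved to one of its attachments over `w`. A flap without such an attachment stays
    -- outside X and is lost; `flaps-even` makes this loss even.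
    toFibre : Fin N → Fin n → Fin n
    toFibre w a = if X a then a else (if hits (attached a) w then anchor w a else a)

    -- Retraction of the flaps onto X used for an edge w w′ of Γ, at the vertices over w:
    -- the own fibre is preferred, so that it agrees with toFibre whenever the latter lands in X.
    retract : Fin N → Fin N → Fin n → Fin n
    retract w w′ a = if X a then a else (if hits (attached a) w then anchor w a else (if hits (attached a) w′ then anchor w′ a else a))

    retract-X : ∀ w w′ a → X a ≡ true → retract w w′ a ≡ a
    retract-X w w′ a Xa rewrite Xa = refl

    retract-attached : ∀ w w′ a → X a ≡ false → hits (attached a) w ∨ hits (attached a) w′ ≡ true →
      attached a (retract w w′ a) ≡ true × (φ (retract w w′ a) ≡ w ⊎ φ (retract w w′ a) ≡ w′)
    retract-attached w w′ a Xa h rewrite Xa with hits (attached a) w in eq | hits (attached a) w′ in eq′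
    ... | true | _ = let (p , q) = anchor-spec w a eq in p , inj₁ q
    ... | false | true = let (p , q) = anchor-spec w′ a eq′ in p , inj₂ q

    retract-free : ∀ w w′ a → X a ≡ false → hits (attached a) w ∨ hits (attached a) w′ ≡ false → retract w w′ a ≡ a
    retract-free w w′ a Xa h rewrite Xa with hits (attached a) w | hits (attached a) w′
    ... | false | false = refl

    retract-over : ∀ w w′ a → φ a ≡ w → X (retract w w′ a) ≡ true → φ (retract w w′ a) ≡ w ⊎ φ (retract w w′ a) ≡ w′
    retract-over w w′ a e h = case true-or-false (X a) of λ where
      (inj₁ Xa) → inj₁ (trans (cong φ (retract-X w w′ a Xa)) e)
      (inj₂ Xa) → case true-or-false (hits (attached a) w ∨ hits (attached a) w′) of λ where
        (inj₁ q) → proj₂ (retract-attached w w′ a Xa q)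
        (inj₂ q) → ⊥-elim (true≢false h (trans (cong X (retract-free w w′ a Xa q)) Xa))

    toFibre-over : ∀ w a → φ a ≡ w → X (toFibre w a) ≡ true → φ (toFibre w a) ≡ w
    toFibre-over w a e h with X a in Xa
    ... | true = e
    ... | false with hits (attached a) w in eq
    ...   | true = proj₂ (anchor-spec w a eq)
    ...   | false = ⊥-elim (true≢false h Xa)

    data Image (p q : Fin n) : Set where
      outside : X p ≡ false → X q ≡ false → Image p q
      collapsed : X p ≡ true → p ≡ q → Image p q
      edge : X p ≡ true → X q ≡ true → Tor p q ≡ true → Image p q

    attached-image : ∀ {d p q} → attached d p ≡ true → attached d q ≡ true → Image p q
    attached-image {d} {p} {q} hp hq with p ≟ q
    ... | yes e = collapsed (attached-X d p hp) e
    ... | no ne = edge (attached-X d p hp) (attached-X d q hq) (Tor-attached ne hp hq)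

    attached⁺ : ∀ {a b} → adj K a b ≡ true → X a ≡ true → X b ≡ false → attached b a ≡ true
    attached⁺ {a} {b} e Xa Xb = ∧-true Xa (anyF⁺ _ b (∧-true e (∧-true (cong not Xb) (reach-refl Out b))))

    -- An end in a flap moves to an attachment of that flap, and the attachments of one flap form a
    -- clique of the torso. If the other end is in X, it is itself an attachment over w or w′, so
    -- the flap is not left behind.
    image : ∀ {w w′ a b} → adj K a b ≡ true → φ a ≡ w → φ b ≡ w′ → Image (retract w w′ a) (retract w′ w b)
    image {w} {w′} {a} {b} e ea eb = case (true-or-false (X a) ,′ true-or-false (X b)) of λ where
        (inj₁ Xa , inj₁ Xb) → subst₂ (retract-X w w′ a Xa) (retract-X w′ w b Xb)
          (edge Xa Xb (∧-true Xa (∧-true Xb (∧-true (cong not (≢⇒==false {u = a} {b} λ { refl → true≢false e (Graph.irrefl K a) })) (∨-injˡ e)))))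
        (inj₁ Xa , inj₂ Xb) → subst₂ (retract-X w w′ a Xa) refl
          (attached-image {b} (attached⁺ e Xa Xb) (proj₁ (retract-attached w′ w b Xb (∨-injʳ {hits (attached b) w′} (hits⁺ _ w a (attached⁺ e Xa Xb) ea)))))
        (inj₂ Xa , inj₁ Xb) → let e′ = trans (Graph.sym K b a) e in subst₂ refl (retract-X w′ w b Xb)
          (attached-image {a} (proj₁ (retract-attached w w′ a Xa (∨-injʳ {hits (attached a) w} (hits⁺ _ w′ b (attached⁺ e′ Xb Xa) eb)))) (attached⁺ e′ Xb Xa))
        (inj₂ Xa , inj₂ Xb) →
          let ab = reach-edge Out (∧-true (cong not Xa) (∧-true (cong not Xb) e))
              swap = trans (∨-comm (hits (attached b) w′) _) (cong₂ _∨_ (sym (hits-cong ab w)) (sym (hits-cong ab w′)))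
          in case true-or-false (hits (attached a) w ∨ hits (attached a) w′) of λ where
               (inj₁ h) → attached-image {a} (proj₁ (retract-attached w w′ a Xa h))
                            (trans (attached-cong ab _) (proj₁ (retract-attached w′ w b Xb (trans swap h))))
               (inj₂ h) → subst₂ (retract-free w w′ a Xa h) (retract-free w′ w b Xb (trans swap h)) (outside Xa Xb)
      where
      subst₂ : ∀ {p p′ q q′} → p ≡ p′ → q ≡ q′ → Image p′ q′ → Image p q
      subst₂ refl refl i = i

  Tor-sym : ∀ p q → Tor p q ≡ true → Tor q p ≡ true
  Tor-sym p q h =
    let Xp = ∧-fst {X p} h ; h₁ = ∧-snd {X p} h ; Xq = ∧-fst {X q} h₁ ; h₂ = ∧-snd {X q} h₁
        ne = ∧-fst {not (p == q)} h₂
    in ∧-true Xq (∧-true Xp (∧-true (trans (cong not (==-sym q p)) ne) (case ∨-case {adj K p q} (∧-snd {not (p == q)} h₂) of λ where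
         (inj₁ e) → ∨-injˡ (trans (Graph.sym K q p) e)
         (inj₂ m) → let (c , m₁) = anyF⁻ _ m ; (c′ , m₂) = anyF⁻ _ m₁
                        Xc = ∧-fst {not (X c)} m₂ ; m₃ = ∧-snd {not (X c)} m₂ ; Xc′ = ∧-fst {not (X c′)} m₃ ; m₄ = ∧-snd {not (X c′)} m₃
                        a₁ = ∧-fst {adj K p c} m₄ ; m₅ = ∧-snd {adj K p c} m₄ ; a₂ = ∧-fst {adj K q c′} m₅ ; f = ∧-snd {adj K q c′} m₅
                    in ∨-injʳ {adj K q p} (anyF⁺ _ c′ (anyF⁺ _ c (∧-true Xc′ (∧-true Xc (∧-true a₂ (∧-true a₁ (reach-sym f))))))))))

  mass : Fin N → Fin n → Bool
  mass w a = (C a ∧ (φ a == w)) ∧ y a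

  private
    -- The sum is grouped by flaps, on each of which `h` is constant. A selected flap has no
    -- attachment over `w`: inside `C` it is even, and outside `C` it carries no mass.
    mass-even : ∀ w (h : Fin n → Bool) → (∀ {a b} → flap a b ≡ true → h a ≡ h b) → (∀ a → h a ≡ true → hits (attached a) w ≡ false) →
      ⨁ (λ a → (not (X a) ∧ h a) ∧ mass w a) ≡ false
    mass-even w h h-cong free = begin
      ⨁ (λ a → (not (X a) ∧ h a) ∧ mass w a) ≡⟨ ⨁-cong (λ a → sym (⨁-δ′ (rep a) (λ _ → (not (X a) ∧ h a) ∧ mass w a))) ⟩
      ⨁ (λ a → ⨁ (λ d → (rep a == d) ∧ ((not (X a) ∧ h a) ∧ mass w a))) ≡⟨ ⨁-swap _ ⟩
      ⨁ (λ d → ⨁ (λ a → (rep a == d) ∧ ((not (X a) ∧ h a) ∧ mass w a))) ≡⟨ ⨁-false (λ d → per-flap d) ⟩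
      false ∎
      where
      per-flap : ∀ d → ⨁ (λ a → (rep a == d) ∧ ((not (X a) ∧ h a) ∧ mass w a)) ≡ false
      per-flap d = case true-or-false ((rep d == d) ∧ ((not (X d) ∧ h d) ∧ C d)) of λ where
          (inj₁ q) →
            let rd = ==⇒≡ (rep d) d (∧-fst {rep d == d} q)
                q′ = ∧-snd {rep d == d} q
                Xd = not-true (∧-fst {not (X d)} (∧-fst {not (X d) ∧ h d} q′))
                hd = ∧-snd {not (X d)} (∧-fst {not (X d) ∧ h d} q′)
                Cd = ∧-snd {not (X d) ∧ h d} q′
            in trans (⨁-cong λ a → iff⇒≡
                 (λ m → let f = reach-sym (rep⇒reach (trans (==⇒≡ (rep a) d (∧-fst {rep a == d} m)) (sym rd)))
                            m′ = ∧-snd {not (X a) ∧ h a} (∧-snd {rep a == d} m)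
                        in ∧-true (∧-true f (∧-snd {C a} (∧-fst {C a ∧ (φ a == w)} m′))) (∧-snd {C a ∧ (φ a == w)} m′))
                 (λ m → let f = ∧-fst {flap d a} (∧-fst {flap d a ∧ (φ a == w)} m)
                        in ∧-true (≡⇒== (trans (sym (rep-cong f)) rd)) (∧-true (∧-true (cong not (flap-outside Xd f)) (trans (sym (h-cong f)) hd))
                             (∧-true (∧-true (flap-C Cd Xd f) (∧-snd {flap d a} (∧-fst {flap d a ∧ (φ a == w)} m))) (∧-snd {flap d a ∧ (φ a == w)} m)))))
               (flaps-even d Cd Xd w (free d hd))
          (inj₂ q) → ⨁-false λ a → ¬true⇒false λ m →
            let ra = ==⇒≡ (rep a) d (∧-fst {rep a == d} m)
                f : flap a d ≡ true
                f = subst (λ t → flap a t ≡ true) ra (rep-reach a)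
                m′ = ∧-snd {rep a == d} m
                Xa = not-true (∧-fst {not (X a)} (∧-fst {not (X a) ∧ h a} m′))
                ha = ∧-snd {not (X a)} (∧-fst {not (X a) ∧ h a} m′)
                Ca = ∧-fst {C a} (∧-fst {C a ∧ (φ a == w)} (∧-snd {not (X a) ∧ h a} m′))
            in true≢false (∧-true (≡⇒== (trans (sym (rep-cong f)) ra)) (∧-true (∧-true (cong not (flap-outside Xa f)) (trans (sym (h-cong f)) ha)) (flap-C Ca Xa f))) q

  vertexChain : Fin N → Fin n → Bool
  vertexChain w p = X p ∧ ⨁ (λ a → mass w a ∧ (toFibre w a == p))

  vertexChain-over : ∀ w p → vertexChain w p ≡ true → φ p ≡ w
  vertexChain-over w p h = case search (λ a → mass w a ∧ (toFibre w a == p)) of λ where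
    (inj₁ (a , m)) →
      let e = ==⇒≡ (toFibre w a) p (∧-snd {mass w a} m)
          ea = ==⇒≡ (φ a) w (∧-snd {C a} (∧-fst {C a ∧ (φ a == w)} (∧-fst {mass w a} m)))
      in trans (cong φ (sym e)) (toFibre-over w a ea (trans (cong X e) (∧-fst {X p} h)))
    (inj₂ none) → ⊥-elim (true≢false (∧-snd {X p} h) (⨁-false none))

  -- Pushing forward loses just the mass on flaps without attachment over `w`, an even amount, so
  -- the augmentation is still the odd parity of `C`.
  vertexChain-odd : ∀ w → hits Sep w ≡ false → ⨁ (vertexChain w) ≡ true
  vertexChain-odd w hw = begin
    ⨁ (λ p → X p ∧ ⨁ (λ a → mass w a ∧ (toFibre w a == p))) ≡⟨ ⨁-cong (λ p → ⨁-∧ˡ (X p) _) ⟩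
    ⨁ (λ p → ⨁ (λ a → X p ∧ (mass w a ∧ (toFibre w a == p)))) ≡⟨ ⨁-swap _ ⟩
    ⨁ (λ a → ⨁ (λ p → X p ∧ (mass w a ∧ (toFibre w a == p))))
      ≡⟨ ⨁-cong (λ a → trans (⨁-cong λ p → solve 3 (λ x m t → x :* (m :* t) := t :* (x :* m)) refl (X p) (mass w a) (toFibre w a == p)) (⨁-δ′ (toFibre w a) _)) ⟩
    ⨁ (λ a → X (toFibre w a) ∧ mass w a) ≡⟨ ⨁-cong (λ a → trans (cong (_∧ mass w a) (lands a)) (∧-distribʳ-xor (mass w a) true (not (X a) ∧ not (hits (attached a) w)))) ⟩
    ⨁ (λ a → mass w a xor ((not (X a) ∧ not (hits (attached a) w)) ∧ mass w a)) ≡⟨ ⨁-xor _ _ ⟩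
    parity C w xor ⨁ (λ a → (not (X a) ∧ not (hits (attached a) w)) ∧ mass w a)
      ≡⟨ cong₂ _xor_ (C-odd w hw) (mass-even w (λ a → not (hits (attached a) w)) (λ f → cong not (hits-cong f w)) (λ a → not-true)) ⟩
    true ∎
    where
    lands : ∀ a → X (toFibre w a) ≡ true xor (not (X a) ∧ not (hits (attached a) w))
    lands a with X a in Xa
    ... | true = Xa
    ... | false with hits (attached a) w in eq
    ...   | true = attached-X a _ (proj₁ (anchor-spec w a eq))
    ...   | false = Xa

  private
    image-X : ∀ {p q} → Image p q → X p ≡ X q
    image-X (outside p q) = trans p (sym q)
    image-X (collapsed _ e) = cong X e
    image-X (edge p q _) = trans p (sym q)

    -- The two retractions differ only on flaps without attachment over w, and these carry no mass.
    retract≈toFibre : ∀ w w′ p → X p ∧ ⨁ (λ a → mass w a ∧ (retract w w′ a == p)) ≡ vertexChain w p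
    retract≈toFibre w w′ p = ∧-congʳ-if {X p} λ Xp → trans (⨁-cong (difference Xp)) (trans (⨁-xor _ _)
        (trans (cong (⨁ (λ a → mass w a ∧ (toFibre w a == p)) xor_) (mass-even w h h-cong (λ a q → not-true (∧-fst {not (hits (attached a) w)} q)))) (xor-identityʳ _)))
      where
      h : Fin n → Bool
      h a = not (hits (attached a) w) ∧ (hits (attached a) w′ ∧ (anchor w′ a == p))
      h-cong : ∀ {a b} → flap a b ≡ true → h a ≡ h b
      h-cong {a} {b} f = cong₂ _∧_ (cong not (hits-cong f w)) (trans (∧-congʳ-if {hits (attached a) w′} λ q → cong (_== p) (anchor-cong w′ f q)) (cong (_∧ (anchor w′ b == p)) (hits-cong f w′)))
      difference : X p ≡ true → ∀ a → mass w a ∧ (retract w w′ a == p) ≡ (mass w a ∧ (toFibre w a == p)) xor ((not (X a) ∧ h a) ∧ mass w a)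
      difference Xp a with X a in Xa
      ... | true = sym (xor-identityʳ _)
      ... | false with hits (attached a) w
      ...   | true = sym (xor-identityʳ _)
      ...   | false with hits (attached a) w′
      ...     | false = sym (xor-identityʳ _)
      ...     | true = trans (∧-comm (mass w a) _) (sym (cong (_xor ((anchor w′ a == p) ∧ mass w a))
                  (trans (cong (mass w a ∧_) (≢⇒==false {u = a} {p} λ e → true≢false Xp (trans (cong X (sym e)) Xa))) (∧-zeroʳ (mass w a)))))

  module EdgeChain (w w′ : Fin N) (ww′ : adj Γ w w′ ≡ true) (hw : hits Sep w ≡ false) (hw′ : hits Sep w′ ≡ false) where
    private
      z⃗ : Fin n → Fin n → Bool
      z⃗ a b = (C a ∧ (φ a == w)) ∧ ((φ b == w′) ∧ z a b)

      σ σ′ : Fin n → Fin n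
      σ = retract w w′
      σ′ = retract w′ w

      out-mass : ∀ a → ⨁ (z⃗ a) ≡ mass w a
      out-mass a = trans (sym (⨁-∧ˡ (C a ∧ (φ a == w)) _)) (∧-congʳ-if {C a ∧ (φ a == w)} λ h →
        sym (balance a w′ (trans (cong (λ v → adj Γ v w′) (==⇒≡ (φ a) w (∧-snd {C a} h))) ww′)))

      -- Edges over w w′ that start in `C` also end in `C`, by `transfer`, so `z⃗` can be summed
      -- from its far end.
      in-mass : ∀ b → ⨁ (λ a → z⃗ a b) ≡ mass w′ b
      in-mass b = trans (⨁-cong λ a → transfer C Sep boundary w w′ hw hw′ a b) (trans (sym (⨁-∧ˡ (C b ∧ (φ b == w′)) _)) (∧-congʳ-if {C b ∧ (φ b == w′)} λ h →
          sym (balance b w (trans (cong (λ v → adj Γ v w) (==⇒≡ (φ b) w′ (∧-snd {C b} h))) (trans (Graph.sym Γ w′ w) ww′)))))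

      z⃗-image : ∀ a b → z⃗ a b ≡ true → Image (σ a) (σ′ b)
      z⃗-image a b h = image (z-adj a b (∧-snd {φ b == w′} (∧-snd {C a ∧ (φ a == w)} h)))
        (==⇒≡ (φ a) w (∧-snd {C a} (∧-fst {C a ∧ (φ a == w)} h))) (==⇒≡ (φ b) w′ (∧-fst {φ b == w′} (∧-snd {C a ∧ (φ a == w)} h)))

      H : Fin n → Fin n → Bool
      H p q = ⨁ (λ a → ⨁ (λ b → z⃗ a b ∧ ((σ a == p) ∧ (σ′ b == q))))

      H⁻ : ∀ p q → H p q ≡ true → ∃ λ a → ∃ λ b → z⃗ a b ≡ true × σ a ≡ p × σ′ b ≡ q
      H⁻ p q h with search (λ a → anyF n (λ b → z⃗ a b ∧ ((σ a == p) ∧ (σ′ b == q))))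
      ... | inj₁ (a , m) = let (b , m′) = anyF⁻ _ m ; e = ∧-snd {z⃗ a b} m′ in
              a , b , ∧-fst {z⃗ a b} m′ , ==⇒≡ (σ a) p (∧-fst {σ a == p} e) , ==⇒≡ (σ′ b) q (∧-snd {σ a == p} e)
      ... | inj₂ none = ⊥-elim (true≢false h (⨁-false λ a → ⨁-false λ b → ¬true⇒false λ m → true≢false (anyF⁺ (λ b → z⃗ a b ∧ ((σ a == p) ∧ (σ′ b == q))) b m) (none a)))

      -- Removes the edges that land outside X and those collapsed to a point; neither has a
      -- boundary in X.
      guard : Fin n → Fin n → Bool
      guard p q = (X p ∧ X q) ∧ not (p == q)

      guard-sym : ∀ p q → guard p q ≡ guard q p
      guard-sym p q = cong₂ _∧_ (∧-comm (X p) (X q)) (cong not (==-sym p q))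

    chain : Fin n → Fin n → Bool
    chain p q = guard p q ∧ (H p q xor H q p)

    chain-symm : ∀ p q → chain p q ≡ chain q p
    chain-symm p q = cong₂ _∧_ (guard-sym p q) (xor-comm (H p q) (H q p))

    private
      H-Tor : ∀ p q → guard p q ≡ true → H p q ≡ true → Tor p q ≡ true
      H-Tor p q g h with H⁻ p q h
      ... | a , b , m , refl , refl with z⃗-image a b m
      ...   | outside Xp _ = ⊥-elim (true≢false (∧-fst {X (σ a)} (∧-fst {X (σ a) ∧ X (σ′ b)} g)) Xp)
      ...   | collapsed _ e = ⊥-elim (true≢false (≡⇒== e) (not-true (∧-snd {X (σ a) ∧ X (σ′ b)} g)))
      ...   | edge _ _ e = e

      H-over : ∀ p q → X p ≡ true → H p q ≡ true → φ p ≡ w ⊎ φ p ≡ w′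
      H-over p q Xp h with H⁻ p q h
      ... | a , b , m , refl , _ = retract-over w w′ a (==⇒≡ (φ a) w (∧-snd {C a} (∧-fst {C a ∧ (φ a == w)} m))) Xp

      H-over′ : ∀ p q → X q ≡ true → H p q ≡ true → φ q ≡ w′ ⊎ φ q ≡ w
      H-over′ p q Xq h with H⁻ p q h
      ... | a , b , m , _ , refl = retract-over w′ w b (==⇒≡ (φ b) w′ (∧-fst {φ b == w′} (∧-snd {C a ∧ (φ a == w)} m))) Xq

      xor-case : ∀ a {b} → a xor b ≡ true → a ≡ true ⊎ b ≡ true
      xor-case true _ = inj₁ refl
      xor-case false h = inj₂ h

    chain-Tor : ∀ p q → chain p q ≡ true → Tor p q ≡ true
    chain-Tor p q h = case xor-case (H p q) (∧-snd {guard p q} h) of λ where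
      (inj₁ m) → H-Tor p q (∧-fst {guard p q} h) m
      (inj₂ m) → Tor-sym q p (H-Tor q p (trans (guard-sym q p) (∧-fst {guard p q} h)) m)

    chain-over : ∀ p q → chain p q ≡ true → φ p ≡ w ⊎ φ p ≡ w′
    chain-over p q h = case xor-case (H p q) (∧-snd {guard p q} h) of λ where
        (inj₁ m) → H-over p q Xp m
        (inj₂ m) → [ inj₂ , inj₁ ]′ (H-over′ q p Xp m)
      where
      Xp = ∧-fst {X p} (∧-fst {X p ∧ X q} (∧-fst {guard p q} h))

    private
      -- Pushing forward commutes with the boundary. The right-hand side pushes the two end masses
      -- of `z⃗` forward along the two retractions.
      contract : ∀ p → ⨁ (λ q → chain p q) ≡ X p ∧ (⨁ (λ a → mass w a ∧ (σ a == p)) xor ⨁ (λ b → mass w′ b ∧ (σ′ b == p)))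
      contract p = begin
        ⨁ (λ q → guard p q ∧ (H p q xor H q p)) ≡⟨ trans (⨁-cong λ q → ∧-distribˡ-xor (guard p q) (H p q) (H q p)) (⨁-xor _ _) ⟩
        ⨁ (λ q → guard p q ∧ H p q) xor ⨁ (λ q → guard p q ∧ H q p) ≡⟨ cong₂ _xor_ spread-out spread-in ⟩
        ⨁ (λ a → ⨁ (λ b → z⃗ a b ∧ ((σ a == p) ∧ guard p (σ′ b)))) xor ⨁ (λ a → ⨁ (λ b → z⃗ a b ∧ ((σ′ b == p) ∧ guard p (σ a))))
          ≡⟨ sym (trans (⨁-cong λ a → ⨁-xor _ _) (⨁-xor _ _)) ⟩
        ⨁ (λ a → ⨁ (λ b → (z⃗ a b ∧ ((σ a == p) ∧ guard p (σ′ b))) xor (z⃗ a b ∧ ((σ′ b == p) ∧ guard p (σ a))))) ≡⟨ ⨁-cong (λ a → ⨁-cong λ b → ends a b) ⟩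
        ⨁ (λ a → ⨁ (λ b → (X p ∧ ((σ a == p) ∧ z⃗ a b)) xor (X p ∧ ((σ′ b == p) ∧ z⃗ a b)))) ≡⟨ trans (⨁-cong λ a → ⨁-xor _ _) (⨁-xor _ _) ⟩
        ⨁ (λ a → ⨁ (λ b → X p ∧ ((σ a == p) ∧ z⃗ a b))) xor ⨁ (λ a → ⨁ (λ b → X p ∧ ((σ′ b == p) ∧ z⃗ a b)))
          ≡⟨ cong₂ _xor_ (collect (λ a b → z⃗ a b) σ (mass w) out-mass) (trans (⨁-swap _) (collect (λ b a → z⃗ a b) σ′ (mass w′) in-mass)) ⟩
        (X p ∧ ⨁ (λ a → mass w a ∧ (σ a == p))) xor (X p ∧ ⨁ (λ b → mass w′ b ∧ (σ′ b == p))) ≡⟨ sym (∧-distribˡ-xor (X p) _ _) ⟩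
        X p ∧ (⨁ (λ a → mass w a ∧ (σ a == p)) xor ⨁ (λ b → mass w′ b ∧ (σ′ b == p))) ∎
        where
        spread : ∀ (g : Fin n → Fin n → Bool) (s : Fin n → Fin n → Fin n) →
          ⨁ (λ q → guard p q ∧ ⨁ (λ a → ⨁ (λ b → g a b ∧ (s a b == q)))) ≡ ⨁ (λ a → ⨁ (λ b → g a b ∧ guard p (s a b)))
        spread g s = begin
          ⨁ (λ q → guard p q ∧ ⨁ (λ a → ⨁ (λ b → g a b ∧ (s a b == q)))) ≡⟨ ⨁-cong (λ q → trans (⨁-∧ˡ (guard p q) _) (⨁-cong λ a → ⨁-∧ˡ (guard p q) _)) ⟩
          ⨁ (λ q → ⨁ (λ a → ⨁ (λ b → guard p q ∧ (g a b ∧ (s a b == q))))) ≡⟨ trans (⨁-swap _) (⨁-cong λ a → ⨁-swap _) ⟩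
          ⨁ (λ a → ⨁ (λ b → ⨁ (λ q → guard p q ∧ (g a b ∧ (s a b == q)))))
            ≡⟨ ⨁-cong (λ a → ⨁-cong λ b → trans (⨁-cong λ q → solve 3 (λ x y t → x :* (y :* t) := t :* (y :* x)) refl (guard p q) (g a b) (s a b == q)) (⨁-δ′ (s a b) _)) ⟩
          ⨁ (λ a → ⨁ (λ b → g a b ∧ guard p (s a b))) ∎
        spread-out : ⨁ (λ q → guard p q ∧ H p q) ≡ ⨁ (λ a → ⨁ (λ b → z⃗ a b ∧ ((σ a == p) ∧ guard p (σ′ b))))
        spread-out = trans (⨁-cong λ q → cong (guard p q ∧_) (⨁-cong λ a → ⨁-cong λ b → sym (∧-assoc (z⃗ a b) (σ a == p) (σ′ b == q))))
          (trans (spread (λ a b → z⃗ a b ∧ (σ a == p)) (λ a b → σ′ b)) (⨁-cong λ a → ⨁-cong λ b → ∧-assoc (z⃗ a b) (σ a == p) _))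
        spread-in : ⨁ (λ q → guard p q ∧ H q p) ≡ ⨁ (λ a → ⨁ (λ b → z⃗ a b ∧ ((σ′ b == p) ∧ guard p (σ a))))
        spread-in = trans (⨁-cong λ q → cong (guard p q ∧_) (⨁-cong λ a → ⨁-cong λ b → solve 3 (λ x y t → x :* (y :* t) := (x :* t) :* y) refl (z⃗ a b) (σ a == q) (σ′ b == p)))
          (trans (spread (λ a b → z⃗ a b ∧ (σ′ b == p)) (λ a b → σ a)) (⨁-cong λ a → ⨁-cong λ b → ∧-assoc (z⃗ a b) (σ′ b == p) _))
        collect : ∀ (g : Fin n → Fin n → Bool) (s : Fin n → Fin n) (m : Fin n → Bool) → (∀ a → ⨁ (g a) ≡ m a) →
          ⨁ (λ a → ⨁ (λ b → X p ∧ ((s a == p) ∧ g a b))) ≡ X p ∧ ⨁ (λ a → m a ∧ (s a == p))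
        collect g s m e = trans (⨁-cong λ a → trans (sym (⨁-∧ˡ (X p) _)) (cong (X p ∧_) (trans (sym (⨁-∧ˡ (s a == p) (g a))) (trans (∧-comm (s a == p) _) (cong (_∧ (s a == p)) (e a))))))
          (sym (⨁-∧ˡ (X p) _))
        -- The ends of an edge land both in X or both outside. A collapsed edge meets `p` at both
        -- ends or at none and cancels.
        ends : ∀ a b → (z⃗ a b ∧ ((σ a == p) ∧ guard p (σ′ b))) xor (z⃗ a b ∧ ((σ′ b == p) ∧ guard p (σ a))) ≡ (X p ∧ ((σ a == p) ∧ z⃗ a b)) xor (X p ∧ ((σ′ b == p) ∧ z⃗ a b))
        ends a b = trans (sym (∧-distribˡ-xor (z⃗ a b) _ _)) (trans (∧-congʳ-if {z⃗ a b} λ h → both (image-X (z⃗-image a b h)))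
            (solve 4 (λ t x s s′ → t :* ((x :* s) :+ (x :* s′)) := (x :* (s :* t)) :+ (x :* (s′ :* t))) refl (z⃗ a b) (X p) (σ a == p) (σ′ b == p)))
          where
          both : X (σ a) ≡ X (σ′ b) → ((σ a == p) ∧ guard p (σ′ b)) xor ((σ′ b == p) ∧ guard p (σ a)) ≡ (X p ∧ (σ a == p)) xor (X p ∧ (σ′ b == p))
          both e rewrite ==-sym p (σ a) | ==-sym p (σ′ b) = go (X (σ a)) (X (σ′ b)) (X p) (σ a == p) (σ′ b == p) e
              (λ h → cong X (==⇒≡ (σ a) p h)) (λ h → cong X (==⇒≡ (σ′ b) p h))
            where
            go : ∀ xa xb x s s′ → xa ≡ xb → (s ≡ true → xa ≡ x) → (s′ ≡ true → xb ≡ x) →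
              (s ∧ ((x ∧ xb) ∧ not s′)) xor (s′ ∧ ((x ∧ xa) ∧ not s)) ≡ (x ∧ s) xor (x ∧ s′)
            go true _ true true true refl _ _ = refl
            go true _ true true false refl _ _ = refl
            go true _ true false true refl _ _ = refl
            go true _ true false false refl _ _ = refl
            go _ _ false true true _ _ _ = refl
            go _ _ false true false _ _ _ = refl
            go _ _ false false true _ _ _ = refl
            go _ _ false false false _ _ _ = refl
            go false _ true true _ refl h _ = ⊥-elim (true≢false (h refl) refl)
            go false _ true false true refl _ h = ⊥-elim (true≢false (h refl) refl)
            go false _ true false false refl _ _ = refl

    -- Replacing the retractions by `toFibre` frees each end from the other endpoint of the edge of
    -- Γ. Only then do the edge chains fit together to one chain map.
    chain-∂ : ∀ p → ⨁ (chain p) ≡ vertexChain w p xor vertexChain w′ p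
    chain-∂ p = trans (contract p) (trans (∧-distribˡ-xor (X p) _ _) (cong₂ _xor_ (retract≈toFibre w w′ p) (retract≈toFibre w′ w p)))

-- Blocks surviving in one bag and their disjoint almost embeddings

module Obstruction {n N k r t : ℕ} (K : Graph n) (Γ : Graph N) (target : Target k r Γ) (U : Fin N)
    (φ : Fin n → Fin N) (cert : Certificate K Γ U φ) {β : Fin t → Mask n}
    (loc : Parity.Localised K Γ target U φ cert β)
    (S : Mask n) (S-small : cnt S ≤ k) where
  open Parity K Γ target U φ cert
  open Localised loc
  open Push K Γ target U φ cert loc

  X′ : Mask n
  X′ v = X v ∧ not (S v)

  private
    clear : Fin r → Fin 5 → Bool
    clear b i = not (hits Sep (block b i) ∨ hits S (block b i))

    good : Mask r
    good b = allF 5 (clear b)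

    good-Sep : ∀ b → good b ≡ true → ∀ i → hits Sep (block b i) ≡ false
    good-Sep b g i = ¬true⇒false λ h → true≢false (∨-injˡ {hits Sep (block b i)} {hits S (block b i)} h) (not-true (allF⁻ (clear b) g i))

    good-S : ∀ b → good b ≡ true → ∀ i → hits S (block b i) ≡ false
    good-S b g i = ¬true⇒false λ h → true≢false (∨-injʳ {hits Sep (block b i)} h) (not-true (allF⁻ (clear b) g i))

    bad⁻ : ∀ b → not (good b) ≡ true → ∃ λ a → Sep a ∨ S a ≡ true × ∃ λ i → φ a ≡ block b i
    bad⁻ b g with search (λ i → hits Sep (block b i) ∨ hits S (block b i))
    ... | inj₂ none = ⊥-elim (true≢false (allF⁺ (clear b) λ i → cong not (none i)) (not-true g))
    ... | inj₁ (i , h) with ∨-case {hits Sep (block b i)} h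
    ...   | inj₁ q = let (a , m) = anyF⁻ (λ a → Sep a ∧ (φ a == block b i)) q in a , ∨-injˡ (∧-fst {Sep a} m) , i , ==⇒≡ (φ a) (block b i) (∧-snd {Sep a} m)
    ...   | inj₂ q = let (a , m) = anyF⁻ (λ a → S a ∧ (φ a == block b i)) q in a , ∨-injʳ {Sep a} (∧-fst {S a} m) , i , ==⇒≡ (φ a) (block b i) (∧-snd {S a} m)

    -- A vertex of K lies over at most one block, so each vertex of the separator or of the apex set
    -- spoils at most one.
    few-bad : cnt (λ b → not (good b)) ≤ k + k
    few-bad = ℕ.≤-trans (cnt-≤ _ (λ a → Sep a ∨ S a) (λ b g → proj₁ (bad⁻ b g)) (λ b g → proj₁ (proj₂ (bad⁻ b g)))
        (λ b g b′ g′ e → proj₁ (block-injective (trans (sym (proj₂ (proj₂ (proj₂ (bad⁻ b g))))) (trans (cong φ e) (proj₂ (proj₂ (proj₂ (bad⁻ b′ g′)))))))))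
      (ℕ.≤-trans (cnt-∨ Sep S) (ℕ.+-mono-≤ Sep-small S-small))

    many-good : r ≤ cnt good + (k + k)
    many-good = ℕ.≤-trans (ℕ.≤-reflexive (sym (cnt-not good))) (ℕ.+-monoʳ-≤ (cnt good) few-bad)

    E-sym : ∀ u v → adjM Tor X′ u v ≡ adjM Tor X′ v u
    E-sym u v = trans (cong (λ t → X′ u ∧ (X′ v ∧ t)) (iff⇒≡ (Tor-sym u v) (Tor-sym v u)))
      (solve 3 (λ p q r → p :* (q :* r) := q :* (p :* r)) refl (X′ u) (X′ v) (Tor v u))

    E-irrefl : ∀ u → adjM Tor X′ u u ≡ false
    E-irrefl u = ¬true⇒false λ h → true≢false (∧-fst {not (u == u)} (∧-snd {X u} (∧-snd {X u} (∧-snd {X′ u} (∧-snd {X′ u} h))))) (cong not (==-refl u))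

  module _ (R : RotSystem Tor X′) where
    private
      open Form R E-sym E-irrefl using (IsChain; B; Chain; ∂; B-disjoint)
      open Kuratowski R E-sym E-irrefl

      over : Fin r → Fin n → Fin 5 → Bool
      over b a i = φ a == block b i

      almostK₅ : ∀ b → good b ≡ true → AlmostK₅ (over b)
      almostK₅ b g = record
        { over-unique = λ {a} {i} {j} p q → proj₂ (block-injective (trans (sym (==⇒≡ (φ a) (block b i) p)) (==⇒≡ (φ a) (block b j) q)))
        ; vertex = λ i → vertexChain (block b i)
        ; edge = λ i j → e i j (i ≟ j)
        ; vertex-over = λ i a h → ≡⇒== (vertexChain-over (block b i) a h)
        ; edge-chain = λ i j i≢j → e-chain i j i≢j (i ≟ j)
        ; edge-over = λ i j a u → e-over i j a u (i ≟ j)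
        ; edge-∂ = λ i j i≢j a → e-∂ i j i≢j a (i ≟ j)
        ; vertex-odd = vertexChain-odd (block b zero) (good-Sep b g zero) }
        where
        module EC {i j} (i≢j : i ≢ j) = EdgeChain (block b i) (block b j) (block-adj b i≢j) (good-Sep b g i) (good-Sep b g j)
        -- Edge chains exist only for distinct i and j. The decision is an argument so that each
        -- property can be proved by matching on it; the diagonal gets the zero chain.
        e : ∀ i j → Dec (i ≡ j) → Chain
        e i j (yes _) = λ _ _ → false
        e i j (no i≢j) = EC.chain i≢j
        e-over : ∀ i j a u d → e i j d a u ≡ true → over b a i ∨ over b a j ≡ true
        e-over i j a u (no i≢j) h = [ (λ q → ∨-injˡ (≡⇒== q)) , (λ q → ∨-injʳ {over b a i} (≡⇒== q)) ]′ (EC.chain-over i≢j a u h)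
        e-∂ : ∀ i j → i ≢ j → ∀ a d → ∂ (e i j d) a ≡ vertexChain (block b i) a xor vertexChain (block b j) a
        e-∂ i j i≢j a (yes q) = ⊥-elim (i≢j q)
        e-∂ i j i≢j a (no ne) = EC.chain-∂ ne a
        avoids : ∀ i a → hits S (block b i) ≡ false → φ a ≡ block b i → S a ≡ false
        avoids i a h q = ¬true⇒false λ Sa → true≢false (hits⁺ S (block b i) a Sa q) h
        e-chain : ∀ i j → i ≢ j → ∀ d → IsChain (e i j d)
        e-chain i j i≢j (yes q) = ⊥-elim (i≢j q)
        e-chain i j i≢j (no ne) = record { symm = EC.chain-symm ne ; supp = supported }
          where
          -- The chain lies over a good block, whose fibres contain no apex, so it survives the
          -- deletion of `S`.
          in-X′ : ∀ u v → EC.chain ne u v ≡ true → X u ≡ true → X′ u ≡ true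
          in-X′ u v h Xu = ∧-true Xu (cong not ([ avoids i u (good-S b g i) , avoids j u (good-S b g j) ]′ (EC.chain-over ne u v h)))
          supported : ∀ u v → EC.chain ne u v ≡ true → adjM Tor X′ u v ≡ true
          supported u v h = let q = EC.chain-Tor ne u v h in
            ∧-true (in-X′ u v h (∧-fst {X u} q)) (∧-true (in-X′ v u (trans (EC.chain-symm ne v u) h) (∧-fst {X v} (∧-snd {X u} q))) q)

      cycles : ∀ b → good b ≡ true → DualCycles (over b)
      cycles b g = dualCycles (almostK₅ b g)

      Z Z′ : ∀ b → good b ≡ true ⊎ good b ≡ false → Chain
      Z b (inj₁ g) = DualCycles.Z (cycles b g)
      Z b (inj₂ _) = λ _ _ → false
      Z′ b (inj₁ g) = DualCycles.Z′ (cycles b g)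
      Z′ b (inj₂ _) = λ _ _ → false

      Z-chain : ∀ b d → good b ≡ true → IsChain (Z b d)
      Z-chain b (inj₁ g) _ = DualCycles.Z-chain (cycles b g)
      Z-chain b (inj₂ q) g = ⊥-elim (true≢false g q)

      Z′-chain : ∀ b d → good b ≡ true → IsChain (Z′ b d)
      Z′-chain b (inj₁ g) _ = DualCycles.Z′-chain (cycles b g)
      Z′-chain b (inj₂ q) g = ⊥-elim (true≢false g q)

      Z-∂ : ∀ b d → good b ≡ true → ∀ a → ∂ (Z b d) a ≡ false
      Z-∂ b (inj₁ g) _ = DualCycles.Z-∂ (cycles b g)
      Z-∂ b (inj₂ q) g = ⊥-elim (true≢false g q)

      Z′-∂ : ∀ b d → good b ≡ true → ∀ a → ∂ (Z′ b d) a ≡ false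
      Z′-∂ b (inj₁ g) _ = DualCycles.Z′-∂ (cycles b g)
      Z′-∂ b (inj₂ q) g = ⊥-elim (true≢false g q)

      Z-crossing : ∀ b d → good b ≡ true → B (Z b d) (Z′ b d) ≡ true
      Z-crossing b (inj₁ g) _ = DualCycles.crossing (cycles b g)
      Z-crossing b (inj₂ q) g = ⊥-elim (true≢false g q)

      Z-disjoint : ∀ b b′ d d′ → good b ≡ true → good b′ ≡ true → b ≢ b′ → B (Z b d) (Z′ b′ d′) ≡ false
      Z-disjoint b b′ (inj₂ q) _ g _ _ = ⊥-elim (true≢false g q)
      Z-disjoint b b′ (inj₁ _) (inj₂ q) _ g _ = ⊥-elim (true≢false g q)
      Z-disjoint b b′ (inj₁ g) (inj₁ g′) _ _ ne = B-disjoint (DualCycles.Z (cycles b g)) (DualCycles.Z′ (cycles b′ g′)) λ a u w → ¬true⇒false λ h →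
        let (i , p) = DualCycles.Z-over (cycles b g) a u (∧-fst {DualCycles.Z (cycles b g) a u} h)
            (j , q) = DualCycles.Z′-over (cycles b′ g′) a w (∧-snd {DualCycles.Z (cycles b g) a u} h)
        in ne (proj₁ (block-injective (trans (sym (==⇒≡ (φ a) (block b i) p)) (==⇒≡ (φ a) (block b′ j) q))))

      dec : ∀ b → good b ≡ true ⊎ good b ≡ false
      dec b = true-or-false (good b)

      dual : ∀ b b′ → good b ≡ true → good b′ ≡ true → B (Z b (dec b)) (Z′ b′ (dec b′)) ≡ (b == b′)
      dual b b′ g g′ = case b ≟ b′ of λ where
        (yes refl) → trans (Z-crossing b (dec b) g) (sym (==-refl b))
        (no ne) → trans (Z-disjoint b b′ (dec b) (dec b′) g g′ ne) (sym (≢⇒==false ne))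

    blocks-bound : 2 * numComps Tor X′ + numEdges Tor X′ ≤ k + numVerts X′ + numFaces R → r ≤ k + (k + k)
    blocks-bound h = ℕ.≤-trans many-good (ℕ.+-monoˡ-≤ (k + k) (GenusBound.genus-bound R E-sym E-irrefl good (λ b → Z b (dec b)) (λ b → Z′ b (dec b))
      (λ b → Z-chain b (dec b)) (λ b → Z-∂ b (dec b)) (λ b → Z′-chain b (dec b)) (λ b → Z′-∂ b (dec b)) dual k h))

-- At most 2k blocks are spoiled and at most k can survive in genus k, which accounts for 3k blocks,
-- one fewer than there are.
ℋ⇒¬certificate : ∀ {n N k} (K : Graph n) (Γ : Graph N) → Target k (suc (k + (k + k))) Γ → (U : Fin N) (φ : Fin n → Fin N) → ℋ k K → ¬ Certificate K Γ U φ
ℋ⇒¬certificate {n} {k = k} K Γ target U φ (D , adhesion , torsos) cert = go TD.t TD.T TD.isTree TD.β TD.coverV TD.coverE TD.subtree adhesion torsos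
  where
  module TD = TreeDecomposition D
  go : ∀ t (T : Adj t) → IsTree T → (β : Fin t → Mask n) → (∀ v → ∃ λ x → β x v ≡ true) →
    (∀ u v → adj K u v ≡ true → ∃ λ x → β x u ∧ β x v ≡ true) →
    (∀ v x y → β x v ≡ true → β y v ≡ true → reach (adjM T (λ z → β z v)) x y ≡ true) →
    (∀ x y → T x y ≡ true → countF n (λ v → β x v ∧ β y v) ≤ k) →
    (∀ x → InC k k (torso (adj K) (β x)) (β x)) → ⊥
  go zero T tree β cV cE sub adh tor = case IsTree.nonempty tree of λ ()
  go (suc s) T tree β cV cE sub adh tor =
    let loc = Parity.Descent.localise K Γ target U φ cert T tree β cV cE sub adh
        (S , _ , S-small , R , euler) = tor (Parity.Localised.node loc)
    in ℕ.<-irrefl refl (Obstruction.blocks-bound K Γ target U φ cert loc S (subst (_≤ k) (countF≡cnt n S) S-small) R euler)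

-- K₅ in the projective plane

all-upTo-false : ∀ (p : ℕ → Bool) m → all p (upTo m) ≡ false → ∃ λ i → p i ≡ false
all-upTo-false p m = go id m
  where
  go : ∀ (g : ℕ → ℕ) m → all p (applyUpTo g m) ≡ false → ∃ λ i → p i ≡ false
  go g (suc m) h with true-or-false (p (g 0))
  ... | inj₁ q = go (g ∘ suc) m (trans (cong (_∧ all p (applyUpTo (g ∘ suc) m)) (sym q)) h)
  ... | inj₂ q = g 0 , q

private
  next prev : Fin 5 → Fin 5
  next zero = suc zero
  next (suc zero) = suc (suc zero)
  next (suc (suc zero)) = suc (suc (suc zero))
  next (suc (suc (suc zero))) = suc (suc (suc (suc zero)))
  next (suc (suc (suc (suc zero)))) = zero
  prev zero = suc (suc (suc (suc zero)))
  prev (suc zero) = zero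
  prev (suc (suc zero)) = suc zero
  prev (suc (suc (suc zero))) = suc (suc zero)
  prev (suc (suc (suc (suc zero)))) = suc (suc (suc zero))

  -- K₅ in the projective plane: every rotation is the cyclic order of ℤ/5, and the edges
  -- of the pentagon i ↦ i + 1 are twisted. This has 6 faces.
  ρ₅ ρ₅' : Fin 5 → Fin 5 → Fin 5
  ρ₅ i j = if next j == i then next (next j) else next j
  ρ₅' i j = if prev j == i then prev (prev j) else prev j

  sig₅ : Fin 5 → Fin 5 → Bool
  sig₅ i j = (j == next i) ∨ (i == next j)

  trace₅ : State 5 → State 5
  trace₅ (i , j , s) = j , (if s xor sig₅ i j then ρ₅ j i else ρ₅' j i) , s xor sig₅ i j

  _=₅_ : State 5 → State 5 → Bool
  (i , j , s) =₅ (i′ , j′ , s′) = ((i == i′) ∧ (j == j′)) ∧ not (s xor s′)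

  -- One state on each of the 12 = 2 · 6 directed face traversals.
  orbitRep : Fin 12 → State 5
  orbitRep zero = zero , suc zero , true
  orbitRep (suc zero) = zero , suc zero , false
  orbitRep (suc (suc zero)) = zero , suc (suc zero) , true
  orbitRep (suc (suc (suc zero))) = zero , suc (suc zero) , false
  orbitRep (suc (suc (suc (suc zero)))) = zero , suc (suc (suc zero)) , true
  orbitRep (suc (suc (suc (suc (suc zero))))) = zero , suc (suc (suc zero)) , false
  orbitRep (suc (suc (suc (suc (suc (suc zero)))))) = zero , suc (suc (suc (suc zero))) , true
  orbitRep (suc (suc (suc (suc (suc (suc (suc zero))))))) = zero , suc (suc (suc (suc zero))) , false
  orbitRep (suc (suc (suc (suc (suc (suc (suc (suc zero)))))))) = suc zero , suc (suc zero) , false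
  orbitRep (suc (suc (suc (suc (suc (suc (suc (suc (suc zero))))))))) = suc zero , suc (suc (suc zero)) , true
  orbitRep (suc (suc (suc (suc (suc (suc (suc (suc (suc (suc zero)))))))))) = suc (suc zero) , suc (suc (suc zero)) , false
  orbitRep (suc (suc (suc (suc (suc (suc (suc (suc (suc (suc (suc zero))))))))))) = suc (suc zero) , suc (suc (suc (suc zero))) , true

  -- The faces are the five triangles i, i + 1, i + 2 modulo 5 and the pentagon 0, 2, 4, 1, 3, so
  -- five iterates exhaust any traversal.
  face₅ : State 5 → Fin 12
  face₅ x = firstOr zero (λ f → anyF 5 (λ m → iter trace₅ (toℕ m) (orbitRep f) =₅ x)) id

  -- Turns a property of pairs of distinct indices into a closed Boolean, which `refl` verifies by
  -- evaluation.
  all₅ : (Fin 5 → Fin 5 → Bool) → Bool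
  all₅ p = allF 5 (λ i → allF 5 (λ j → (i == j) ∨ p i j))

  all₅⁻ : ∀ p → all₅ p ≡ true → ∀ i j → i ≢ j → p i j ≡ true
  all₅⁻ p h i j ne = case ∨-case {i == j} (allF⁻ (λ j → (i == j) ∨ p i j) (allF⁻ (λ i → allF 5 (λ j → (i == j) ∨ p i j)) h i) j) of λ where
    (inj₁ e) → ⊥-elim (ne (==⇒≡ i j e))
    (inj₂ q) → q

  ρ₅-closed : ∀ i j → i ≢ j → i ≢ ρ₅ i j
  ρ₅-closed i j ne e = true≢false (≡⇒== e) (not-true (all₅⁻ (λ i j → not (i == ρ₅ i j)) refl i j ne))

  ρ₅'-closed : ∀ i j → i ≢ j → i ≢ ρ₅' i j
  ρ₅'-closed i j ne e = true≢false (≡⇒== e) (not-true (all₅⁻ (λ i j → not (i == ρ₅' i j)) refl i j ne))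

  ρ₅ρ₅' : ∀ i j → i ≢ j → ρ₅ i (ρ₅' i j) ≡ j
  ρ₅ρ₅' i j ne = ==⇒≡ _ j (all₅⁻ (λ i j → ρ₅ i (ρ₅' i j) == j) refl i j ne)

  ρ₅'ρ₅ : ∀ i j → i ≢ j → ρ₅' i (ρ₅ i j) ≡ j
  ρ₅'ρ₅ i j ne = ==⇒≡ _ j (all₅⁻ (λ i j → ρ₅' i (ρ₅ i j) == j) refl i j ne)

  ρ₅-cyclic : ∀ i j l → i ≢ j → i ≢ l → ∃ λ m → iter (ρ₅ i) m j ≡ l
  ρ₅-cyclic i j l ij il =
    let p = λ i j → allF 5 (λ l → (i == l) ∨ anyF 4 (λ m → iter (ρ₅ i) (toℕ m) j == l))
        q = allF⁻ (λ l → (i == l) ∨ anyF 4 (λ m → iter (ρ₅ i) (toℕ m) j == l)) (all₅⁻ p refl i j ij) l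
    in case ∨-case {i == l} q of λ where
         (inj₁ e) → ⊥-elim (il (==⇒≡ i l e))
         (inj₂ h) → let (m , e) = anyF⁻ {4} (λ m → iter (ρ₅ i) (toℕ m) j == l) h in toℕ m , ==⇒≡ (iter (ρ₅ i) (toℕ m) j) l e

  sig₅-sym : ∀ i j → sig₅ i j ≡ sig₅ j i
  sig₅-sym i j = ∨-comm (j == next i) (i == next j)

  face₅-trace : ∀ i j s → i ≢ j → face₅ (i , j , s) ≡ face₅ (trace₅ (i , j , s))
  face₅-trace i j true ne = ==⇒≡ _ _ (all₅⁻ (λ i j → face₅ (i , j , true) == face₅ (trace₅ (i , j , true))) refl i j ne)
  face₅-trace i j false ne = ==⇒≡ _ _ (all₅⁻ (λ i j → face₅ (i , j , false) == face₅ (trace₅ (i , j , false))) refl i j ne)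

  face₅-rep : ∀ f → face₅ (orbitRep f) ≡ f
  face₅-rep f = ==⇒≡ _ f (allF⁻ (λ f → face₅ (orbitRep f) == f) refl f)

  orbitRep-valid : ∀ f → proj₁ (orbitRep f) ≢ proj₁ (proj₂ (orbitRep f))
  orbitRep-valid f e = true≢false (≡⇒== e) (not-true (allF⁻ (λ f → not (proj₁ (orbitRep f) == proj₁ (proj₂ (orbitRep f)))) refl f))

module ProjectiveK₅ {n : ℕ} (A : Adj n) (X : Mask n) (ι : Fin 5 → Fin n) (idx : Fin n → Fin 5)
    (ι-X : ∀ i → X (ι i) ≡ true) (ι-idx : ∀ v → X v ≡ true → ι (idx v) ≡ v) (idx-ι : ∀ i → idx (ι i) ≡ i)
    (complete : ∀ u v → adjM A X u v ≡ X u ∧ (X v ∧ not (u == v))) where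

  private
    E : Adj n
    E = adjM A X

    E⇒Xˡ : ∀ {u v} → E u v ≡ true → X u ≡ true
    E⇒Xˡ {u} e = ∧-fst {X u} e

    E⇒Xʳ : ∀ {u v} → E u v ≡ true → X v ≡ true
    E⇒Xʳ {u} {v} e = ∧-fst {X v} (∧-snd {X u} e)

    E⇒≢ : ∀ {u v} → E u v ≡ true → u ≢ v
    E⇒≢ {u} {v} e q = true≢false (≡⇒== q) (not-true (∧-snd {X v} (∧-snd {X u} (trans (sym (complete u v)) e))))

    E⇒idx≢ : ∀ {u v} → E u v ≡ true → idx u ≢ idx v
    E⇒idx≢ {u} {v} e q = E⇒≢ e (trans (sym (ι-idx u (E⇒Xˡ e))) (trans (cong ι q) (ι-idx v (E⇒Xʳ e))))

    E⁺ : ∀ {u v} → X u ≡ true → X v ≡ true → u ≢ v → E u v ≡ true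
    E⁺ {u} {v} Xu Xv ne = trans (complete u v) (∧-true Xu (∧-true Xv (cong not (≢⇒==false ne))))

    ι-E : ∀ {v j} → X v ≡ true → idx v ≢ j → E v (ι j) ≡ true
    ι-E {v} {j} Xv ne = E⁺ Xv (ι-X j) λ q → ne (trans (cong idx q) (idx-ι j))

    E-sym : ∀ u v → E u v ≡ E v u
    E-sym u v = iff⇒≡ (λ e → E⁺ (E⇒Xʳ e) (E⇒Xˡ e) (E⇒≢ e ∘ sym)) (λ e → E⁺ (E⇒Xʳ e) (E⇒Xˡ e) (E⇒≢ e ∘ sym))

    E-irrefl : ∀ u → E u u ≡ false
    E-irrefl u = ¬true⇒false λ e → E⇒≢ e refl

    iter-ι : ∀ v u m → X u ≡ true → iter (λ u → ι (ρ₅ (idx v) (idx u))) m u ≡ ι (iter (ρ₅ (idx v)) m (idx u))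
    iter-ι v u zero Xu = sym (ι-idx u Xu)
    iter-ι v u (suc m) Xu = cong (λ t → ι (ρ₅ (idx v) t)) (trans (cong idx (iter-ι v u m Xu)) (idx-ι _))

  rotation : RotSystem A X
  rotation = record
    { ρ = λ v u → ι (ρ₅ (idx v) (idx u))
    ; ρ' = λ v u → ι (ρ₅' (idx v) (idx u))
    ; sig = λ u v → sig₅ (idx u) (idx v)
    ; ρ-closed = λ v u e → ι-E (E⇒Xˡ e) (ρ₅-closed (idx v) (idx u) (E⇒idx≢ e))
    ; ρ'-closed = λ v u e → ι-E (E⇒Xˡ e) (ρ₅'-closed (idx v) (idx u) (E⇒idx≢ e))
    ; ρρ' = λ v u e → trans (cong (λ t → ι (ρ₅ (idx v) t)) (idx-ι _)) (trans (cong ι (ρ₅ρ₅' (idx v) (idx u) (E⇒idx≢ e))) (ι-idx u (E⇒Xʳ e)))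
    ; ρ'ρ = λ v u e → trans (cong (λ t → ι (ρ₅' (idx v) t)) (idx-ι _)) (trans (cong ι (ρ₅'ρ₅ (idx v) (idx u) (E⇒idx≢ e))) (ι-idx u (E⇒Xʳ e)))
    ; cyclic = λ v u w eu ew → let (m , q) = ρ₅-cyclic (idx v) (idx u) (idx w) (E⇒idx≢ eu) (E⇒idx≢ ew) in
        m , trans (iter-ι v u m (E⇒Xʳ eu)) (trans (cong ι q) (ι-idx w (E⇒Xʳ ew)))
    ; sig-sym = λ u v → sig₅-sym (idx u) (idx v) }

  open Faces rotation E-sym E-irrefl

  private
    face : State n → Fin 12
    face (u , v , s) = face₅ (idx u , idx v , s)

    face-trace : ∀ x → Valid x → face (trace rotation x) ≡ face x
    face-trace (u , v , s) e = sym (trans (face₅-trace (idx u) (idx v) s (E⇒idx≢ e)) (cong (λ t → face₅ (idx v , t , s xor sig₅ (idx u) (idx v))) (sym (turn (s xor sig₅ (idx u) (idx v))))))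
      where
      turn : ∀ b → idx (if b then ι (ρ₅ (idx v) (idx u)) else ι (ρ₅' (idx v) (idx u))) ≡ (if b then ρ₅ (idx v) (idx u) else ρ₅' (idx v) (idx u))
      turn true = idx-ι _
      turn false = idx-ι _

    face-iter : ∀ i x → Valid x → face (iter (trace rotation) i x) ≡ face x
    face-iter zero x v = refl
    face-iter (suc i) x v = trans (face-trace (iter (trace rotation) i x) (iter-valid i x v)) (face-iter i x v)

    start₅ : Fin 12 → State n
    start₅ f = let (i , j , s) = orbitRep f in ι i , ι j , s

    start₅-valid : ∀ f → Valid (start₅ f)
    start₅-valid f = ι-E (ι-X _) λ q → orbitRep-valid f (trans (sym (idx-ι _)) q)

    start₅-face : ∀ f → face (start₅ f) ≡ f
    start₅-face f = trans (cong₂ (λ i j → face₅ (i , j , proj₂ (proj₂ (orbitRep f)))) (idx-ι _) (idx-ι _)) (face₅-rep f)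

    Minimal : State n → Set
    Minimal x = ∃ λ i → isRep rotation (iter (trace rotation) i x) ≡ true

    -- Well-founded descent on codes: a state failing `isRep` has an iterate of smaller code.
    minimal : ∀ c x → code rotation x ≡ c → Minimal x
    minimal = <-rec (λ c → ∀ x → code rotation x ≡ c → Minimal x) λ c rec x e → case true-or-false (isRep rotation x) of λ where
      (inj₁ h) → 0 , h
      (inj₂ h) → let (i , q) = all-upTo-false (λ i → code rotation x ≤ᵇ code rotation (iter (trace rotation) i x)) (suc (2 * n * n)) h
                     smaller = subst (code rotation (iter (trace rotation) i x) <_) e (ℕ.≰⇒> λ le → true≢false (T⇒≡ (ℕ.≤⇒≤ᵇ le)) q)
                     (j , m) = rec smaller (iter (trace rotation) i x) refl
                 in j + i , subst (λ y → isRep rotation y ≡ true) (sym (iter-+ (trace rotation) j i x)) m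

    least-state : Fin 12 → State n
    least-state f = iter (trace rotation) (proj₁ (minimal _ (start₅ f) refl)) (start₅ f)

    least-valid : ∀ f → Valid (least-state f)
    least-valid f = iter-valid (proj₁ (minimal _ (start₅ f) refl)) (start₅ f) (start₅-valid f)

    least-face : ∀ f → face (least-state f) ≡ f
    least-face f = trans (face-iter (proj₁ (minimal _ (start₅ f) refl)) (start₅ f) (start₅-valid f)) (start₅-face f)

    -- The label `face` is invariant under `trace`, so the twelve model states lead to twelve
    -- different least states, whatever the numbering of the vertices.
    twelve-orbits : 12 ≤ numOrbits rotation
    twelve-orbits = ℕ.≤-trans (ℕ.≤-reflexive (sym (cnt-true 12))) (ℕ.≤-trans
      (cnt-≤ (λ _ → true) isOrbitRep (λ f _ → enc (least-state f))
        (λ f _ → subst (λ x → E (proj₁ x) (proj₁ (proj₂ x)) ∧ isRep rotation x ≡ true) (sym (dec-enc (least-state f))) (∧-true (least-valid f) (proj₂ (minimal _ (start₅ f) refl))))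
        (λ f _ f′ _ e → trans (sym (least-face f)) (trans (cong face (trans (sym (dec-enc (least-state f))) (trans (cong dec e) (dec-enc (least-state f′))))) (least-face f′))))
      (ℕ.≤-reflexive (sym numOrbits≡)))

    one-component : numComps A X ≤ 1
    one-component = ℕ.≤-trans (ℕ.≤-reflexive (countF≡cnt n _)) (ℕ.≤-trans
      (cnt-≤ {n = 1} (λ v → X v ∧ allF n (λ u → not (X u ∧ reach E u v) ∨ (toℕ v ≤ᵇ toℕ u))) (λ _ → true) (λ _ _ → zero) (λ _ _ → refl)
        λ u hu v hv _ → Fin.toℕ-injective (ℕ.≤-antisym (lowest u v hu (∧-fst {X v} hv)) (lowest v u hv (∧-fst {X u} hu))))
      (ℕ.≤-reflexive (cnt-true 1)))
      where
      connected : ∀ u v → X u ≡ true → X v ≡ true → reach E u v ≡ true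
      connected u v Xu Xv with u ≟ v
      ... | yes refl = reach-refl E u
      ... | no ne = reach-edge E (E⁺ Xu Xv ne)
      lowest : ∀ u v → X u ∧ allF n (λ w → not (X w ∧ reach E w u) ∨ (toℕ u ≤ᵇ toℕ w)) ≡ true → X v ≡ true → toℕ u ≤ toℕ v
      lowest u v h Xv = case ∨-case {not (X v ∧ reach E v u)} (allF⁻ (λ w → not (X w ∧ reach E w u) ∨ (toℕ u ≤ᵇ toℕ w)) (∧-snd {X u} h) v) of λ where
        (inj₁ q) → ⊥-elim (true≢false (∧-true Xv (connected v u Xv (∧-fst {X u} h))) (not-true q))
        (inj₂ q) → ℕ.≤ᵇ⇒≤ _ _ (subst T (sym q) _)

    five-vertices : 5 ≤ numVerts X
    five-vertices = ℕ.≤-trans (ℕ.≤-reflexive (sym (cnt-true 5))) (ℕ.≤-trans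
      (cnt-≤ (λ _ → true) X (λ i _ → ι i) (λ i _ → ι-X i) (λ i _ j _ e → trans (sym (idx-ι i)) (trans (cong idx e) (idx-ι j))))
      (ℕ.≤-reflexive (sym (countF≡cnt n X))))

    twenty-darts : numDarts A X ≤ 20
    twenty-darts = ℕ.≤-trans (ℕ.≤-reflexive (trans (sumF≡∑ n _) (trans (∑-cong λ u → countF≡cnt n _) (trans (∑-cong λ u → ∑-cong λ v → cong ⟦_⟧ (sym (cong (λ p → E (proj₁ p) (proj₂ p)) (Fin.remQuot-combine u v)))) (sym (∑-combine n _))))))
      (ℕ.≤-trans (cnt-≤ (λ p → dart (remQuot {n} n p)) (λ p → distinct (remQuot {5} 5 p)) (λ p _ → combine (idx (proj₁ (remQuot {n} n p))) (idx (proj₂ (remQuot {n} n p))))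
          (λ p e → trans (cong distinct (Fin.remQuot-combine (idx (proj₁ (remQuot {n} n p))) (idx (proj₂ (remQuot {n} n p))))) (cong not (≢⇒==false (E⇒idx≢ e))))
          (λ p e p′ e′ q → trans (sym (Fin.combine-remQuot {n} n p)) (trans (cong (λ (u , v) → combine u v) (same e e′ q)) (Fin.combine-remQuot {n} n p′))))
        -- Evaluation: 20 of the 25 pairs are off the diagonal.
        (ℕ.≤-reflexive (sym (countF≡cnt 25 (λ p → distinct (remQuot {5} 5 p))))))
      where
      dart : Fin n × Fin n → Bool
      dart (u , v) = E u v
      distinct : Fin 5 × Fin 5 → Bool
      distinct (i , j) = not (i == j)
      same : ∀ {u v u′ v′} → E u v ≡ true → E u′ v′ ≡ true → combine (idx u) (idx v) ≡ combine (idx u′) (idx v′) → (u , v) ≡ (u′ , v′)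
      same {u} {v} {u′} {v′} e e′ q = cong₂ _,_
        (trans (sym (ι-idx u (E⇒Xˡ e))) (trans (cong ι (Fin.combine-injectiveˡ (idx u) (idx v) (idx u′) (idx v′) q)) (ι-idx u′ (E⇒Xˡ e′))))
        (trans (sym (ι-idx v (E⇒Xʳ e))) (trans (cong ι (Fin.combine-injectiveʳ (idx u) (idx v) (idx u′) (idx v′) q)) (ι-idx v′ (E⇒Xʳ e′))))

  genus≤1 : ∀ g → EulerGenus≤ (suc g) A X
  -- Twice one component plus 10 edges is 12, and so is 1 + 5 vertices + 6 faces; `g` is slack.
  genus≤1 g = rotation , ℕ.≤-trans (ℕ.+-mono-≤ (ℕ.*-monoʳ-≤ 2 one-component) (ℕ.⌊n/2⌋-mono twenty-darts))
    (ℕ.≤-trans (ℕ.m≤n+m 12 g) (ℕ.≤-trans (ℕ.≤-reflexive (ℕ.+-suc g 11)) (ℕ.≤-trans (ℕ.≤-reflexive (sym (ℕ.+-assoc (suc g) 5 6)))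
      (ℕ.+-mono-≤ (ℕ.+-monoʳ-≤ (suc g) five-vertices) (ℕ.≤-trans (ℕ.⌊n/2⌋-mono twelve-orbits) (ℕ.m≤m+n _ _))))))

-- K_{k+1} joined to r = q + 1 disjoint copies of K₅.
module Join (k q : ℕ) where
  r N : ℕ
  r = suc q
  N = suc k + r * 5

  Kind : Set
  Kind = Fin (suc k) ⊎ (Fin r × Fin 5)

  kind : Fin N → Kind
  kind v = [ inj₁ , (λ p → inj₂ (remQuot 5 p)) ]′ (splitAt (suc k) v)

  core : Fin (suc k) → Fin N
  core i = i ↑ˡ (r * 5)

  block : Fin r → Fin 5 → Fin N
  block b i = suc k ↑ʳ combine b i

  unkind : Kind → Fin N
  unkind (inj₁ i) = core i
  unkind (inj₂ (b , i)) = block b i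

  kind-core : ∀ i → kind (core i) ≡ inj₁ i
  kind-core i = cong [ _ , _ ]′ (Fin.splitAt-↑ˡ (suc k) i (r * 5))

  kind-block : ∀ b i → kind (block b i) ≡ inj₂ (b , i)
  kind-block b i = trans (cong [ _ , _ ]′ (Fin.splitAt-↑ʳ (suc k) (r * 5) (combine b i))) (cong inj₂ (Fin.remQuot-combine b i))

  unkind-kind : ∀ v → unkind (kind v) ≡ v
  unkind-kind v = trans (go (splitAt (suc k) v)) (Fin.join-splitAt (suc k) (r * 5) v)
    where
    go : ∀ s → unkind ([ inj₁ , (λ p → inj₂ (remQuot 5 p)) ]′ s) ≡ join (suc k) (r * 5) s
    go (inj₁ i) = refl
    go (inj₂ p) = cong (suc k ↑ʳ_) (Fin.combine-remQuot {r} 5 p)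

  joined : Kind → Kind → Bool
  joined (inj₁ _) _ = true
  joined (inj₂ _) (inj₁ _) = true
  joined (inj₂ (b , _)) (inj₂ (b′ , _)) = b == b′

  joined-sym : ∀ s t → joined s t ≡ joined t s
  joined-sym (inj₁ _) (inj₁ _) = refl
  joined-sym (inj₁ _) (inj₂ _) = refl
  joined-sym (inj₂ _) (inj₁ _) = refl
  joined-sym (inj₂ (b , _)) (inj₂ (b′ , _)) = ==-sym b b′

  Γ : Graph N
  Γ = record
    { adj = λ u v → not (u == v) ∧ joined (kind u) (kind v)
    ; sym = λ u v → cong₂ _∧_ (cong not (==-sym u v)) (joined-sym (kind u) (kind v))
    ; irrefl = λ v → cong (λ t → not t ∧ joined (kind v) (kind v)) (==-refl v) }

  Γ-adj : ∀ {u v} → u ≢ v → joined (kind u) (kind v) ≡ true → adj Γ u v ≡ true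
  Γ-adj ne j = ∧-true (cong not (≢⇒==false ne)) j

  target : Target k r Γ
  target = record
    { core = core
    ; core-injective = λ {i} {j} e → Fin.↑ˡ-injective (r * 5) i j e
    ; core-adj = λ i w ne → Γ-adj {core i} {w} (ne ∘ sym) (cong (λ t → joined t (kind w)) (kind-core i))
    ; block = block
    ; block-injective = λ {b} {b′} {i} {i′} e → same (trans (sym (kind-block b i)) (trans (cong kind e) (kind-block b′ i′)))
    ; block-adj = λ b {i} {i′} ne → Γ-adj {block b i} {block b i′} (λ e → ne (proj₂ (same (trans (sym (kind-block b i)) (trans (cong kind e) (kind-block b i′))))))
        (trans (cong₂ joined (kind-block b i) (kind-block b i′)) (==-refl b)) }
    where
    same : ∀ {b b′ : Fin r} {i i′ : Fin 5} → _≡_ {A = Kind} (inj₂ (b , i)) (inj₂ (b′ , i′)) → b ≡ b′ × i ≡ i′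
    same refl = refl , refl

  nbr : ∀ v → ∃ λ w → adj Γ v w ≡ true
  nbr v = go (kind v) refl
    where
    go : ∀ s → kind v ≡ s → ∃ λ w → adj Γ v w ≡ true
    go (inj₁ i) eq = block zero zero , Γ-adj {v} {block zero zero} (λ e → case trans (sym eq) (trans (cong kind e) (kind-block zero zero)) of λ ()) (cong (λ t → joined t (kind (block zero zero))) eq)
    go (inj₂ p) eq = core zero , Γ-adj {v} {core zero} (λ e → case trans (sym eq) (trans (cong kind e) (kind-core zero)) of λ ()) (cong₂ joined eq (kind-core zero))

  -- Two different bags meet exactly in the core, so the shape of the tree is arbitrary; a star
  -- keeps connectivity and the edge count short.
  𝕋 : Adj r
  𝕋 a b = (a == zero) xor (b == zero)

  star : IsTree 𝕋
  star = record
    { sym = λ a b → xor-comm (a == zero) (b == zero)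
    ; irrefl = λ a → xor-same (a == zero)
    ; nonempty = s≤s z≤n
    ; connected = λ a b → reach-trans 𝕋 (to-centre a) (from-centre b)
    ; edges = trans (cong ⌊_/2⌋ darts) (sym (ℕ.n≡⌊n+n/2⌋ q)) }
    where
    to-centre : ∀ a → reach 𝕋 a zero ≡ true
    to-centre zero = reach-refl 𝕋 zero
    to-centre (suc a) = reach-edge 𝕋 {suc a} {zero} refl
    from-centre : ∀ b → reach 𝕋 zero b ≡ true
    from-centre zero = reach-refl 𝕋 zero
    from-centre (suc b) = reach-edge 𝕋 {zero} {suc b} refl
    darts : numDarts 𝕋 full ≡ q + q
    darts = trans (sumF≡∑ r _) (trans (∑-cong λ a → countF≡cnt r (𝕋 a)) (trans (∑-suc _) (cong₂ _+_
      (trans (∑-suc _) (cnt-true q)) (trans (∑-cong λ a → ∑-δ {r} zero) (cnt-true q)))))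

  isCore : Kind → Bool
  isCore (inj₁ _) = true
  isCore (inj₂ _) = false

  inBag : Fin r → Kind → Bool
  inBag x (inj₁ _) = true
  inBag x (inj₂ (b , _)) = x == b

  β : Fin r → Mask N
  β x v = inBag x (kind v)

  few-core : ∀ (p : Mask N) → (∀ v → p v ≡ true → isCore (kind v) ≡ true) → countF N p ≤ suc k
  few-core p h = ℕ.≤-trans (ℕ.≤-reflexive (countF≡cnt N p)) (ℕ.≤-trans (cnt-≤ p (λ (_ : Fin (suc k)) → true) (λ v e → index (kind v) (h v e)) (λ _ _ → refl)
      (λ u eu v ev e → trans (sym (back u (h u eu))) (trans (cong core e) (back v (h v ev))))) (ℕ.≤-reflexive (cnt-true (suc k))))
    where
    index : ∀ s → isCore s ≡ true → Fin (suc k)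
    index (inj₁ i) _ = i
    back : ∀ v (e : isCore (kind v) ≡ true) → core (index (kind v) e) ≡ v
    back v e = trans (go (kind v) e) (unkind-kind v)
      where
      go : ∀ s e → core (index s e) ≡ unkind s
      go (inj₁ i) _ = refl

  decomposition : TreeDecomposition (adj Γ)
  decomposition = record
    { t = r ; T = 𝕋 ; isTree = star ; β = β
    ; coverV = λ v → bagOf (kind v) , bagOf-in (kind v)
    ; coverE = λ u v e → common (kind u) (kind v) (∧-snd {not (u == v)} e)
    ; subtree = λ v x y hx hy → connect (kind v) x y hx hy }
    where
    bagOf : Kind → Fin r
    bagOf (inj₁ _) = zero
    bagOf (inj₂ (b , _)) = b
    bagOf-in : ∀ s → inBag (bagOf s) s ≡ true
    bagOf-in (inj₁ _) = refl
    bagOf-in (inj₂ (b , _)) = ==-refl b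
    common : ∀ s t → joined s t ≡ true → ∃ λ x → inBag x s ∧ inBag x t ≡ true
    common (inj₁ _) t _ = bagOf t , bagOf-in t
    common (inj₂ (b , _)) (inj₁ _) _ = b , ∧-true (==-refl b) refl
    common (inj₂ (b , _)) (inj₂ (b′ , _)) e = b , ∧-true (==-refl b) e
    connect : ∀ s x y → inBag x s ≡ true → inBag y s ≡ true → reach (adjM 𝕋 (λ z → inBag z s)) x y ≡ true
    connect (inj₁ _) x y _ _ = IsTree.connected star x y
    connect (inj₂ (b , i)) x y hx hy rewrite ==⇒≡ x b hx | ==⇒≡ y b hy = reach-refl (adjM 𝕋 (λ z → inBag z (inj₂ (b , i)))) b

  -- The core is the apex set. What remains of the bag is one block, whose vertices are already
  -- pairwise adjacent in Γ, so the edges added by the torso leave it a K₅.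
  torso-genus : ∀ x → InC (suc k) (suc k) (torso (adj Γ) (β x)) (β x)
  torso-genus x = (λ v → isCore (kind v)) , (λ v → core-in (kind v)) , few-core (λ v → isCore (kind v)) (λ _ e → e) ,
      ProjectiveK₅.genus≤1 Tor X′ (block x) (λ v → idx (kind v))
        (λ i → trans (cong (λ s → inBag x s ∧ not (isCore s)) (kind-block x i)) (cong (_∧ true) (==-refl x)))
        (λ v h → trans (recover (kind v) h) (unkind-kind v)) (λ i → cong idx (kind-block x i)) complete k
    where
    Tor : Adj N
    Tor = torso (adj Γ) (β x)
    X′ : Mask N
    X′ v = β x v ∧ not (isCore (kind v))
    core-in : ∀ s → isCore s ≡ true → inBag x s ≡ true
    core-in (inj₁ _) _ = refl
    idx : Kind → Fin 5
    idx (inj₁ _) = zero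
    idx (inj₂ (_ , i)) = i
    recover : ∀ s → inBag x s ∧ not (isCore s) ≡ true → block x (idx s) ≡ unkind s
    recover (inj₂ (b , i)) h = cong (λ t → block t i) (==⇒≡ x b (∧-fst {x == b} h))
    adjacent : ∀ s t → inBag x s ∧ not (isCore s) ≡ true → inBag x t ∧ not (isCore t) ≡ true → joined s t ≡ true
    adjacent (inj₂ (b , _)) (inj₂ (b′ , _)) h h′ = ≡⇒== (trans (sym (==⇒≡ x b (∧-fst {x == b} h))) (==⇒≡ x b′ (∧-fst {x == b′} h′)))
    complete : ∀ u v → adjM Tor X′ u v ≡ X′ u ∧ (X′ v ∧ not (u == v))
    complete u v = ∧-congʳ-if {X′ u} λ hu → ∧-congʳ-if {X′ v} λ hv → iff⇒≡
      (λ h → ∧-fst {not (u == v)} (∧-snd {β x v} (∧-snd {β x u} h)))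
      (λ h → ∧-true (∧-fst {β x u} hu) (∧-true (∧-fst {β x v} hv) (∧-true h (∨-injˡ (∧-true h (adjacent (kind u) (kind v) hu hv))))))

  Γ∈ℋ : ℋ (suc k) Γ
  Γ∈ℋ = decomposition , (λ x y e → few-core (λ v → β x v ∧ β y v) (λ v h → only-core (kind v) x y e h)) , torso-genus
    where
    only-core : ∀ s x y → 𝕋 x y ≡ true → inBag x s ∧ inBag y s ≡ true → isCore s ≡ true
    only-core (inj₁ _) x y _ _ = refl
    only-core (inj₂ (b , _)) x y e h rewrite ==⇒≡ x b (∧-fst {x == b} h) | ==⇒≡ y b (∧-snd {x == b} h) = ⊥-elim (true≢false e (xor-same (b == zero)))

theorem1p9 : ∀ (k : ℕ) → Σ ℕ (λ n → Σ ℕ (λ m → Σ (Graph n) (λ G → Σ (Graph m) (λ H →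
    HomEquivℋ k G H × ¬ HomEquivℋ (suc k) G H))))
theorem1p9 k = N * 2 ^ N , N * 2 ^ N , cfi false , cfi true ,
    (λ a F F∈ℋ → cfi-indistinguishable F λ φ _ → ℋ⇒¬certificate F Γ target (core zero) φ F∈ℋ) ,
    -- Γ itself is the distinguishing graph.
    (λ equiv → ℕ.<-irrefl (sym (equiv N Γ Γ∈ℋ)) (cfi-distinguished nbr))
  where
  -- `Join` takes one less than the number of blocks, which is therefore 3k + 1: k for the
  -- separator, k for the apices, and k + 1 to exceed the genus.
  open Join k (k + (k + k))
  open CFI Γ (core zero)
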